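{- Let $k \ge 5$ be an odd integer, let $t=\lfloor (k-1)/2\rfloor$, and let $F$ be a graph with $p(F)\ge t+1$. Let $\mathcal{F}=\mathcal{C}_{\ge k}\cup\{F\}$, and let $\mathcal{H}=\{F[S] : S \text{ is a vertex covering of } F\}$. Then for all sufficiently large $n$, $$\mathrm{ex}_{2\text{ -conn}}(n,\mathcal{F})=\mathrm{ex}(t,\mathcal{H})+t(n-t).$$
   Context: All graphs are finite and simple. A graph is $\mathcal{G}$-free, for a family $\mathcal{G}$ of graphs, if it contains no member of $\mathcal{G}$ as a (not necessarily induced) subgraph. $\mathrm{ex}(n,\mathcal{G})$ is the maximum number of edges in an $n$-vertex $\mathcal{G}$-free graph. $\mathrm{ex}_{2\text{ -conn}}(n,\mathcal{G})$ is the maximum number of edges among all $n$-vertex graphs that are 2-connected and $\mathcal{G}$-free. $\mathcal{C}_{\ge k}$ is the set of all cycles of length at least $k$. A vertex covering of $F$ is a set $S\subseteq V(F)$ such that $V(F)\setminus S$ is an independent set in $F$. If $F$ is bipartite, $p(F)$ is the smallest possible size of a color class among all proper 2-colorings of $F$; if $F$ is not bipartite, $p(F)=\infty$. "Sufficiently large $n$" means $n\ge n_0$ for some $n_0$ depending only on $k$ and $F$. -}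

module Defs where

open import Data.Bool.Base using (Bool; true; false; T; _∨_; _∧_)
open import Data.Bool.Properties using (∨-comm; ∨-idem; ∧-zeroʳ; T?)
  renaming (_≟_ to _≟ᵇ_)
open import Data.Fin.Base using (Fin; zero; suc; toℕ)
open import Data.Fin.Properties using (_<?_)
open import Data.Fin.Subset using (Subset; _∉_; ∁; ⁅_⁆; ∣_∣)
open import Data.List.Base using (allFin; cartesianProduct; filter; length)
open import Data.Nat.Base using (ℕ; zero; suc; _+_; _≤_; _≡ᵇ_)
open import Data.Product.Base using (∃; ∃₂; _×_; _,_)
open import Data.Vec.Base using ([]; _∷_; tabulate)
open import Function.Definitions using (Injective)
open import Level using (0ℓ)
open import Relation.Binary.Construct.Closure.ReflexiveTransitive using (Star)
open import Relation.Binary.PropositionalEquality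
  using (_≡_; _≢_; refl; cong; cong₂; trans)
open import Relation.Nullary using (¬_)
open import Relation.Nullary.Construct.Add.Supremum using (_⁺; [_]; ⊤⁺)
open import Relation.Nullary.Decidable using (does; _×-dec_)
open import Relation.Unary using (Pred)

record Graph (n : ℕ) : Set where
  field
    adj    : Fin n → Fin n → Bool
    sym    : ∀ i j → adj i j ≡ adj j i
    irrefl : ∀ i → adj i i ≡ false

  infix 4 _∼_
  _∼_ : Fin n → Fin n → Set
  i ∼ j = T (adj i j)

  edges : ℕ
  edges = length (filter (λ (i , j) → (i <? j) ×-dec T? (adj i j))
                         (cartesianProduct (allFin n) (allFin n)))

open Graph using (edges)

-- The increasing enumeration of the elements of a subset.
enum : ∀ {n} (S : Subset n) → Fin ∣ S ∣ → Fin n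
enum (true  ∷ S) zero    = zero
enum (true  ∷ S) (suc i) = suc (enum S i)
enum (false ∷ S) i       = suc (enum S i)

-- G [[ S ]] is the induced subgraph, with the vertices of S renumbered.
infix 20 _[[_]]
_[[_]] : ∀ {n} → Graph n → (S : Subset n) → Graph ∣ S ∣
G [[ S ]] = record
  { adj    = λ i j → Graph.adj G (enum S i) (enum S j)
  ; sym    = λ i j → Graph.sym G (enum S i) (enum S j)
  ; irrefl = λ i → Graph.irrefl G (enum S i)
  }

-- Not necessarily induced.
infix 4 _⊑_
_⊑_ : ∀ {m n} → Graph m → Graph n → Set
H ⊑ G = ∃ λ f → Injective _≡_ _≡_ f × (∀ i j → i ∼ᴴ j → f i ∼ᴳ f j)
  where
  open Graph H renaming (_∼_ to _∼ᴴ_)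
  open Graph G renaming (_∼_ to _∼ᴳ_)

Family : Set₁
Family = Pred (∃ Graph) 0ℓ

Free : ∀ {n} → Family → Graph n → Set
Free 𝒢 G = ∀ {m} (H : Graph m) → 𝒢 (m , H) → ¬ (H ⊑ G)

Connected : ∀ {n} → Graph n → Set
Connected G = ∀ i j → Star (Graph._∼_ G) i j

TwoConnected : ∀ {n} → Graph n → Set
TwoConnected {n} G = 3 ≤ n × Connected G × (∀ v → Connected (G [[ ∁ ⁅ v ⁆ ]]))

IsMinimum IsMaximum : Pred ℕ 0ℓ → ℕ → Set
IsMinimum P x = P x × (∀ y → P y → x ≤ y)
IsMaximum P x = P x × (∀ y → P y → y ≤ x)

-- Extremal numbers are given by their graphs: Ex n 𝒢 e says ex(n,𝒢) = e.
-- If no graph qualifies, the extremal number has no value.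
Ex Ex₂₋conn : ℕ → Family → ℕ → Set
Ex n 𝒢 = IsMaximum λ e → ∃ λ (G : Graph n) → Free 𝒢 G × edges G ≡ e
Ex₂₋conn n 𝒢 = IsMaximum λ e →
  ∃ λ (G : Graph n) → TwoConnected G × Free 𝒢 G × edges G ≡ e

-- The arcs 0 → 1 → ⋯ → m + 2 → 0.
arc : ∀ m → Fin (3 + m) → Fin (3 + m) → Bool
arc m i j = (suc (toℕ i) ≡ᵇ toℕ j) ∨ ((toℕ i ≡ᵇ 2 + m) ∧ (toℕ j ≡ᵇ 0))

private
  suc≢ᵇ : ∀ n → (suc n ≡ᵇ n) ≡ false
  suc≢ᵇ zero    = refl
  suc≢ᵇ (suc n) = suc≢ᵇ n

  arc-irrefl : ∀ m i → arc m i i ≡ false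
  arc-irrefl m zero    = refl
  arc-irrefl m (suc i) = cong₂ _∨_ (suc≢ᵇ (toℕ i)) (∧-zeroʳ (toℕ i ≡ᵇ 1 + m))

-- The cycle of length 3 + m.
cycle : ∀ m → Graph (3 + m)
cycle m = record
  { adj    = λ i j → arc m i j ∨ arc m j i
  ; sym    = λ i j → ∨-comm (arc m i j) (arc m j i)
  ; irrefl = λ i → trans (∨-idem (arc m i i)) (arc-irrefl m i)
  }

data Cycles≥ (k : ℕ) : Family where
  cyc : ∀ m → k ≤ 3 + m → Cycles≥ k (3 + m , cycle m)

VertexCovering : ∀ {n} → Graph n → Subset n → Set
VertexCovering F S = ∀ i j → i ∉ S → j ∉ S → ¬ (Graph._∼_ F i j)

data CoveringSubgraphs {n} (F : Graph n) : Family where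
  cov : ∀ S → VertexCovering F S → CoveringSubgraphs F (∣ S ∣ , F [[ S ]])

ProperTwoColouring : ∀ {n} → Graph n → (Fin n → Bool) → Set
ProperTwoColouring F c = ∀ i j → Graph._∼_ F i j → c i ≢ c j

colourClass : ∀ {n} → (Fin n → Bool) → Bool → Subset n
colourClass c b = tabulate λ i → does (c i ≟ᵇ b)

Bipartite : ∀ {n} → Graph n → Set
Bipartite F = ∃ (ProperTwoColouring F)

-- HasP F q says p(F) = q, where ⊤⁺ plays the role of ∞.
data HasP {n} (F : Graph n) : ℕ ⁺ → Set where
  finite   : ∀ {x} →
             IsMinimum (λ s → ∃₂ λ c b →
               ProperTwoColouring F c × ∣ colourClass c b ∣ ≡ s) x →
             HasP F [ x ]
  infinite : ¬ Bipartite F → HasP F ⊤⁺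

-- Write c = 2t, so that k = c + 1.  The join of an extremal graph on t vertices
-- with n - t independent vertices gives the lower bound; the bound on its cycles
-- holds because no two consecutive vertices of a cycle are independent ones.
--
-- Conversely let G be 2-connected without cycles longer than c and with at least
-- t(n - t) edges.  By Pósa's lemma a subgraph of minimum degree > t has at most c
-- vertices, so the vertices of G can be ordered with at most t later neighbours
-- each, apart from the last c; by the number of edges, all but boundedly many
-- have exactly t.  Starting from the exceptional vertices, repeatedly
-- add the vertices with t neighbours in the set obtained so far.  A vertex that is
-- missing after i rounds starts a path of length i, and paths of a 2-connected
-- graph are bounded in terms of its longest cycle; so boundedly many rounds reach
-- all n vertices, and when n is large some round adds many vertices.  Many of
-- these share t neighbours: G contains a complete bipartite graph with parts A of
-- size t and B large.  An edge outside A would extend to a cycle longer than c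
-- through A, hence G has at most e(G[A]) + t(n - t) edges.  A copy of some F[S] in
-- G[A] would extend to a copy of F by vertices of B.
module Submission where

open import Defs
open import Algebra.Properties.CommutativeSemigroup using (interchange; x∙yz≈y∙xz)
open import Data.Bool.Base using (Bool; true; false; T; if_then_else_; not; _∧_; _∨_)
open import Data.Bool.Properties
  using (T?; T-∧; T-∨; ∧-comm; ∧-idem; ∧-identityʳ; ∧-zeroʳ)
  renaming (_≟_ to _≟ᵇ_)
open import Data.Empty using (⊥; ⊥-elim)
open import Data.Fin.Base as Fin
  using (Fin; zero; suc; toℕ; cast; inject≤; inject₁; fromℕ; splitAt; _↑ˡ_; _↑ʳ_)
import Data.Fin.Properties as Fin
open import Data.Fin.Subset as Subset using (Subset; ∁; ⁅_⁆; ∣_∣)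
import Data.Fin.Subset.Properties as Subset
open import Data.List.Base
  using (List; []; _∷_; _++_; _∷ʳ_; length; allFin; filter; filterᵇ; lookup; map; tabulate;
         cartesianProduct)
open import Data.List.Membership.Propositional using (_∈_; _∉_; find; lose)
open import Data.List.Membership.Propositional.Properties
  using (∈-∃++; ∈-++⁺ˡ; ∈-++⁺ʳ; ∈-++⁻; ∈-allFin; ∈-lookup; ∈-map⁺; ∈-map⁻)
open import Data.List.Properties
  using (length-tabulate; length-map; length-++; ++-assoc; ∷-injective; map-id; map-tabulate;
         tabulate-lookup)
open import Data.List.Relation.Binary.Permutation.Propositional as Perm
  using (_↭_; ↭-sym; ↭-trans; ↭-refl; ↭-reflexive; prep; swap; ↭⇒↭ₛ)
open import Data.List.Relation.Binary.Permutation.Propositional.Properties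
  using (shift; ↭-length; ∈-resp-↭; ++-comm; ++⁺ˡ; ++⁺ʳ; ∷↭∷ʳ)
import Data.List.Relation.Binary.Permutation.Setoid.Properties as PermS
open import Data.List.Relation.Unary.All as All using (All; []; _∷_)
open import Data.List.Relation.Unary.AllPairs using (AllPairs; []; _∷_)
import Data.List.Relation.Unary.AllPairs.Properties as AllPairs
open import Data.List.Relation.Unary.Any as Any using (here; there; any?)
open import Data.List.Relation.Unary.Unique.Propositional using (Unique)
import Data.List.Relation.Unary.Unique.Propositional.Properties as Uniq
open import Data.Nat.Base
open import Data.Nat.Divisibility using (_∤_; divides)
open import Data.Nat.Properties
open import Data.Product.Base using (∃; ∃₂; _×_; _,_; proj₁; proj₂; ∃-syntax)
open import Data.Sum.Base as Sum using (_⊎_; inj₁; inj₂; [_,_]′)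
open import Data.Unit.Base using (⊤; tt)
open import Data.Vec.Base as Vec using (Vec; []; _∷_; here; there)
import Data.Vec.Properties as Vec
open import Function.Base using (_∘_; id)
open import Function.Bundles using (module Equivalence)
open import Function.Definitions using (Injective)
open import Relation.Binary.Construct.Add.Supremum.NonStrict _≤_ using (_≤⁺_; [≤]-injective)
open import Relation.Binary.Construct.Closure.ReflexiveTransitive using (Star; ε; _◅_)
open import Relation.Binary.PropositionalEquality
open import Relation.Nullary
open import Relation.Nullary.Construct.Add.Supremum using (_⁺; [_])
open import Relation.Nullary.Decidable
  using (⌊_⌋; toWitness; fromWitness; isYes≗does; dec-true; dec-false;
         _×-dec_; _⊎-dec_; _→-dec_; ¬?; map′)
open import Relation.Unary using (_∪_; ｛_｝; Decidable)

-- 2-connectedness is used mainly through `Link`: two disjoint paths between two vertex sets with a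
-- prescribed vertex of each set among the ends. The prescribed ends make one lemma serve three
-- purposes: Pósa's lemma when the chords from the ends of a path do not cross, a cycle through both
-- ends of a path, and a path through a given edge that joins two vertices of the bipartite graph.
--
-- Pósa's lemma wants a path on more than c vertices. A component of the subgraph of minimum degree
-- > t may be too small for one, so only the ends of a path are required to lie in the subgraph; the
-- rest may cross other vertices to reach a second component.
--
-- c = 2t is used twice: (t + 1) + (t + 1) = c + 2 is what Pósa's lemma needs, and a cycle
-- alternating between A and B has c vertices already, so an edge in place of one vertex of B is too
-- much.
--
-- `Ex` asserts that a maximum is attained, so the existence of ex(t,H) is part of the claim. The
-- condition on p(F) makes the edgeless graph on t vertices a candidate, and a search over adjacency
-- matrices finds the maximum.

-- Counting and pigeonhole in lists

module Counting where

  private variable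
    A : Set
    p : A → Bool
    x y : A
    xs ys : List A

  𝟙 : Bool → ℕ
  𝟙 b = if b then 1 else 0

  𝟙≤1 : ∀ b → 𝟙 b ≤ 1
  𝟙≤1 true  = ≤-refl
  𝟙≤1 false = z≤n

  𝟙-T : ∀ {b} → T b → 𝟙 b ≡ 1
  𝟙-T {true} _ = refl

  𝟙-¬T : ∀ {b} → ¬ T b → 𝟙 b ≡ 0
  𝟙-¬T {true}  ¬t = contradiction _ ¬t
  𝟙-¬T {false} ¬t = refl

  count : (A → Bool) → List A → ℕ
  count p []       = 0
  count p (x ∷ xs) = 𝟙 (p x) + count p xs

  count-++ : ∀ (p : A → Bool) xs ys → count p (xs ++ ys) ≡ count p xs + count p ys
  count-++ p []       ys = refl
  count-++ p (x ∷ xs) ys =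
    trans (cong (𝟙 (p x) +_) (count-++ p xs ys)) (sym (+-assoc (𝟙 (p x)) _ _))

  count-↭ : ∀ (p : A → Bool) {xs ys} → xs ↭ ys → count p xs ≡ count p ys
  count-↭ p Perm.refl        = refl
  count-↭ p (prep x r)       = cong (𝟙 (p x) +_) (count-↭ p r)
  count-↭ p (swap {xs} {ys} x y r) = begin
    𝟙 (p x) + (𝟙 (p y) + count p xs) ≡⟨ +-assoc (𝟙 (p x)) _ _ ⟨
    𝟙 (p x) + 𝟙 (p y) + count p xs   ≡⟨ cong₂ _+_ (+-comm (𝟙 (p x)) _) (count-↭ p r) ⟩
    𝟙 (p y) + 𝟙 (p x) + count p ys   ≡⟨ +-assoc (𝟙 (p y)) _ _ ⟩
    𝟙 (p y) + (𝟙 (p x) + count p ys) ∎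
    where open ≡-Reasoning
  count-↭ p (Perm.trans r s) = trans (count-↭ p r) (count-↭ p s)

  count≤length : ∀ (p : A → Bool) xs → count p xs ≤ length xs
  count≤length p []       = z≤n
  count≤length p (x ∷ xs) = +-mono-≤ (𝟙≤1 (p x)) (count≤length p xs)

  count-none : All (λ z → ¬ T (p z)) xs → count p xs ≡ 0
  count-none []         = refl
  count-none (¬px ∷ ps) = cong₂ _+_ (𝟙-¬T ¬px) (count-none ps)

  count-all : All (λ z → T (p z)) xs → count p xs ≡ length xs
  count-all []        = refl
  count-all (px ∷ ps) = cong₂ _+_ (𝟙-T px) (count-all ps)

  length-filterᵇ : ∀ (p : A → Bool) xs → length (filterᵇ p xs) ≡ count p xs
  length-filterᵇ p []       = refl
  length-filterᵇ p (x ∷ xs) with p x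
  ... | true  = cong suc (length-filterᵇ p xs)
  ... | false = length-filterᵇ p xs

  ∈-filterᵇ⁺ : x ∈ xs → T (p x) → x ∈ filterᵇ p xs
  ∈-filterᵇ⁺ {xs = y ∷ xs} {p = p} (here refl) px with true ← p y = here refl
  ∈-filterᵇ⁺ {xs = y ∷ xs} {p = p} (there x∈) px with p y
  ... | true  = there (∈-filterᵇ⁺ x∈ px)
  ... | false = ∈-filterᵇ⁺ x∈ px

  ∈-filterᵇ⁻ : ∀ xs → x ∈ filterᵇ p xs → x ∈ xs × T (p x)
  ∈-filterᵇ⁻ {p = p} (y ∷ xs) x∈ with p y in eq
  ∈-filterᵇ⁻ (y ∷ xs) (here refl) | true = here refl , subst T (sym eq) _
  ∈-filterᵇ⁻ (y ∷ xs) (there x∈)  | true with x∈xs , px ← ∈-filterᵇ⁻ xs x∈ = there x∈xs , px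
  ∈-filterᵇ⁻ (y ∷ xs) x∈          | false with x∈xs , px ← ∈-filterᵇ⁻ xs x∈ = there x∈xs , px

  filterᵇ-unique : Unique xs → Unique (filterᵇ p xs)
  filterᵇ-unique [] = []
  filterᵇ-unique {xs = x ∷ xs} {p = p} (x≢ ∷ u) with p x
  ... | true  = All.tabulate (λ z∈ → All.lookup x≢ (proj₁ (∈-filterᵇ⁻ xs z∈))) ∷ filterᵇ-unique u
  ... | false = filterᵇ-unique u

  ∈⇒↭ : x ∈ xs → ∃[ ys ] xs ↭ x ∷ ys
  ∈⇒↭ {x = x} x∈xs with as , bs , refl ← ∈-∃++ x∈xs = as ++ bs , shift x as bs

  Unique-↭ : xs ↭ ys → Unique xs → Unique ys
  Unique-↭ r = PermS.Unique-resp-↭ (setoid _) (↭⇒↭ₛ r)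

  ∉-∷⁻ : Unique (x ∷ xs) → x ∉ xs
  ∉-∷⁻ (x≢ ∷ _) x∈xs = All.lookup x≢ x∈xs refl

  ∉-∷⁺ : x ∉ xs → Unique xs → Unique (x ∷ xs)
  ∉-∷⁺ x∉xs u = All.tabulate (λ { y∈ refl → x∉xs y∈ }) ∷ u

  -- Each counted entry of `us` is cancelled against its occurrence in `ls`; uniqueness of `us`
  -- prevents a second use of that occurrence.
  count-⊆ : ∀ (p : A → Bool) {us ls} → Unique us →
            (∀ {u} → u ∈ us → T (p u) → u ∈ ls) → count p us ≤ count p ls
  count-⊆ p {[]} _ _ = z≤n
  count-⊆ p {u ∷ us} {ls} u! sub with T? (p u)
  ... | no ¬pu rewrite 𝟙-¬T ¬pu with _ ∷ us! ← u! = count-⊆ p us! (λ v∈ → sub (there v∈))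
  ... | yes pu with ls′ , r ← ∈⇒↭ (sub (here refl) pu) | _ ∷ us! ← u! = begin
    𝟙 (p u) + count p us  ≤⟨ +-monoʳ-≤ (𝟙 (p u)) (count-⊆ p us! sub′) ⟩
    𝟙 (p u) + count p ls′ ≡⟨ count-↭ p r ⟨
    count p ls            ∎
    where
    open ≤-Reasoning
    sub′ : ∀ {v} → v ∈ us → T (p v) → v ∈ ls′
    sub′ v∈ pv with ∈-resp-↭ r (sub (there v∈) pv)
    ... | here refl  = contradiction v∈ (∉-∷⁻ u!)
    ... | there v∈ls = v∈ls

  length-⊆ : Unique xs → (∀ {u} → u ∈ xs → u ∈ ys) → length xs ≤ length ys
  length-⊆ {xs = xs} {ys} u sub = begin
    length xs             ≡⟨ count-all (All.universal _ xs) ⟨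
    count (λ _ → true) xs ≤⟨ count-⊆ _ u (λ x∈ _ → sub x∈) ⟩
    count (λ _ → true) ys ≡⟨ count-all (All.universal _ ys) ⟩
    length ys             ∎
    where open ≤-Reasoning

  ⊆-↭ : Unique xs → (∀ {u} → u ∈ xs → u ∈ ys) → length ys ≤ length xs → xs ↭ ys
  ⊆-↭ {xs = []} {[]} _ _ _ = ↭-refl
  ⊆-↭ {xs = x ∷ xs} {ys} u@(_ ∷ xs!) sub le with ys′ , r ← ∈⇒↭ (sub (here refl)) =
    ↭-trans (prep x (⊆-↭ xs! sub′ (s≤s⁻¹ (subst (_≤ _) (↭-length r) le)))) (↭-sym r)
    where
    sub′ : ∀ {v} → v ∈ xs → v ∈ ys′
    sub′ v∈ with ∈-resp-↭ r (sub (there v∈))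
    ... | here refl = contradiction v∈ (∉-∷⁻ u)
    ... | there v∈′ = v∈′

  Unique-++⁻ : ∀ (xs : List A) {ys} → Unique (xs ++ ys) →
               Unique xs × Unique ys × (∀ {z} → z ∈ xs → z ∉ ys)
  Unique-++⁻ []       u = [] , u , λ ()
  Unique-++⁻ (x ∷ xs) u@(_ ∷ u′) with uxs , uys , dis ← Unique-++⁻ xs u′ =
    ∉-∷⁺ (λ x∈ → ∉-∷⁻ u (∈-++⁺ˡ x∈)) uxs , uys ,
    λ { (here refl) z∈ys → ∉-∷⁻ u (∈-++⁺ʳ xs z∈ys) ; (there z∈xs) → dis z∈xs }

  Unique-++⁺ : Unique xs → Unique ys → (∀ {z} → z ∈ xs → z ∉ ys) → Unique (xs ++ ys)
  Unique-++⁺ uxs uys dis = Uniq.++⁺ uxs uys (λ (z∈xs , z∈ys) → dis z∈xs z∈ys)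

  Unique-∷ʳ⁺ : Unique xs → x ∉ xs → Unique (xs ∷ʳ x)
  Unique-∷ʳ⁺ u x∉ = Unique-++⁺ u ([] ∷ []) (λ { z∈ (here refl) → x∉ z∈ })

  ∈-∷ʳ⁻ : ∀ xs → y ∈ xs ∷ʳ x → y ∈ xs ⊎ y ≡ x
  ∈-∷ʳ⁻ xs y∈ with ∈-++⁻ xs y∈
  ... | inj₁ y∈xs       = inj₁ y∈xs
  ... | inj₂ (here y≡x) = inj₂ y≡x

  module _ {n : ℕ} where
    open import Data.List.Membership.DecPropositional (Fin._≟_ {n}) public using (_∈?_; _∉?_)

    length≤n : {xs : List (Fin n)} → Unique xs → length xs ≤ n
    length≤n {xs} u = subst (length xs ≤_) (length-tabulate {n = n} (λ i → i)) (length-⊆ u (λ {i} _ → ∈-allFin i))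

    -- The pigeonhole behind the extension of paths: `p` is adjacency to an end, `ls` lists the
    -- vertices to be avoided.
    ∃-new : ∀ (p : Fin n → Bool) {us ls} → Unique us → count p ls < count p us →
            ∃[ u ] u ∈ us × T (p u) × u ∉ ls
    ∃-new p {us} {ls} us! lt with any? (λ u → T? (p u) ×-dec (u ∉? ls)) us
    ... | yes a  = find a
    ... | no ¬a = contradiction (count-⊆ p us! sub) (<⇒≱ lt)
      where
      sub : ∀ {u} → u ∈ us → T (p u) → u ∈ ls
      sub {u} u∈ pu with u ∈? ls
      ... | yes u∈ls = u∈ls
      ... | no u∉ls  = contradiction (Any.map (λ { refl → pu , u∉ls }) u∈) ¬a

    ∃-new′ : ∀ {us ls : List (Fin n)} → Unique us → length ls < length us → ∃[ u ] u ∈ us × u ∉ ls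
    ∃-new′ {us} {ls} us! lt
      with u , u∈ , _ , u∉ ← ∃-new (λ _ → true) us! (subst₂ _<_
             (sym (count-all (All.universal _ ls))) (sym (count-all (All.universal _ us))) lt)
      = u , u∈ , u∉

open Counting

-- Walks, paths and cycles

module Walks {n} (G : Graph n) where
  open Graph G using (adj; _∼_)

  V : Set
  V = Fin n

  ∼-sym : ∀ {u v} → u ∼ v → v ∼ u
  ∼-sym {u} {v} = subst T (Graph.sym G u v)

  ∼-irrefl : ∀ {u} → ¬ u ∼ u
  ∼-irrefl {u} = subst T (Graph.irrefl G u)

  ∼⇒≢ : ∀ {u v} → u ∼ v → u ≢ v
  ∼⇒≢ e refl = ∼-irrefl e

  infixr 5 _∷_ _++ʷ_

  -- The list contains every vertex of the walk except the first one, so a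
  -- cycle is a closed walk whose list has no repetition.
  data Walk : V → V → List V → Set where
    []  : ∀ {u} → Walk u u []
    _∷_ : ∀ {u v w xs} → u ∼ v → Walk v w xs → Walk u w (v ∷ xs)

  private variable
    u v w x z : V
    xs ys zs as bs : List V

  _++ʷ_ : Walk u v xs → Walk v w ys → Walk u w (xs ++ ys)
  []       ++ʷ W = W
  (e ∷ W₁) ++ʷ W = e ∷ (W₁ ++ʷ W)

  split : ∀ xs → Walk u w (xs ++ v ∷ ys) → Walk u v (xs ∷ʳ v) × Walk v w ys
  split []       (e ∷ W) = (e ∷ []) , W
  split (x ∷ xs) (e ∷ W) with W₁ , W₂ ← split xs W = (e ∷ W₁) , W₂

  split-at : Walk u w xs → ∀ l {a r} → u ∷ xs ≡ l ++ a ∷ r →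
             ∃[ as ] Walk u a as × u ∷ as ≡ l ∷ʳ a × Walk a w r
  split-at W []      refl = [] , [] , refl , W
  split-at W (_ ∷ l) refl with W₁ , W₂ ← split l W = _ , W₁ , refl , W₂

  last-∈ : Walk u v xs → v ∈ u ∷ xs
  last-∈ []      = here refl
  last-∈ (_ ∷ W) = there (last-∈ W)

  last-∈′ : Walk u v xs → u ≢ v → v ∈ xs
  last-∈′ W u≢v with last-∈ W
  ... | here v≡u = contradiction (sym v≡u) u≢v
  ... | there v∈ = v∈

  last-view : Walk u v (x ∷ xs) → ∃₂ λ ys w → x ∷ xs ≡ ys ∷ʳ v × Walk u w ys × w ∼ v
  last-view (e ∷ [])          = [] , _ , refl , [] , e
  last-view (e ∷ W@(_ ∷ _)) with ys , w , eq , W′ , e′ ← last-view W =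
    _ ∷ ys , w , cong (_ ∷_) eq , e ∷ W′ , e′

  reverseʷ : Walk u v xs → ∃[ ys ] Walk v u ys × v ∷ ys ↭ u ∷ xs
  reverseʷ []      = [] , [] , ↭-refl
  reverseʷ {u} (_∷_ {v = v} {w = w} e W) with ys , W′ , r ← reverseʷ W =
    ys ∷ʳ u , W′ ++ʷ ∼-sym e ∷ [] ,
    ↭-trans (↭-sym (∷↭∷ʳ u (w ∷ ys))) (prep u r)

  ∈-split : Walk u w xs → v ∈ xs → ∃₂ λ as bs → xs ≡ as ++ v ∷ bs × Walk u v (as ∷ʳ v) × Walk v w bs
  ∈-split W v∈ with as , bs , refl ← ∈-∃++ v∈ with W₁ , W₂ ← split as W = as , bs , refl , W₁ , W₂

  rotate : Walk u u xs → v ∈ xs → ∃[ ys ] Walk v v ys × ys ↭ xs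
  rotate {v = v} W v∈ with as , bs , refl , W₁ , W₂ ← ∈-split W v∈ =
    _ , W₂ ++ʷ W₁ , ↭-trans (++-comm bs (as ∷ʳ v)) (↭-reflexive (++-assoc as (v ∷ []) bs))

  FirstHit : List V → V → V → List V → Set
  FirstHit ws u h hs = Walk u h hs × h ∈ ws × (∀ {z} → z ∈ u ∷ hs → z ∈ ws → z ≡ h)

  first-hit : ∀ ws → Walk u v xs → Unique (u ∷ xs) → v ∈ ws →
              ∃₂ λ h hs → FirstHit ws u h hs × Unique (u ∷ hs) × (∀ {z} → z ∈ hs → z ∈ xs)
  first-hit {u} ws W u! v∈ with u ∈? ws
  ... | yes u∈ = u , [] , ([] , u∈ , λ { (here refl) _ → refl }) , ([] ∷ []) , λ ()
  first-hit ws [] u! v∈ | no u∉ = contradiction v∈ u∉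
  first-hit ws (_∷_ {v = x} {xs = xs} e W) u!@(_ ∷ xs!) v∈ | no u∉
    with h , hs , (W′ , h∈ , only) , hs! , sub ← first-hit ws W xs! v∈ =
    h , x ∷ hs ,
    (e ∷ W′ , h∈ , λ { (here refl) z∈ws → contradiction z∈ws u∉ ; (there z∈) z∈ws → only z∈ z∈ws }) ,
    ∉-∷⁺ (λ u∈ → ∉-∷⁻ u! (sub′ u∈)) hs! , sub′
    where
    sub′ : ∀ {z} → z ∈ x ∷ hs → z ∈ x ∷ xs
    sub′ (here refl) = here refl
    sub′ (there z∈)  = there (sub z∈)

  record Bridge (zs js : List V) (Q : V → Set) : Set where
    constructor bridge
    field
      {a b}  : V
      {ss}   : List V
      walk   : Walk a b (ss ∷ʳ b)
      a∈zs   : a ∈ zs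
      b∈js   : b ∈ js
      inner  : All (λ s → s ∉ zs × s ∉ js × Q s) ss
      unique : Unique ss
      Qa     : Q a
      Qb     : Q b

  -- Works backwards from the end of the walk. The piece found so far leads straight to `js`; it is
  -- finished when it starts in `zs`, and when a vertex is met twice the loop in between is cut out.
  find-bridge : ∀ zs js (Q : V → Set) → (∀ {z} → z ∈ zs → z ∉ js) →
                Walk u w xs → u ∈ zs → w ∈ js → Q u → All Q xs → Bridge zs js Q
  find-bridge zs js Q dis W u∈ w∈ qu qs with go W w∈ (dis u∈) qu qs
    where
    Direct : V → Set
    Direct u = ∃₂ λ j ss → Walk u j (ss ∷ʳ j) × j ∈ js × Q j ×
               All (λ s → s ∉ zs × s ∉ js × Q s) ss × Unique ss
    go : Walk x w xs → w ∈ js → x ∉ js → Q x → All Q xs → Direct x ⊎ Bridge zs js Q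
    go [] w∈ x∉ _ _ = contradiction w∈ x∉
    go {x} (_∷_ {v = v} e W) w∈ x∉ qx (qv ∷ qs) with v ∈? js
    ... | yes v∈ = inj₁ (v , [] , (e ∷ []) , v∈ , qv , [] , [])
    ... | no v∉ with go W w∈ v∉ qv qs
    ...   | inj₂ b = inj₂ b
    ...   | inj₁ (j , ss , W′ , j∈ , qj , inn , ss!) with v ∈? zs
    ...     | yes v∈ = inj₂ (bridge W′ v∈ j∈ inn ss! qv qj)
    ...     | no v∉zs with v ∈? ss
    ...       | no v∉ss = inj₁ (j , v ∷ ss , e ∷ W′ , j∈ , qj , (v∉zs , v∉ , qv) ∷ inn , ∉-∷⁺ v∉ss ss!)
    ...       | yes v∈ss with as , bs , refl ← ∈-∃++ v∈ss
      = inj₁ (j , v ∷ bs ,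
              e ∷ proj₂ (split as (subst (Walk v j) (++-assoc as (v ∷ bs) (j ∷ [])) W′)) ,
              j∈ , qj ,
              All.tabulate (λ s∈ → All.lookup inn (∈-++⁺ʳ as s∈)) ,
              proj₁ (proj₂ (Unique-++⁻ as ss!)))
  ... | inj₂ b = b
  ... | inj₁ (j , ss , W′ , j∈ , qj , inn , ss!) = bridge W′ u∈ j∈ inn ss! qu qj

  -- Connectedness after the deletion of a vertex, stated inside the graph so that no renumbering of
  -- vertices is involved.
  Robust : Set
  Robust = ∀ v {u w} → u ≢ v → w ≢ v → ∃[ xs ] Walk u w xs × All (_≢ v) xs

-- Two disjoint paths with prescribed ends

module Linkage {n} (G : Graph n) (robust : Walks.Robust G) where
  open Graph G using (adj; _∼_)
  open Walks G

  private variable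
    x y y′ y″ : V
    ms rs I₀ : List V

  -- Two disjoint paths from x ∷ I₀ to y ∷ rs which have x and y among their ends.
  record Link (I₀ : List V) (x y : V) (rs : List V) : Set where
    constructor link
    field
      {u v j} : V
      {as bs} : List V
      A       : Walk u y as
      B       : Walk v j bs
      ends    : (u ≡ x × v ∈ I₀) ⊎ (v ≡ x × u ∈ I₀)
      j∈rs    : j ∈ rs
      unique  : Unique ((u ∷ as) ++ v ∷ bs)
      as∉I    : ∀ {z} → z ∈ as → z ∉ x ∷ I₀
      bs∉I    : ∀ {z} → z ∈ bs → z ∉ x ∷ I₀
      as∉rs   : ∀ {z} → z ∈ u ∷ as → z ∉ rs
      bs∈rs   : ∀ {z} → z ∈ v ∷ bs → z ∈ rs → z ≡ j

  -- At the start the first path is the single vertex `x`, and `robust` supplies a second path that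
  -- avoids it.
  link-base : ∀ {i r} → i ∈ I₀ → r ∈ rs → x ∉ I₀ → (∀ {z} → z ∈ x ∷ I₀ → z ∉ rs) → Link I₀ x x rs
  link-base {I₀} {rs} {x} {i} {r} i∈ r∈ x∉ dis
    with xs , W , W≢x ← robust x {i} {r} (λ { refl → x∉ i∈ }) (λ { refl → dis (here refl) r∈ })
    with bridge {a} {b} {ss} W′ a∈ b∈ inn ss! a≢x b≢x ←
           find-bridge I₀ rs (_≢ x) (λ z∈ → dis (there z∈)) W i∈ r∈ (λ { refl → x∉ i∈ }) W≢x
    = link [] W′ (inj₁ (refl , a∈)) b∈ uniq (λ ()) tail∉I
        (λ { (here refl) → dis (here refl) }) tail∈rs
    where
    tail∉I : ∀ {z} → z ∈ ss ∷ʳ b → z ∉ x ∷ I₀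
    tail∉I z∈ z∈I with ∈-∷ʳ⁻ ss z∈
    ... | inj₂ refl = dis z∈I b∈
    ... | inj₁ z∈ss with z∉I₀ , _ , z≢x ← All.lookup inn z∈ss with z∈I
    ...   | here z≡x   = z≢x z≡x
    ...   | there z∈I₀ = z∉I₀ z∈I₀
    tail∈rs : ∀ {z} → z ∈ a ∷ ss ∷ʳ b → z ∈ rs → z ≡ b
    tail∈rs (here refl) z∈rs = contradiction z∈rs (dis (there a∈))
    tail∈rs (there z∈)  z∈rs with ∈-∷ʳ⁻ ss z∈
    ... | inj₂ z≡b  = z≡b
    ... | inj₁ z∈ss = contradiction z∈rs (proj₁ (proj₂ (All.lookup inn z∈ss)))
    uniq : Unique (x ∷ a ∷ ss ∷ʳ b)
    uniq = ∉-∷⁺ (λ { (here refl) → a≢x refl ; (there x∈) → tail∉I x∈ (here refl) })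
             (∉-∷⁺ (λ a∈′ → tail∉I a∈′ (there a∈))
               (Unique-∷ʳ⁺ ss! (λ b∈ss → proj₁ (proj₂ (All.lookup inn b∈ss)) b∈)))

  -- The augmenting step of Menger's theorem: if the second path already ends in y′,
  -- leave the linkage for the last time by a path that avoids y′.
  link-step : ∀ {r} → Link I₀ x y (y′ ∷ rs) → y ∼ y′ → r ∈ rs → y′ ∉ rs →
              (∀ {z} → z ∈ x ∷ I₀ → z ∉ y′ ∷ rs) → Link I₀ x y′ rs
  link-step {I₀} {x} {y} {y′} {rs} {r}
    (link {u} {v} {j} {as} {bs} A B ends j∈rs unique as∉I bs∉I as∉rs bs∈rs) y∼y′ r∈ y′∉ dis
    = step (j Fin.≟ y′) j∈rs
    where
    u! = proj₁ (Unique-++⁻ (u ∷ as) unique)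
    v! = proj₁ (proj₂ (Unique-++⁻ (u ∷ as) unique))
    u#v = proj₂ (proj₂ (Unique-++⁻ (u ∷ as) unique))

    A′ : Walk u y′ (as ∷ʳ y′)
    A′ = A ++ʷ y∼y′ ∷ []

    y′∉A : y′ ∉ u ∷ as
    y′∉A y′∈ = as∉rs y′∈ (here refl)

    A′! : Unique (u ∷ as ∷ʳ y′)
    A′! = Unique-∷ʳ⁺ u! y′∉A

    A′∉I : ∀ {z} → z ∈ as ∷ʳ y′ → z ∉ x ∷ I₀
    A′∉I z∈ z∈I with ∈-∷ʳ⁻ as z∈
    ... | inj₁ z∈as = as∉I z∈as z∈I
    ... | inj₂ refl = dis z∈I (here refl)

    A′∉rs : ∀ {z} → z ∈ u ∷ as ∷ʳ y′ → z ∉ rs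
    A′∉rs z∈ z∈rs with ∈-∷ʳ⁻ (u ∷ as) z∈
    ... | inj₁ z∈as = as∉rs z∈as (there z∈rs)
    ... | inj₂ refl = y′∉ z∈rs

    step : Dec (j ≡ y′) → j ∈ y′ ∷ rs → Link I₀ x y′ rs
    step (no j≢y′) (here j≡y′)   = contradiction j≡y′ j≢y′
    -- The second path does not end in `y′` and hence avoids it: the first path simply takes the
    -- edge to `y′`.
    step (no j≢y′) (there j∈rs′) = link A′ B ends j∈rs′ (Unique-++⁺ A′! v! A′#v) A′∉I bs∉I A′∉rs
                          (λ z∈ z∈rs → bs∈rs z∈ (there z∈rs))
      where
      A′#v : ∀ {z} → z ∈ u ∷ as ∷ʳ y′ → z ∉ v ∷ bs
      A′#v z∈ z∈v with ∈-∷ʳ⁻ (u ∷ as) z∈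
      ... | inj₁ z∈as = u#v z∈as z∈v
      ... | inj₂ refl = j≢y′ (sym (bs∈rs z∈v (here refl)))
    step (yes refl) _ = turn
      where
      zs∉rs : ∀ {z} → z ∈ (u ∷ as) ++ (v ∷ bs) ++ x ∷ I₀ → z ∉ rs
      zs∉rs z∈ z∈rs with ∈-++⁻ (u ∷ as) z∈
      ... | inj₁ z∈A = as∉rs z∈A (there z∈rs)
      ... | inj₂ z∈′ with ∈-++⁻ (v ∷ bs) z∈′
      ...   | inj₂ z∈I = dis z∈I (there z∈rs)
      ...   | inj₁ z∈B with refl ← bs∈rs z∈B (there z∈rs) = y′∉ z∈rs

      module Turn {a b : V} {ss : List V} (W′ : Walk a b (ss ∷ʳ b))
               (a∈ : a ∈ (u ∷ as) ++ (v ∷ bs) ++ x ∷ I₀) (b∈ : b ∈ rs)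
               (inn : All (λ s → s ∉ (u ∷ as) ++ (v ∷ bs) ++ x ∷ I₀ × s ∉ rs × s ≢ y′) ss)
               (ss! : Unique ss) (a≢ : a ≢ y′) (b≢ : b ≢ y′) where

        tail∉zs : ∀ {z} → z ∈ ss ∷ʳ b → z ∉ (u ∷ as) ++ (v ∷ bs) ++ x ∷ I₀
        tail∉zs z∈ z∈zs with ∈-∷ʳ⁻ ss z∈
        ... | inj₁ z∈ss = proj₁ (All.lookup inn z∈ss) z∈zs
        ... | inj₂ refl = zs∉rs z∈zs b∈

        tail≢y′ : ∀ {z} → z ∈ ss ∷ʳ b → z ≢ y′
        tail≢y′ z∈ with ∈-∷ʳ⁻ ss z∈
        ... | inj₁ z∈ss = proj₂ (proj₂ (All.lookup inn z∈ss))
        ... | inj₂ refl = b≢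

        tail∈rs : ∀ {z} → z ∈ ss ∷ʳ b → z ∈ rs → z ≡ b
        tail∈rs z∈ z∈rs with ∈-∷ʳ⁻ ss z∈
        ... | inj₁ z∈ss = contradiction z∈rs (proj₁ (proj₂ (All.lookup inn z∈ss)))
        ... | inj₂ z≡b = z≡b

        tail! : Unique (ss ∷ʳ b)
        tail! = Unique-∷ʳ⁺ ss! (λ b∈ss → proj₁ (proj₂ (All.lookup inn b∈ss)) b∈)

        assemble : ∀ {p q ps qs} → Walk p y′ ps → Walk q a qs →
                   (p ≡ x × q ∈ I₀) ⊎ (q ≡ x × p ∈ I₀) →
                   Unique (p ∷ ps) → Unique (q ∷ qs) → (∀ {z} → z ∈ p ∷ ps → z ∉ q ∷ qs) →
                   (∀ {z} → z ∈ ps → z ∉ x ∷ I₀) → (∀ {z} → z ∈ qs → z ∉ x ∷ I₀) →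
                   (∀ {z} → z ∈ p ∷ ps → z ∉ rs) →
                   (∀ {z} → z ∈ p ∷ ps → z ∈ (u ∷ as) ++ (v ∷ bs) ++ x ∷ I₀ ⊎ z ≡ y′) →
                   (∀ {z} → z ∈ q ∷ qs → z ∈ (u ∷ as) ++ (v ∷ bs) ++ x ∷ I₀) →
                   Link I₀ x y′ rs
        assemble {p} {q} {ps} {qs} P Q ends′ p! q! p#q ps∉I qs∉I p∉rs p⊆ q⊆ =
          link P (Q ++ʷ W′) ends′ b∈
            (Unique-++⁺ p! (Unique-++⁺ q! tail! (λ z∈q z∈t → tail∉zs z∈t (q⊆ z∈q))) disj)
            ps∉I qt∉I p∉rs qt∈rs
          where
          disj : ∀ {z} → z ∈ p ∷ ps → z ∉ q ∷ qs ++ ss ∷ʳ b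
          disj z∈p z∈ with ∈-++⁻ (q ∷ qs) z∈
          ... | inj₁ z∈q = p#q z∈p z∈q
          ... | inj₂ z∈t with p⊆ z∈p
          ...   | inj₁ z∈zs = tail∉zs z∈t z∈zs
          ...   | inj₂ z≡y′ = tail≢y′ z∈t z≡y′
          qt∉I : ∀ {z} → z ∈ qs ++ ss ∷ʳ b → z ∉ x ∷ I₀
          qt∉I z∈ z∈I with ∈-++⁻ qs z∈
          ... | inj₁ z∈q = qs∉I z∈q z∈I
          ... | inj₂ z∈t = tail∉zs z∈t (∈-++⁺ʳ (u ∷ as) (∈-++⁺ʳ (v ∷ bs) z∈I))
          qt∈rs : ∀ {z} → z ∈ q ∷ qs ++ ss ∷ʳ b → z ∈ rs → z ≡ b
          qt∈rs z∈ z∈rs with ∈-++⁻ (q ∷ qs) z∈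
          ... | inj₁ z∈q = contradiction z∈rs (zs∉rs (q⊆ z∈q))
          ... | inj₂ z∈t = tail∈rs z∈t z∈rs

        A′⊆ : ∀ {z} → z ∈ u ∷ as ∷ʳ y′ → z ∈ (u ∷ as) ++ (v ∷ bs) ++ x ∷ I₀ ⊎ z ≡ y′
        A′⊆ z∈ with ∈-∷ʳ⁻ (u ∷ as) z∈
        ... | inj₁ z∈A  = inj₁ (∈-++⁺ˡ z∈A)
        ... | inj₂ z≡y′ = inj₂ z≡y′

        B⊆ : ∀ {z} → z ∈ v ∷ bs → z ∈ (u ∷ as) ++ (v ∷ bs) ++ x ∷ I₀
        B⊆ z∈ = ∈-++⁺ʳ (u ∷ as) (∈-++⁺ˡ z∈)

        B∉rs : ∀ {z} → z ∈ v ∷ bs → z ∉ rs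
        B∉rs z∈ = zs∉rs (B⊆ z∈)

        branch : Link I₀ x y′ rs
        branch with a ∈? u ∷ as
        -- The escape path leaves from `A`: the paths change roles. `B`, which ends in `y′`, becomes
        -- the first path, and `A` up to `a` goes on along the escape path.
        ... | yes a∈A with l , r , eq ← ∈-∃++ a∈A with as₁ , A₁ , eq₁ , _ ← split-at A l eq =
          assemble B A₁ (Sum.swap ends) v! (proj₁ (Unique-++⁻ (u ∷ as₁) (subst Unique eq₂ u!)))
            (λ z∈v z∈u → u#v (sub z∈u) z∈v) bs∉I
            (λ z∈ → as∉I (sub₁ z∈)) B∉rs (λ z∈ → inj₁ (B⊆ z∈)) (λ z∈ → ∈-++⁺ˡ (sub z∈))
          where
          eq₂ : u ∷ as ≡ (u ∷ as₁) ++ r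
          eq₂ = trans eq (trans (sym (++-assoc l (a ∷ []) r)) (cong (_++ r) (sym eq₁)))
          sub : ∀ {z} → z ∈ u ∷ as₁ → z ∈ u ∷ as
          sub {z} z∈ = subst (z ∈_) (sym eq₂) (∈-++⁺ˡ z∈)
          sub₁ : ∀ {z} → z ∈ as₁ → z ∈ as
          sub₁ {z} z∈ = subst (z ∈_) (sym (proj₂ (∷-injective eq₂))) (∈-++⁺ˡ z∈)
        ... | no a∉A with a ∈? v ∷ bs
        -- It leaves from `B`: `A` takes the edge to `y′`, and `B` is cut at `a`, before it reaches
        -- `y′`.
        ...   | yes a∈v with l , r , eq ← ∈-∃++ a∈v with bs₁ , B₁ , eq₁ , B₂ ← split-at B l eq =
          assemble A′ B₁ ends A′! (proj₁ (Unique-++⁻ (v ∷ bs₁) v!′))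
            disj A′∉I (λ z∈ → bs∉I (sub₁ z∈)) A′∉rs A′⊆ (λ z∈ → B⊆ (sub z∈))
          where
          eq₂ : v ∷ bs ≡ (v ∷ bs₁) ++ r
          eq₂ = trans eq (trans (sym (++-assoc l (a ∷ []) r)) (cong (_++ r) (sym eq₁)))
          v!′ = subst Unique eq₂ v!
          sub : ∀ {z} → z ∈ v ∷ bs₁ → z ∈ v ∷ bs
          sub {z} z∈ = subst (z ∈_) (sym eq₂) (∈-++⁺ˡ z∈)
          sub₁ : ∀ {z} → z ∈ bs₁ → z ∈ bs
          sub₁ {z} z∈ = subst (z ∈_) (sym (proj₂ (∷-injective eq₂))) (∈-++⁺ˡ z∈)
          y′∉B₁ : y′ ∉ v ∷ bs₁
          y′∉B₁ y′∈ with last-∈ B₂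
          ... | here y′≡a = a≢ (sym y′≡a)
          ... | there y′∈r = proj₂ (proj₂ (Unique-++⁻ (v ∷ bs₁) v!′)) y′∈ y′∈r
          disj : ∀ {z} → z ∈ u ∷ as ∷ʳ y′ → z ∉ v ∷ bs₁
          disj z∈ z∈v with ∈-∷ʳ⁻ (u ∷ as) z∈
          ... | inj₁ z∈A = u#v z∈A (sub z∈v)
          ... | inj₂ refl = y′∉B₁ z∈v
        ...   | no a∉B = from-I ends a∈I
          where
          a∈I : a ∈ x ∷ I₀
          a∈I with ∈-++⁻ (u ∷ as) a∈
          ... | inj₁ a∈A = contradiction a∈A a∉A
          ... | inj₂ a∈′ with ∈-++⁻ (v ∷ bs) a∈′
          ...   | inj₁ a∈B = contradiction a∈B a∉B
          ...   | inj₂ a∈I = a∈I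
          disj : ∀ {z} → z ∈ u ∷ as ∷ʳ y′ → z ∉ a ∷ []
          disj z∈ (here refl) with ∈-∷ʳ⁻ (u ∷ as) z∈
          ... | inj₁ z∈A = a∉A z∈A
          ... | inj₂ a≡y′ = a≢ a≡y′
          -- It leaves from a vertex on neither path: the path that starts in `x` is kept, prolonged
          -- to `y′` if it is `A`, and the escape path replaces the other one.
          from-I : (u ≡ x × v ∈ I₀) ⊎ (v ≡ x × u ∈ I₀) → a ∈ x ∷ I₀ → Link I₀ x y′ rs
          from-I (inj₁ (u≡x , _)) (here a≡x)   = contradiction (here (trans a≡x (sym u≡x))) a∉A
          from-I (inj₂ (v≡x , _)) (here a≡x)   = contradiction (here (trans a≡x (sym v≡x))) a∉B
          from-I (inj₁ (u≡x , _)) (there a∈I₀) =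
            assemble A′ [] (inj₁ (u≡x , a∈I₀)) A′! ([] ∷ [])
              disj A′∉I (λ ()) A′∉rs A′⊆ (λ { (here refl) → a∈ })
          from-I (inj₂ (v≡x , _)) (there a∈I₀) =
            assemble B [] (inj₁ (v≡x , a∈I₀)) v! ([] ∷ [])
              (λ { z∈ (here refl) → a∉B z∈ }) bs∉I (λ ()) B∉rs
              (λ z∈ → inj₁ (B⊆ z∈)) (λ { (here refl) → a∈ })

      turn : Link I₀ x y′ rs
      turn with xs , W , W≢ ← robust y′ {u} {r}
                          (λ { refl → y′∉A (here refl) }) (λ { refl → y′∉ r∈ })
        with bridge W′ a∈ b∈ inn ss! a≢ b≢ ←
             find-bridge ((u ∷ as) ++ (v ∷ bs) ++ x ∷ I₀) rs (_≢ y′) zs∉rs W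
               (here refl) r∈ (λ { refl → y′∉A (here refl) }) W≢
        = Turn.branch W′ a∈ b∈ inn ss! a≢ b≢

  link-walk : ∀ {r} → Walk y y″ ms → Link I₀ x y (ms ++ rs) → r ∈ rs → Unique (ms ++ rs) →
              (∀ {z} → z ∈ x ∷ I₀ → z ∉ ms ++ rs) → Link I₀ x y″ rs
  link-walk [] L r∈ u! dis = L
  link-walk {ms = _ ∷ ms} (e ∷ W) L r∈ u!@(_ ∷ u!′) dis =
    link-walk W (link-step L e (∈-++⁺ʳ ms r∈) (∉-∷⁻ u!) dis) r∈ u!′
      (λ z∈ z∈′ → dis z∈ (there z∈′))

  -- Menger's theorem for two paths, by induction along a path from `x` to `y`: its vertices count
  -- as targets until the end of the first path moves over them.
  link-path : ∀ {i r} → Walk x y ms → i ∈ I₀ → r ∈ rs → x ∉ I₀ → Unique (ms ++ rs) →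
              (∀ {z} → z ∈ x ∷ I₀ → z ∉ ms ++ rs) → Link I₀ x y rs
  link-path {ms = ms} W i∈ r∈ x∉ u! dis =
    link-walk W (link-base i∈ (∈-++⁺ʳ ms r∈) x∉ dis) r∈ u! dis

  -- `A` may be a single vertex, but `B` is not, since `x ∷ I₀` and `rs` are disjoint; its edges
  -- make the inequality strict.
  close : (L : Link I₀ x y rs) (let open Link L) → (∀ {z} → z ∈ x ∷ I₀ → z ∉ rs) →
          ∀ {is js} → Walk v u is → Unique (v ∷ is) → (∀ {z} → z ∈ v ∷ is → z ∈ x ∷ I₀) →
          Walk y j js → Unique (y ∷ js) → (∀ {z} → z ∈ js → z ∈ rs) →
          ∃[ zs ] Walk v v zs × Unique zs × length is + length js < length zs ×
                  (∀ {z} → z ∈ v ∷ is → z ∈ zs) × (∀ {z} → z ∈ js → z ∈ zs)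
  close {I₀} {x} {y} {rs} L dis {is} {js} WI v! is⊆ WJ y! js⊆
    with bs′ , B′ , r ← reverseʷ (Link.B L) =
    is ++ as ++ js ++ bs′ , WI ++ʷ A ++ʷ WJ ++ʷ B′ ,
    Unique-++⁺ is! (Unique-++⁺ as! (Unique-++⁺ js! bs′! js#bs′) as#) is# ,
    len , v∷is⊆ , λ z∈ → ∈-++⁺ʳ is (∈-++⁺ʳ as (∈-++⁺ˡ z∈))
    where
    open Link L
    as!′ = proj₁ (Unique-++⁻ (u ∷ as) unique)
    as! = proj₁ (proj₂ (Unique-++⁻ (u ∷ []) as!′))
    bs! = proj₁ (proj₂ (Unique-++⁻ (u ∷ as) unique))
    u#v = proj₂ (proj₂ (Unique-++⁻ (u ∷ as) unique))
    is! = proj₁ (proj₂ (Unique-++⁻ (v ∷ []) v!))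
    js! = proj₁ (proj₂ (Unique-++⁻ (y ∷ []) y!))
    j∷bs′! = Unique-↭ (↭-sym r) bs!
    bs′! = proj₁ (proj₂ (Unique-++⁻ (j ∷ []) j∷bs′!))
    bs′⊆ : ∀ {z} → z ∈ bs′ → z ∈ v ∷ bs
    bs′⊆ z∈ = ∈-resp-↭ r (there z∈)
    v∈ : v ∈ bs′
    v∈ = last-∈′ B′ (λ { refl → dis (is⊆ (here refl)) j∈rs })
    js#bs′ : ∀ {z} → z ∈ js → z ∉ bs′
    js#bs′ z∈ z∈b with refl ← bs∈rs (bs′⊆ z∈b) (js⊆ z∈) = ∉-∷⁻ j∷bs′! z∈b
    as# : ∀ {z} → z ∈ as → z ∉ js ++ bs′
    as# z∈ z∈′ with ∈-++⁻ js z∈′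
    ... | inj₁ z∈js = as∉rs (there z∈) (js⊆ z∈js)
    ... | inj₂ z∈b = u#v (there z∈) (bs′⊆ z∈b)
    is# : ∀ {z} → z ∈ is → z ∉ as ++ js ++ bs′
    is# z∈ z∈′ with ∈-++⁻ as z∈′
    ... | inj₁ z∈as = as∉I z∈as (is⊆ (there z∈))
    ... | inj₂ z∈″ with ∈-++⁻ js z∈″
    ...   | inj₁ z∈js = dis (is⊆ (there z∈)) (js⊆ z∈js)
    ...   | inj₂ z∈b with bs′⊆ z∈b
    ...     | here refl  = ∉-∷⁻ v! z∈
    ...     | there z∈bs = bs∉I z∈bs (is⊆ (there z∈))
    v∷is⊆ : ∀ {z} → z ∈ v ∷ is → z ∈ is ++ as ++ js ++ bs′
    v∷is⊆ (here refl) = ∈-++⁺ʳ is (∈-++⁺ʳ as (∈-++⁺ʳ js v∈))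
    v∷is⊆ (there z∈)  = ∈-++⁺ˡ z∈
    open ≤-Reasoning
    len : length is + length js < length (is ++ as ++ js ++ bs′)
    len = begin-strict
      length is + length js             <⟨ +-monoʳ-< (length is) (m<m+n (length js) (nonempty v∈)) ⟩
      length is + (length js + length bs′) ≡⟨ cong (length is +_) (length-++ js) ⟨
      length is + length (js ++ bs′)    ≤⟨ +-monoʳ-≤ (length is) (m≤n+m _ (length as)) ⟩
      length is + (length as + length (js ++ bs′)) ≡⟨ cong (length is +_) (length-++ as) ⟨
      length is + length (as ++ js ++ bs′) ≡⟨ length-++ is ⟨
      length (is ++ as ++ js ++ bs′)    ∎
      where
      nonempty : ∀ {z : V} {zs} → z ∈ zs → 0 < length zs
      nonempty (here _)  = s≤s z≤n
      nonempty (there _) = s≤s z≤n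

-- Chords from the two ends of a path

first-split : ∀ {A : Set} (p : A → Bool) zs → All (λ z → ¬ T (p z)) zs ⊎
              ∃₂ λ l b → ∃[ r ] zs ≡ l ++ b ∷ r × T (p b) × All (λ z → ¬ T (p z)) l
first-split p [] = inj₁ []
first-split p (z ∷ zs) with T? (p z)
... | yes pz = inj₂ ([] , z , zs , refl , pz , [])
... | no ¬pz with first-split p zs
...   | inj₁ none = inj₁ (¬pz ∷ none)
...   | inj₂ (l , b , r , refl , pb , none) = inj₂ (z ∷ l , b , r , refl , pb , ¬pz ∷ none)

last-split : ∀ {A : Set} (p : A → Bool) zs → All (λ z → ¬ T (p z)) zs ⊎
             ∃₂ λ l b → ∃[ r ] zs ≡ l ++ b ∷ r × T (p b) × All (λ z → ¬ T (p z)) r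
last-split p [] = inj₁ []
last-split p (z ∷ zs) with last-split p zs
... | inj₂ (l , b , r , refl , pb , none) = inj₂ (z ∷ l , b , r , refl , pb , none)
... | inj₁ none with T? (p z)
...   | yes pz = inj₂ ([] , z , zs , refl , pz , none)
...   | no ¬pz = inj₁ (¬pz ∷ none)

module _ {A : Set} (X Y : A → Bool) where

  YX : List A → Set
  YX zs = ∃₂ λ l a → ∃₂ λ b r → zs ≡ l ++ a ∷ b ∷ r × T (Y a) × T (X b)

  -- For the ends x and y of a path, an edge a b of the path with y ∼ a and x ∼ b
  -- closes it up to a cycle on the same vertices.
  adjacent-YX : ∀ z zs → YX (z ∷ zs) ⊎ count X zs + count Y (z ∷ zs) ≤ suc (length zs)
  adjacent-YX z [] = inj₂ (+-monoˡ-≤ 0 (𝟙≤1 (Y z)))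
  adjacent-YX z (z′ ∷ zs) with adjacent-YX z′ zs
  ... | inj₁ (l , a , b , r , eq , ya , xb) = inj₁ (z ∷ l , a , b , r , cong (z ∷_) eq , ya , xb)
  ... | inj₂ le with T? (Y z) | T? (X z′)
  ...   | yes yz | yes xz′ = inj₁ ([] , z , z′ , zs , refl , yz , xz′)
  ...   | yes yz | no ¬xz′ = inj₂ (bound (subst (λ i → i + 𝟙 (Y z) ≤ 1) (sym (𝟙-¬T ¬xz′)) (𝟙≤1 (Y z))))
    where
    bound : 𝟙 (X z′) + 𝟙 (Y z) ≤ 1 → _
    bound h = ≤-trans (≤-reflexive (interchange +-commutativeSemigroup (𝟙 (X z′)) _ _ _)) (+-mono-≤ h le)
  ...   | no ¬yz | _ = inj₂ (bound (subst₂ (λ i j → i ≤ j) (cong (𝟙 (X z′) +_) (sym (𝟙-¬T ¬yz))) refl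
                          (≤-trans (≤-reflexive (+-identityʳ _)) (𝟙≤1 (X z′)))))
    where
    bound : 𝟙 (X z′) + 𝟙 (Y z) ≤ 1 → _
    bound h = ≤-trans (≤-reflexive (interchange +-commutativeSemigroup (𝟙 (X z′)) _ _ _)) (+-mono-≤ h le)

  -- A crossing recorded here is of minimal width: no chord ends strictly inside it.
  data Scan : List A → Set where
    crossing   : ∀ l a l′ b l″ → T (Y a) → T (X b) →
                 All (λ z → ¬ T (X z)) l′ → All (λ z → ¬ T (Y z)) l′ →
                 Scan (l ++ a ∷ l′ ++ b ∷ l″)
    noncrossing : ∀ l w l′ → All (λ z → ¬ T (Y z)) l → All (λ z → ¬ T (X z)) l′ →
                  Scan (l ++ w ∷ l′)

  -- Only a new first vertex `z` with `Y z` can spoil a noncrossing list. Then the nearest `X` up to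
  -- `w` gives a crossing, and no `Y` lies inside it, as there is none before `w`. If there is no
  -- such `X`, `z` takes the place of `w`.
  scan : ∀ z zs → Scan (z ∷ zs)
  scan z [] = noncrossing [] z [] [] []
  scan z (z′ ∷ zs) = extend (scan z′ zs)
    where
    extend : ∀ {zs} → Scan zs → Scan (z ∷ zs)
    extend (crossing l a l′ b l″ ya xb ¬x ¬y) = crossing (z ∷ l) a l′ b l″ ya xb ¬x ¬y
    extend (noncrossing l w l′ ¬y ¬x) with T? (Y z)
    ... | no ¬yz = noncrossing (z ∷ l) w l′ (¬yz ∷ ¬y) ¬x
    ... | yes yz with first-split X l
    ...   | inj₂ (m , b , r , refl , xb , ¬xm) =
            subst (λ u → Scan (z ∷ u)) (sym (++-assoc m (b ∷ r) (w ∷ l′)))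
              (crossing [] z m b (r ++ w ∷ l′) yz xb ¬xm
                (All.tabulate (λ z∈ → All.lookup ¬y (∈-++⁺ˡ z∈))))
    ...   | inj₁ ¬xl with T? (X w)
    ...     | yes xw = crossing [] z l w l′ yz xw ¬xl ¬y
    ...     | no ¬xw = noncrossing [] z (l ++ w ∷ l′) []
                (All.tabulate λ z∈ xz → case z∈ xz (∈-++⁻ l z∈))
      where
      case : ∀ {u} → u ∈ l ++ w ∷ l′ → T (X u) → u ∈ l ⊎ u ∈ w ∷ l′ → ⊥
      case _ xu (inj₁ u∈)          = All.lookup ¬xl u∈ xu
      case _ xu (inj₂ (here refl)) = ¬xw xu
      case _ xu (inj₂ (there u∈))  = All.lookup ¬x u∈ xu

-- Pósa's lemma

module Posa {n} (G : Graph n) (robust : Walks.Robust G) where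
  open Graph G using (adj; _∼_)
  open Walks G
  open Linkage G robust

  private variable
    u v x y : V
    xs ys zs as bs is : List V

  Cycle> : ℕ → Set
  Cycle> c = ∃₂ λ v zs → Walk v v zs × Unique zs × c < length zs

  -- The cycle runs from `x` to `a`, over the chord to `y`, back to `b` and over the other chord to
  -- `x`.
  cross-cycle : ∀ {a b} → Walk x a as → Walk b y bs → y ∼ a → x ∼ b →
                ∃[ zs ] Walk x x zs × zs ↭ (x ∷ as) ++ b ∷ bs
  cross-cycle {x} {as} {y} {bs} {b = b} W₁ W₂ y∼a x∼b with ys , W′ , r ← reverseʷ W₂ =
    as ++ (y ∷ ys) ++ x ∷ [] , W₁ ++ʷ ∼-sym y∼a ∷ (W′ ++ʷ ∼-sym x∼b ∷ []) ,
    ↭-trans (++⁺ˡ as (++⁺ʳ (x ∷ []) r))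
      (↭-trans (↭-reflexive (sym (++-assoc as (b ∷ bs) (x ∷ []))))
               (↭-sym (∷↭∷ʳ x (as ++ b ∷ bs))))

  -- Run back from i to x, then along the first chord from x over i.
  route : ∀ {i} → Walk x y is → x ∼ y → Unique (x ∷ is) → i ∈ x ∷ is → i ≢ y →
          ∃[ rt ] Walk i y rt × Unique (i ∷ rt) × (∀ {z} → z ∈ i ∷ rt → z ∈ x ∷ is) ×
                  count (adj x) (x ∷ is) ≤ length rt
  route {x} {y} {is} {i} W x∼y u! i∈ i≢y
    with l , r , eq ← ∈-∃++ i∈
    with as , W₁ , eq₁ , W₂ ← split-at W l eq
    with first-split (adj x) r
  ... | inj₁ none = contradiction x∼y (All.lookup none (last-∈′ W₂ i≢y))
  ... | inj₂ (m , b , m′ , refl , x∼b , none)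
    with _ , W₃ ← split m W₂
    with as′ , W₁′ , p ← reverseʷ W₁ =
    as′ ++ b ∷ m′ , W₁′ ++ʷ x∼b ∷ W₃ ,
    Unique-++⁺ (Unique-↭ (↭-sym p) as!) bm!
      (λ z∈ z∈bm → as# (∈-resp-↭ p z∈) (∈-++⁺ʳ m z∈bm)) ,
    sub , bound
    where
    eq₂ : x ∷ is ≡ (x ∷ as) ++ m ++ b ∷ m′
    eq₂ = trans eq (trans (sym (++-assoc l (i ∷ []) _)) (cong (_++ m ++ b ∷ m′) (sym eq₁)))
    u!′ = Unique-++⁻ (x ∷ as) (subst Unique eq₂ u!)
    as! = proj₁ u!′
    bm! = proj₁ (proj₂ (Unique-++⁻ m (proj₁ (proj₂ u!′))))
    as# = proj₂ (proj₂ u!′)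
    sub : ∀ {z} → z ∈ i ∷ as′ ++ b ∷ m′ → z ∈ x ∷ is
    sub {z} z∈ with ∈-++⁻ (i ∷ as′) z∈
    ... | inj₁ z∈as = subst (z ∈_) (sym eq₂) (∈-++⁺ˡ (∈-resp-↭ p z∈as))
    ... | inj₂ z∈bm = subst (z ∈_) (sym eq₂) (∈-++⁺ʳ (x ∷ as) (∈-++⁺ʳ m z∈bm))
    open ≤-Reasoning
    bound : count (adj x) (x ∷ is) ≤ length (as′ ++ b ∷ m′)
    bound = begin
      count (adj x) (x ∷ is) ≡⟨ cong (count (adj x)) eq₂ ⟩
      count (adj x) ((x ∷ as) ++ m ++ b ∷ m′) ≡⟨ count-++ (adj x) (x ∷ as) _ ⟩
      (𝟙 (adj x x) + count (adj x) as) + count (adj x) (m ++ b ∷ m′)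
        ≡⟨ cong₂ _+_ (cong (_+ count (adj x) as) (𝟙-¬T {adj x x} ∼-irrefl)) (count-++ (adj x) m _) ⟩
      count (adj x) as + (count (adj x) m + count (adj x) (b ∷ m′))
        ≡⟨ cong (λ k → count (adj x) as + (k + count (adj x) (b ∷ m′))) (count-none none) ⟩
      count (adj x) as + count (adj x) (b ∷ m′)
        ≤⟨ +-mono-≤ (count≤length (adj x) as) (count≤length (adj x) (b ∷ m′)) ⟩
      length as + length (b ∷ m′)
        ≡⟨ cong (_+ length (b ∷ m′)) (suc-injective (↭-length p)) ⟨
      length as′ + length (b ∷ m′) ≡⟨ length-++ as′ ⟨
      length (as′ ++ b ∷ m′) ∎

  route′ : ∀ {i} → Walk x y is → x ∼ y → Unique (x ∷ is) → i ∈ x ∷ is → i ≢ y →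
           ∃[ rt ] Walk y i rt × Unique (y ∷ rt) × (∀ {z} → z ∈ y ∷ rt → z ∈ x ∷ is) ×
                   count (adj x) (x ∷ is) ≤ length rt
  route′ W x∼y u! i∈ i≢y
    with rt , R , r! , r⊆ , le ← route W x∼y u! i∈ i≢y with rt′ , R′ , p ← reverseʷ R =
    rt′ , R′ , Unique-↭ (↭-sym p) r! , (λ z∈ → r⊆ (∈-resp-↭ p z∈)) ,
    ≤-trans le (≤-reflexive (suc-injective (sym (↭-length p))))

  open ≤-Reasoning

  hamilton : ∀ m {a b m′} → Walk x y xs → x ∷ xs ≡ m ++ a ∷ b ∷ m′ → y ∼ a → x ∼ b →
             ∃[ zs ] Walk x x zs × zs ↭ x ∷ xs
  hamilton m {a} {b} {m′} W eq y∼a x∼b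
    with as , W₁ , eq₁ , _ ∷ W₂ ← split-at W m eq
    with zs , Z , p ← cross-cycle W₁ W₂ y∼a x∼b =
    zs , Z , ↭-trans p (↭-reflexive (trans (cong (_++ b ∷ m′) eq₁)
               (trans (++-assoc m (a ∷ []) (b ∷ m′)) (sym eq))))

  count-self : ∀ x xs → count (adj x) (x ∷ xs) ≡ count (adj x) xs
  count-self x xs = cong (_+ count (adj x) xs) (𝟙-¬T {adj x x} ∼-irrefl)

  private
    count-gap : ∀ (p : V → Bool) as m bs → All (λ z → ¬ T (p z)) m →
                count p (as ++ m ++ bs) ≡ count p as + count p bs
    count-gap p as m bs none = begin-equality
      count p (as ++ m ++ bs)               ≡⟨ count-++ p as _ ⟩
      count p as + count p (m ++ bs)        ≡⟨ cong (count p as +_) (count-++ p m bs) ⟩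
      count p as + (count p m + count p bs) ≡⟨ cong (λ k → count p as + (k + count p bs)) (count-none none) ⟩
      count p as + count p bs               ∎

  module _ {c d} (0<d : 0 < d) (2+c≤d+d : 2 + c ≤ d + d) where

    -- Unless some edge of the path closes it up to a cycle on all its vertices, `adjacent-YX`
    -- bounds the neighbours of both ends on the segments before and after `l′`. All neighbours lie
    -- on these segments, so the cycle over the two chords has at least 2d - 1 > c vertices.
    crossing-case : ∀ l a l′ b l″ → Walk x y xs → Unique (x ∷ xs) → c < length (x ∷ xs) →
      d ≤ count (adj x) (x ∷ xs) → d ≤ count (adj y) (x ∷ xs) →
      x ∷ xs ≡ l ++ a ∷ l′ ++ b ∷ l″ → y ∼ a → x ∼ b →
      All (λ z → ¬ x ∼ z) l′ → All (λ z → ¬ y ∼ z) l′ → Cycle> c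
    crossing-case {x} {y} {xs} l a l′ b l″ W u! long dx dy eq y∼a x∼b ¬x ¬y
      with as , W₁ , eq₁ , W₂ ← split-at W l eq
      with _ , W₃ ← split l′ W₂ = cases (adjacent-YX (adj x) (adj y) x as) (adjacent-YX (adj x) (adj y) b l″)
      where
      eq₂ : x ∷ xs ≡ (x ∷ as) ++ l′ ++ b ∷ l″
      eq₂ = trans eq (trans (sym (++-assoc l (a ∷ []) _)) (cong (_++ l′ ++ b ∷ l″) (sym eq₁)))

      whole : ∀ m {a b m′} → x ∷ xs ≡ m ++ a ∷ b ∷ m′ → y ∼ a → x ∼ b → Cycle> c
      whole m eq y∼a x∼b with zs , Z , p ← hamilton m W eq y∼a x∼b =
        x , zs , Z , Unique-↭ (↭-sym p) u! , subst (c <_) (sym (↭-length p)) long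

      cases : _ → _ → Cycle> c
      cases (inj₁ (m , a′ , b′ , m′ , eq₃ , y∼a′ , x∼b′)) _ =
        whole m (trans eq₂ (trans (cong (_++ l′ ++ b ∷ l″) eq₃) (++-assoc m _ _))) y∼a′ x∼b′
      cases (inj₂ _) (inj₁ (m , a′ , b′ , m′ , eq₃ , y∼a′ , x∼b′)) =
        whole (((x ∷ as) ++ l′) ++ m)
          (trans eq₂ (trans (sym (++-assoc (x ∷ as) l′ _))
            (trans (cong (((x ∷ as) ++ l′) ++_) eq₃) (sym (++-assoc ((x ∷ as) ++ l′) m _)))))
          y∼a′ x∼b′
      cases (inj₂ le₁) (inj₂ le₂) with zs , Z , p ← cross-cycle W₁ W₃ y∼a x∼b =
        x , zs , Z , Unique-↭ (↭-sym p) ab! , long′ p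
        where
        u!′ = Unique-++⁻ (x ∷ as) (subst Unique eq₂ u!)
        ab! : Unique ((x ∷ as) ++ b ∷ l″)
        ab! = Unique-++⁺ (proj₁ u!′) (proj₁ (proj₂ (Unique-++⁻ l′ (proj₁ (proj₂ u!′)))))
                (λ z∈ z∈′ → proj₂ (proj₂ u!′) z∈ (∈-++⁺ʳ l′ z∈′))
        long′ : ∀ {zs} → zs ↭ (x ∷ as) ++ b ∷ l″ → c < length zs
        long′ {zs} p = s≤s⁻¹ (begin
          2 + c ≤⟨ 2+c≤d+d ⟩
          d + d ≤⟨ +-mono-≤ dx dy ⟩
          count (adj x) (x ∷ xs) + count (adj y) (x ∷ xs)
            ≡⟨ cong (λ k → count (adj x) k + count (adj y) k) eq₂ ⟩
          count (adj x) ((x ∷ as) ++ l′ ++ b ∷ l″) + count (adj y) ((x ∷ as) ++ l′ ++ b ∷ l″)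
            ≡⟨ cong₂ _+_ (count-gap (adj x) (x ∷ as) l′ (b ∷ l″) ¬x) (count-gap (adj y) (x ∷ as) l′ (b ∷ l″) ¬y) ⟩
          (count (adj x) (x ∷ as) + count (adj x) (b ∷ l″)) + (count (adj y) (x ∷ as) + count (adj y) (b ∷ l″))
            ≡⟨ interchange +-commutativeSemigroup (count (adj x) (x ∷ as)) _ _ _ ⟩
          (count (adj x) (x ∷ as) + count (adj y) (x ∷ as)) + (count (adj x) (b ∷ l″) + count (adj y) (b ∷ l″))
            ≤⟨ +-mono-≤ (≤-trans (≤-reflexive (cong (_+ count (adj y) (x ∷ as)) (count-self x as))) le₁)
                        -- `le₂` does not count `b`, the first vertex of its segment, among the
                        -- neighbours of `x`; this costs the 1 in 2d - 1.
                        (≤-trans (+-monoˡ-≤ (count (adj y) (b ∷ l″)) (+-monoˡ-≤ (count (adj x) l″) (𝟙≤1 (adj x b)))) (s≤s le₂)) ⟩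
          suc (length as) + suc (suc (length l″)) ≡⟨ +-suc (suc (length as)) (suc (length l″)) ⟩
          suc (suc (length as) + suc (length l″)) ≡⟨ cong suc (length-++ (x ∷ as)) ⟨
          suc (length ((x ∷ as) ++ b ∷ l″)) ≡⟨ cong suc (↭-length p) ⟨
          suc (length zs) ∎)

    -- The last neighbour `p` of `x` and the first neighbour `q` of `y` close each side by a chord.
    -- Two disjoint paths join the sides, one leaving from `p` and one arriving in `q`; by `route`
    -- each side is traversed between its two contacts so that at least d vertices are collected.
    noncrossing-case : ∀ l w l′ → Walk x y xs → Unique (x ∷ xs) →
      d ≤ count (adj x) (x ∷ xs) → d ≤ count (adj y) (x ∷ xs) →
      x ∷ xs ≡ l ++ w ∷ l′ →
      All (λ z → ¬ y ∼ z) l → All (λ z → ¬ x ∼ z) l′ → Cycle> c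
    noncrossing-case {x} {y} {xs} l w l′ W u! dx dy eq ¬y ¬x
      = main
      where
      x-count : ∀ {as} → x ∷ as ≡ l ∷ʳ w → count (adj x) (x ∷ xs) ≡ count (adj x) (x ∷ as)
      x-count {as} eq₁ = begin-equality
        count (adj x) (x ∷ xs)                       ≡⟨ cong (count (adj x)) (trans eq (sym (++-assoc l (w ∷ []) l′))) ⟩
        count (adj x) ((l ∷ʳ w) ++ l′)               ≡⟨ count-++ (adj x) (l ∷ʳ w) l′ ⟩
        count (adj x) (l ∷ʳ w) + count (adj x) l′    ≡⟨ cong₂ _+_ (cong (count (adj x)) (sym eq₁)) (count-none ¬x) ⟩
        count (adj x) (x ∷ as) + 0                   ≡⟨ +-identityʳ _ ⟩
        count (adj x) (x ∷ as)                       ∎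

      y-count : count (adj y) (x ∷ xs) ≡ count (adj y) (w ∷ l′)
      y-count = begin-equality
        count (adj y) (x ∷ xs)                    ≡⟨ cong (count (adj y)) eq ⟩
        count (adj y) (l ++ w ∷ l′)               ≡⟨ count-++ (adj y) l (w ∷ l′) ⟩
        count (adj y) l + count (adj y) (w ∷ l′)  ≡⟨ cong (_+ count (adj y) (w ∷ l′)) (count-none ¬y) ⟩
        count (adj y) (w ∷ l′)                    ∎

      last-nbr : ∀ {x w as} → Walk x w as → 0 < count (adj x) (x ∷ as) →
        ∃₂ λ p is → ∃[ ms ] x ∼ p × Walk x p is × Walk p w ms × as ≡ is ++ ms ×
                    count (adj x) (x ∷ as) ≡ count (adj x) (x ∷ is)
      last-nbr {x} {w} {as} W pos with last-split (adj x) as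
      ... | inj₁ none = contradiction (trans (count-self x as) (count-none none)) (>⇒≢ pos)
      ... | inj₂ (l , p , r , refl , x∼p , none) with Wi , Wm ← split l W =
        p , l ∷ʳ p , r , x∼p , Wi , Wm , sym (++-assoc l (p ∷ []) r) , (begin-equality
          count (adj x) (x ∷ l ++ p ∷ r)              ≡⟨ cong (λ k → count (adj x) (x ∷ k)) (sym (++-assoc l (p ∷ []) r)) ⟩
          count (adj x) ((x ∷ l ∷ʳ p) ++ r)           ≡⟨ count-++ (adj x) (x ∷ l ∷ʳ p) r ⟩
          count (adj x) (x ∷ l ∷ʳ p) + count (adj x) r ≡⟨ cong (count (adj x) (x ∷ l ∷ʳ p) +_) (count-none none) ⟩
          count (adj x) (x ∷ l ∷ʳ p) + 0              ≡⟨ +-identityʳ _ ⟩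
          count (adj x) (x ∷ l ∷ʳ p)                  ∎)

      first-nbr : ∀ {w y bs} → Walk w y bs → 0 < count (adj y) (w ∷ bs) →
        ∃₂ λ q ms → ∃[ rs ] y ∼ q × Walk w q ms × Walk q y rs × bs ≡ ms ++ rs ×
                    count (adj y) (w ∷ bs) ≡ count (adj y) (q ∷ rs)
      first-nbr {w} {y} {bs} W pos with first-split (adj y) (w ∷ bs)
      ... | inj₁ none = contradiction (count-none none) (>⇒≢ pos)
      ... | inj₂ (l , q , r , eq , y∼q , none) with ms , Wm , eq₁ , Wr ← split-at W l eq =
        q , ms , r , y∼q , Wm , Wr ,
        proj₂ (∷-injective (trans eq (trans (sym (++-assoc l (q ∷ []) r)) (cong (_++ r) (sym eq₁))))) ,
        (begin-equality
          count (adj y) (w ∷ bs)                    ≡⟨ cong (count (adj y)) eq ⟩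
          count (adj y) (l ++ q ∷ r)                ≡⟨ count-++ (adj y) l (q ∷ r) ⟩
          count (adj y) l + count (adj y) (q ∷ r)   ≡⟨ cong (_+ count (adj y) (q ∷ r)) (count-none none) ⟩
          count (adj y) (q ∷ r)                     ∎)

      ears′ : ∀ {x y p q is ys ms rs} → is ≡ ys ∷ʳ p →
              x ∼ p → Walk x p is → Walk p q ms → y ∼ q → Walk q y rs →
              Unique ((x ∷ is ++ ms) ++ rs) →
              d ≤ count (adj x) (x ∷ is) → d ≤ count (adj y) (q ∷ rs) → Cycle> c
      ears′ {x} {y} {p} {q} {is} {ys} {ms} {rs} refl x∼p Wi Wm y∼q Wr u! dx dy
        with rs′ , Wr′ , rp ← reverseʷ Wr =
        finish (link-path Wm (here refl) y∈rs p∉ ms! dis)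
        where
        u!′ = Unique-++⁻ (x ∷ ys ∷ʳ p) (subst Unique (++-assoc (x ∷ ys ∷ʳ p) ms rs) u!)
        xp! = proj₁ u!′
        ms! = proj₁ (proj₂ u!′)
        perm : x ∷ ys ∷ʳ p ↭ p ∷ x ∷ ys
        perm = ↭-sym (∷↭∷ʳ p (x ∷ ys))
        p∉ : p ∉ x ∷ ys
        p∉ = ∉-∷⁻ (Unique-↭ perm xp!)
        dis : ∀ {z} → z ∈ p ∷ x ∷ ys → z ∉ ms ++ rs
        dis z∈ = proj₂ (proj₂ u!′) (∈-resp-↭ (↭-sym perm) z∈)
        q∉rs : q ∉ rs
        q∉rs q∈ with last-∈ Wm
        ... | here refl  = dis (here refl) (∈-++⁺ʳ ms q∈)
        ... | there q∈ms = proj₂ (proj₂ (Unique-++⁻ ms ms!)) q∈ms q∈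
        y∈rs : y ∈ rs
        y∈rs = last-∈′ Wr (λ { refl → ∼-irrefl y∼q })
        q∷rs! : Unique (q ∷ rs)
        q∷rs! = ∉-∷⁺ q∉rs (proj₁ (proj₂ (Unique-++⁻ ms ms!)))
        inner : ∀ {u v} → (u ≡ p × v ∈ x ∷ ys) ⊎ (v ≡ p × u ∈ x ∷ ys) →
                ∃[ ri ] Walk v u ri × Unique (v ∷ ri) × (∀ {z} → z ∈ v ∷ ri → z ∈ x ∷ ys ∷ʳ p) ×
                        count (adj x) (x ∷ ys ∷ʳ p) ≤ length ri
        -- Which of the two paths starts in `p` decides the direction of the traversal.
        inner (inj₁ (refl , v∈)) = route Wi x∼p xp! (∈-++⁺ˡ v∈) (λ { refl → p∉ v∈ })
        inner (inj₂ (refl , u∈)) = route′ Wi x∼p xp! (∈-++⁺ˡ u∈) (λ { refl → p∉ u∈ })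
        drop-q : ∀ {rj} → Unique (q ∷ rj) → (∀ {z} → z ∈ q ∷ rj → z ∈ y ∷ rs′) → ∀ {z} → z ∈ rj → z ∈ rs
        drop-q rj! rj⊆ z∈ with ∈-resp-↭ rp (rj⊆ (there z∈))
        ... | here refl = contradiction z∈ (∉-∷⁻ rj!)
        ... | there z∈rs = z∈rs
        finish : Link (x ∷ ys) p q rs → Cycle> c
        -- Read from `y`, the right side has the form of the left side, with `q` in the place of
        -- `p`.
        finish L with rj , Rj , rj! , rj⊆ , lej ← route′ Wr′ y∼q (Unique-↭ (↭-sym rp) q∷rs!)
                       (∈-resp-↭ (↭-sym rp) (there (Link.j∈rs L))) (λ { refl → q∉rs (Link.j∈rs L) })
          with ri , Ri , ri! , ri⊆ , lei ← inner (Link.ends L)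
          with zs , Z , z! , len , _ ← close L (λ z∈ z∈rs → dis z∈ (∈-++⁺ʳ ms z∈rs))
                 Ri ri! (λ z∈ → ∈-resp-↭ perm (ri⊆ z∈)) Rj rj! (drop-q rj! rj⊆)
          = _ , zs , Z , z! , (begin-strict
              c                       ≤⟨ m≤n+m c 2 ⟩
              2 + c                   ≤⟨ 2+c≤d+d ⟩
              d + d                   ≤⟨ +-mono-≤ (≤-trans dx lei)
                           (≤-trans dy (≤-trans (≤-reflexive (count-↭ (adj y) (↭-sym rp))) lej)) ⟩
              length ri + length rj   <⟨ len ⟩
              length zs               ∎)

      ears : ∀ {x y p q is ms rs} → x ∼ p → Walk x p is → Walk p q ms → y ∼ q → Walk q y rs →
             Unique ((x ∷ is ++ ms) ++ rs) →
             d ≤ count (adj x) (x ∷ is) → d ≤ count (adj y) (q ∷ rs) → Cycle> c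
      ears x∼p [] _ _ _ _ _ _ = contradiction x∼p ∼-irrefl
      ears x∼p Wi@(_ ∷ _) Wm y∼q Wr u! dx dy
        with ys , _ , eq , _ ← last-view Wi = ears′ eq x∼p Wi Wm y∼q Wr u! dx dy

      regroup : ∀ (is ms₁ ms₂ rs : List V) → (is ++ ms₁) ++ ms₂ ++ rs ≡ (is ++ ms₁ ++ ms₂) ++ rs
      regroup is ms₁ ms₂ rs = trans (++-assoc is ms₁ _)
        (trans (cong (is ++_) (sym (++-assoc ms₁ ms₂ rs))) (sym (++-assoc is (ms₁ ++ ms₂) rs)))

      main : Cycle> c
      main with as , W₁ , eq₁ , W₂ ← split-at W l eq
        with p , is , ms₁ , x∼p , Wi , Wm₁ , eqi , cx ← last-nbr W₁ (≤-trans 0<d (≤-trans dx (≤-reflexive (x-count eq₁))))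
        with q , ms₂ , rs , y∼q , Wm₂ , Wr , eqr , cy ← first-nbr W₂ (≤-trans 0<d (≤-trans dy (≤-reflexive y-count)))
        = ears x∼p Wi (Wm₁ ++ʷ Wm₂) y∼q Wr
          (subst Unique (trans eq (trans (sym (++-assoc l (w ∷ []) l′))
            (trans (cong (_++ l′) (sym eq₁)) (cong (x ∷_) (trans (cong₂ _++_ eqi eqr) (regroup is ms₁ ms₂ rs)))))) u!)
          (≤-trans dx (≤-reflexive (trans (x-count eq₁) cx)))
          (≤-trans dy (≤-reflexive (trans y-count cy)))

    posa : Walk x y xs → Unique (x ∷ xs) → c < length (x ∷ xs) →
           d ≤ count (adj x) (x ∷ xs) → d ≤ count (adj y) (x ∷ xs) → Cycle> c
    posa {x} {y} {xs} W u! long dx dy = cases (scan (adj x) (adj y) x xs) refl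
      where
      cases : ∀ {zs} → Scan (adj x) (adj y) zs → x ∷ xs ≡ zs → Cycle> c
      cases (crossing l a l′ b l″ y∼a x∼b ¬x ¬y) eq =
        crossing-case l a l′ b l″ W u! long dx dy eq y∼a x∼b ¬x ¬y
      cases (noncrossing l w l′ ¬y ¬x) eq = noncrossing-case l w l′ W u! dx dy eq ¬y ¬x

-- Subgraphs of large minimum degree have at most c vertices

module Core {n} (G : Graph n) (robust : Walks.Robust G)
  (connected : ∀ u w → ∃ (Walks.Walk G u w))
  {c d} (0<d : 0 < d) (2+c≤d+d : 2 + c ≤ d + d)
  (no-long-cycle : ¬ Posa.Cycle> G robust c) where

  open Graph G using (adj; _∼_)
  open Walks G
  open Posa G robust
  open ≤-Reasoning

  private variable
    x y : V
    xs : List V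
    k : ℕ

  length-∷ʳ : ∀ (xs : List V) y → length (xs ∷ʳ y) ≡ suc (length xs)
  length-∷ʳ xs y = trans (length-++ xs) (+-comm (length xs) 1)

  open-cycle : ∀ {b zs} → Walk x x zs → b ∈ zs → ∃₂ λ w front → Walk b w front × b ∷ front ↭ zs
  open-cycle Z b∈ with ys , Y , r ← rotate Z b∈ = cut Y r (∈-resp-↭ (↭-sym r) b∈)
    where
    cut : ∀ {b ys zs} → Walk b b ys → ys ↭ zs → b ∈ ys →
          ∃₂ λ w front → Walk b w front × b ∷ front ↭ zs
    cut Y@(_ ∷ _) r _ with front , w , eq , Y′ , _ ← last-view Y =
      w , front , Y′ , ↭-trans (∷↭∷ʳ _ front) (↭-trans (↭-reflexive (sym eq)) r)

  module _ (us : List V) (us! : Unique us) (c<us : c < length us)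
           (deg : ∀ {u} → u ∈ us → d ≤ count (adj u) us) where

    -- Inner vertices may lie outside `us`: a path that joins two components of the subgraph has to
    -- leave it.
    record Ends∈us (k : ℕ) : Set where
      constructor path
      field
        {a b} : V
        {ps}  : List V
        walk  : Walk a b ps
        ps!   : Unique (a ∷ ps)
        a∈us  : a ∈ us
        b∈us  : b ∈ us
        k≤ps  : k ≤ length (a ∷ ps)

    -- By Pósa's lemma some end has fewer than d neighbours on the path, hence one in `us` off the
    -- path.
    lengthen : c < k → Ends∈us k → Ends∈us (suc k)
    lengthen {k} c<k (path {x} {y} {xs} W u! x∈ y∈ k≤)
      with d ≤? count (adj x) (x ∷ xs) | d ≤? count (adj y) (x ∷ xs)
    ... | yes dx | yes dy = contradiction (posa 0<d 2+c≤d+d W u! (<-≤-trans c<k k≤) dx dy) no-long-cycle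
    ... | no ¬dx | _ with u , u∈ , x∼u , u∉ ← ∃-new (adj x) us! (<-≤-trans (≰⇒> ¬dx) (deg x∈)) =
      path (∼-sym x∼u ∷ W) (∉-∷⁺ u∉ u!) u∈ y∈ (s≤s k≤)
    ... | yes _ | no ¬dy with u , u∈ , y∼u , u∉ ← ∃-new (adj y) us! (<-≤-trans (≰⇒> ¬dy) (deg y∈)) =
      path (W ++ʷ y∼u ∷ []) (Unique-∷ʳ⁺ u! u∉) x∈ u∈
        (≤-trans (s≤s k≤) (≤-reflexive (sym (length-∷ʳ (x ∷ xs) u))))

    no-long-path : ¬ Ends∈us (suc c)
    no-long-path p = <-irrefl refl (≤-trans (Ends∈us.k≤ps q) (≤-trans (length≤n (Ends∈us.ps! q)) (m≤n+m n (suc c))))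
      where
      grow : ∀ j → Ends∈us (suc c + j)
      grow zero    = subst Ends∈us (sym (+-identityʳ _)) p
      grow (suc j) = subst Ends∈us (sym (+-suc (suc c) j)) (lengthen (m≤m+n (suc c) j) (grow j))
      q = subst Ends∈us (+-suc (suc c) n) (grow (suc n))

    -- The length is exact because an upper bound is needed too: on at most c vertices, d neighbours
    -- of each end force a cycle on all vertices of the path.
    record Within (k : ℕ) : Set where
      constructor within
      field
        {a b} : V
        {ps}  : List V
        walk  : Walk a b ps
        ps!   : Unique (a ∷ ps)
        ps⊆us : ∀ {z} → z ∈ a ∷ ps → z ∈ us
        k≡    : length (a ∷ ps) ≡ k

    -- If a path cannot be extended inside us and closes up to a cycle, its vertices
    -- either have a further neighbour in us, which opens the cycle to a longer path,
    -- or are joined outside us to a second such component.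
    widen : ∀ {a b ps k} → Walk a b ps → Unique (a ∷ ps) → (∀ {z} → z ∈ a ∷ ps → z ∈ us) →
            length (a ∷ ps) ≡ k → k ≤ c → d ≤ count (adj a) (a ∷ ps) → d ≤ count (adj b) (a ∷ ps) →
            Within (suc k) ⊎ Ends∈us (suc c)
    widen {x} {y} {xs} {k} W u! ⊆us k≡ k≤c dx dy with adjacent-YX (adj x) (adj y) x xs
    ... | inj₂ le = contradiction (begin-strict
            c                                                   <⟨ ≤-refl ⟩
            suc c                                               ≤⟨ n≤1+n (suc c) ⟩
            2 + c                                               ≤⟨ 2+c≤d+d ⟩
            d + d                                               ≤⟨ +-mono-≤ dx dy ⟩
            count (adj x) (x ∷ xs) + count (adj y) (x ∷ xs)     ≡⟨ cong (_+ count (adj y) (x ∷ xs)) (count-self x xs) ⟩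
            count (adj x) xs + count (adj y) (x ∷ xs)           ≤⟨ le ⟩
            suc (length xs)                                     ≡⟨ k≡ ⟩
            k                                                   ≤⟨ k≤c ⟩
            c                                                   ∎) (<-irrefl refl)
    ... | inj₁ (l , a , b , r , eq , y∼a , x∼b) with zs , Z , p ← hamilton l W eq y∼a x∼b
      with any? (λ u → (u ∉? x ∷ xs) ×-dec any? (λ w → T? (adj w u)) (x ∷ xs)) us
    ...   | yes hit with u , u∈ , u∉P , hit′ ← find hit
      with w , w∈ , w∼u ← find hit′
      with e , front , Y , q ← open-cycle Z (∈-resp-↭ (↭-sym p) w∈)
      = inj₁ (within (∼-sym w∼u ∷ Y)
          (∉-∷⁺ (λ u∈′ → u∉P (∈-resp-↭ r′ u∈′)) (Unique-↭ (↭-sym r′) u!))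
          (λ { (here refl) → u∈ ; (there z∈) → ⊆us (∈-resp-↭ r′ z∈) })
          (cong suc (trans (↭-length r′) k≡)))
      where
      r′ = ↭-trans q p
    ...   | no ¬hit = inj₂ escape
      where
      P = x ∷ xs
      outside = filterᵇ (λ u → does (u ∉? P)) us

      isolated : ∀ {u w} → u ∈ us → u ∉ P → w ∈ P → ¬ w ∼ u
      isolated u∈ u∉ w∈ w∼u = ¬hit (lose u∈ (u∉ , lose w∈ w∼u))

      ∈-outside : ∀ {z} → z ∈ us → z ∉ P → z ∈ outside
      ∈-outside {z} z∈ z∉ = ∈-filterᵇ⁺ z∈ (subst T (sym (dec-true (z ∉? P) z∉)) _)

      outside⁻ : ∀ {z} → z ∈ outside → z ∈ us × z ∉ P
      outside⁻ {z} z∈ with z∈us , t ← ∈-filterᵇ⁻ us z∈ = z∈us , toWitness (subst T (sym (isYes≗does (z ∉? P))) t)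

      Greedy : V → ℕ → Set
      Greedy a k = ∃₂ λ g gs → Walk g a gs × Unique (g ∷ gs) × (∀ {z} → z ∈ g ∷ gs → z ∈ outside) ×
                               length (g ∷ gs) ≡ suc k

      -- The front has at least d neighbours in `us`, so a path on at most d vertices goes on; it
      -- stays in `outside` because no vertex of `P` has a neighbour there.
      greedy : ∀ {a} → a ∈ outside → ∀ k → k ≤ d → Greedy a k
      greedy {a} a∈ zero    _   = a , [] , [] , ([] ∷ []) , (λ { (here refl) → a∈ }) , refl
      greedy {a} a∈ (suc k) k<d with g , gs , W , g! , g⊆ , len ← greedy a∈ k (<⇒≤ k<d)
        with u , u∈ , g∼u , u∉ ← ∃-new (adj g) us! (begin-strict
               count (adj g) (g ∷ gs) ≡⟨ count-self g gs ⟩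
               count (adj g) gs       ≤⟨ count≤length (adj g) gs ⟩
               length gs              ≡⟨ suc-injective len ⟩
               k                      <⟨ k<d ⟩
               d                      ≤⟨ deg (proj₁ (outside⁻ (g⊆ (here refl)))) ⟩
               count (adj g) us       ∎)
        = u , g ∷ gs , ∼-sym g∼u ∷ W , ∉-∷⁺ u∉ g! ,
          (λ { (here refl) → ∈-outside u∈ (λ u∈P → isolated (proj₁ g∈) (proj₂ g∈) u∈P (∼-sym g∼u))
             ; (there z∈) → g⊆ z∈ }) ,
          cong suc len
        where
        g∈ = outside⁻ (g⊆ (here refl))

      escape : Ends∈us (suc c)
      escape with u , u∈ , u∉ ← ∃-new′ us! (≤-<-trans (≤-trans (≤-reflexive k≡) k≤c) c<us)
        with ws , W′ ← connected u x
        with bridge {a} {b} {ss} B a∈ b∈ inn ss! _ _ ←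
               find-bridge outside P (λ _ → ⊤) (λ z∈ → proj₂ (outside⁻ z∈)) W′
                 (∈-outside u∈ u∉) (here refl) tt (All.universal (λ _ → tt) ws)
        with e , front , Y , q ← open-cycle Z (∈-resp-↭ (↭-sym p) b∈)
        with g , gs , Wg , g! , g⊆ , len ← greedy a∈ d ≤-refl
        = path (Wg ++ʷ B ++ʷ Y) (joined inn ss! (↭-trans q p) g! g⊆)
            (proj₁ (outside⁻ (g⊆ (here refl))))
            (⊆us (∈-resp-↭ (↭-trans q p) (last-∈ Y)))
            (begin
              suc c                                   ≤⟨ n≤1+n (suc c) ⟩
              2 + c                                   ≤⟨ 2+c≤d+d ⟩
              -- The path in `outside` has d + 1 vertices, and `P` holds at least d neighbours of
              -- `x`.
              d + d                                   ≤⟨ +-mono-≤ (n≤1+n d) (≤-trans dx (count≤length (adj x) P)) ⟩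
              suc d + length P                        ≡⟨ cong₂ _+_ len (↭-length (↭-trans q p)) ⟨
              length (g ∷ gs) + length (b ∷ front)    ≤⟨ +-monoʳ-≤ (length (g ∷ gs)) (m≤n+m _ (length ss)) ⟩
              length (g ∷ gs) + (length ss + length (b ∷ front)) ≡⟨ cong (length (g ∷ gs) +_) (length-++ ss) ⟨
              length (g ∷ gs) + length (ss ++ b ∷ front) ≡⟨ cong (λ l → length (g ∷ gs) + length l) (++-assoc ss (b ∷ []) front) ⟨
              length (g ∷ gs) + length (ss ∷ʳ b ++ front) ≡⟨ length-++ (g ∷ gs) ⟨
              length (g ∷ gs ++ ss ∷ʳ b ++ front)     ∎)
        where
        joined : ∀ {b ss g gs front} → All (λ s → s ∉ outside × s ∉ P × ⊤) ss → Unique ss →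
                 b ∷ front ↭ P → Unique (g ∷ gs) → (∀ {z} → z ∈ g ∷ gs → z ∈ outside) →
                 Unique (g ∷ gs ++ ss ∷ʳ b ++ front)
        joined {b} {ss} {g} {gs} {front} inn ss! r g! g⊆ =
          Unique-++⁺ g! (subst Unique (sym (++-assoc ss (b ∷ []) front))
            (Unique-++⁺ ss! (Unique-↭ (↭-sym r) u!)
              (λ z∈ss z∈P → proj₁ (proj₂ (All.lookup inn z∈ss)) (∈-resp-↭ r z∈P)))) disj
          where
          disj : ∀ {z} → z ∈ g ∷ gs → z ∉ ss ∷ʳ b ++ front
          disj {z} z∈g z∈ with ∈-++⁻ ss (subst (z ∈_) (++-assoc ss (b ∷ []) front) z∈)
          ... | inj₁ z∈ss = proj₁ (All.lookup inn z∈ss) (g⊆ z∈g)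
          ... | inj₂ z∈P  = proj₂ (outside⁻ (g⊆ z∈g)) (∈-resp-↭ r z∈P)

    step : k ≤ c → Within k → Within (suc k) ⊎ Ends∈us (suc c)
    step k≤c (within {x} {y} {xs} W u! ⊆us k≡)
      with d ≤? count (adj x) (x ∷ xs) | d ≤? count (adj y) (x ∷ xs)
    ... | yes dx | yes dy = widen W u! ⊆us k≡ k≤c dx dy
    ... | no ¬dx | _ with u , u∈ , x∼u , u∉ ← ∃-new (adj x) us! (<-≤-trans (≰⇒> ¬dx) (deg (⊆us (here refl)))) =
      inj₁ (within (∼-sym x∼u ∷ W) (∉-∷⁺ u∉ u!) (λ { (here refl) → u∈ ; (there z∈) → ⊆us z∈ }) (cong suc k≡))
    ... | yes _ | no ¬dy with u , u∈ , y∼u , u∉ ← ∃-new (adj y) us! (<-≤-trans (≰⇒> ¬dy) (deg (⊆us (last-∈ W)))) =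
      inj₁ (within (W ++ʷ y∼u ∷ []) (Unique-∷ʳ⁺ u! u∉) ⊆us′ (trans (length-∷ʳ (x ∷ xs) u) (cong suc k≡)))
      where
      ⊆us′ : ∀ {z} → z ∈ x ∷ xs ∷ʳ u → z ∈ us
      ⊆us′ z∈ with ∈-∷ʳ⁻ (x ∷ xs) z∈
      ... | inj₁ z∈P  = ⊆us z∈P
      ... | inj₂ refl = u∈

    -- Paths inside `us` grow to c + 1 vertices unless `widen` yields a long path earlier; from
    -- there `lengthen` would go on beyond n vertices.
    no-core : ⊥
    no-core with u , u∈ , _ ← ∃-new′ {ls = []} us! (≤-<-trans z≤n c<us) = no-long-path climb
      where
      climb′ : ∀ k → k ≤ c → Within (suc k) ⊎ Ends∈us (suc c)
      climb′ zero    _   = inj₁ (within [] ([] ∷ []) (λ { (here refl) → u∈ }) refl)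
      climb′ (suc k) k<c with climb′ k (<⇒≤ k<c)
      ... | inj₁ w = step k<c w
      ... | inj₂ p = inj₂ p
      climb : Ends∈us (suc c)
      climb with climb′ c ≤-refl
      ... | inj₂ p = p
      ... | inj₁ (within W u! ⊆us k≡) = path W u! (⊆us (here refl)) (⊆us (last-∈ W)) (≤-reflexive (sym k≡))

-- Paths are bounded in terms of the longest cycle

module PathBound {n} (G : Graph n) (robust : Walks.Robust G) {c} (2≤c : 2 ≤ c)
  (no-long-cycle : ¬ Posa.Cycle> G robust c) where

  open Graph G using (adj; _∼_)
  open Walks G
  open Linkage G robust
  open Posa G robust

  private variable
    a b o x y : V
    xs ys zs ss : List V

  -- With an arc of the cycle from `b` back to `a`, the path forms a cycle that contains it.
  chord-short : Walk o o zs → Unique zs → a ∈ zs → b ∈ zs → a ≢ b →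
                Walk a b (ss ∷ʳ b) → Unique ss → (∀ {z} → z ∈ ss → z ∉ zs) → length (ss ∷ʳ b) ≤ c
  chord-short {a = a} {b} {ss} Z z! a∈ b∈ a≢b W ss! ss∉
    with ys , Y , r ← rotate Z b∈
    with as , bs , refl , Y₁ , Y₂ ← ∈-split Y (∈-resp-↭ (↭-sym r) a∈)
    = ≮⇒≥ λ long → no-long-cycle
        (a , (ss ∷ʳ b) ++ (as ∷ʳ a) , W ++ʷ Y₁ ,
         Unique-++⁺ (Unique-∷ʳ⁺ ss! (λ b∈ss → ss∉ b∈ss b∈)) (proj₁ y!) disj ,
         ≤-trans long (≤-trans (m≤m+n _ _) (≤-reflexive (sym (length-++ (ss ∷ʳ b))))))
    where
    eq = ++-assoc as (a ∷ []) bs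
    y! = Unique-++⁻ (as ∷ʳ a) (subst Unique (sym eq) (Unique-↭ (↭-sym r) z!))
    disj : ∀ {z} → z ∈ ss ∷ʳ b → z ∉ as ∷ʳ a
    disj {z} z∈ z∈′ with ∈-∷ʳ⁻ ss z∈
    ... | inj₁ z∈ss = ss∉ z∈ss (∈-resp-↭ r (subst (z ∈_) eq (∈-++⁺ˡ z∈′)))
    ... | inj₂ refl = proj₂ (proj₂ y!) z∈′ (last-∈′ Y₂ a≢b)

  module _ {v zs} (Z : Walk v v zs) (z! : Unique zs) where

    on-cycle : V → Bool
    on-cycle z = ⌊ z ∈? zs ⌋

    -- The visits to the cycle cut the path into pieces of length at most c, one for each visit
    -- after the start. `m` is fuel for the recursion on the remaining path.
    chords-bound : ∀ m → length xs ≤ m → Walk a y xs → Unique (a ∷ xs) → a ∈ zs → y ∈ zs →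
                   length xs ≤ c * count on-cycle xs
    chords-bound _ _ [] _ _ _ = z≤n
    chords-bound {xs = xs@(_ ∷ _)} {a = a} {y} (suc m) (s≤s len≤) W@(_ ∷ W′) u! a∈ y∈ with first-split on-cycle xs
    ... | inj₁ none = contradiction (fromWitness y∈) (All.lookup none (last-∈′ W a≢y))
      where
      a≢y : a ≢ y
      a≢y refl = ∉-∷⁻ u! (last-∈ W′)
    ... | inj₂ (l , b , r , eq , b∈ , none) = bound W u! len≤ eq
      where
      open ≤-Reasoning
      bound : ∀ {x xs} → Walk a y (x ∷ xs) → Unique (a ∷ x ∷ xs) → length xs ≤ m → x ∷ xs ≡ l ++ b ∷ r →
              length (x ∷ xs) ≤ c * count on-cycle (x ∷ xs)
      bound {x} {xs} W u! len≤ eq with W₁ , W₂ ← split l (subst (Walk a y) eq W) = begin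
        length (x ∷ xs)               ≡⟨ cong length eq ⟩
        length (l ++ b ∷ r)           ≡⟨ cong length (++-assoc l (b ∷ []) r) ⟨
        length ((l ∷ʳ b) ++ r)        ≡⟨ length-++ (l ∷ʳ b) ⟩
        length (l ∷ʳ b) + length r    ≤⟨ +-mono-≤
            (chord-short Z z! a∈ (toWitness b∈) (λ { refl → ∉-∷⁻ u!′ (∈-++⁺ʳ l (here refl)) }) W₁
              (proj₁ (Unique-++⁻ l (proj₁ (proj₂ (Unique-++⁻ (a ∷ []) u!′)))))
              (λ z∈ z∈zs → All.lookup none z∈ (fromWitness z∈zs)))
            (chords-bound m r≤ W₂ b∷r! (toWitness b∈) y∈) ⟩
        c + c * count on-cycle r      ≡⟨ *-suc c _ ⟨
        c * suc (count on-cycle r)    ≡⟨ cong (c *_) (sym (trans (cong (count on-cycle) eq) (trans (count-++ on-cycle l (b ∷ r))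
                                           (cong₂ (λ i j → i + (j + count on-cycle r)) (count-none none) (𝟙-T b∈))))) ⟩
        c * count on-cycle (x ∷ xs)   ∎
        where
        u!′ : Unique (a ∷ l ++ b ∷ r)
        u!′ = subst (λ k → Unique (a ∷ k)) eq u!
        b∷r! : Unique (b ∷ r)
        b∷r! = proj₁ (proj₂ (Unique-++⁻ (a ∷ l) u!′))
        r≤ : length r ≤ m
        r≤ = ≤-trans (s≤s⁻¹ (begin
          suc (length r)            ≤⟨ m≤n+m _ (length l) ⟩
          length l + length (b ∷ r) ≡⟨ length-++ l ⟨
          length (l ++ b ∷ r)       ≡⟨ cong length eq ⟨
          suc (length xs)           ∎)) len≤

  -- A linkage along the path, closed by the first edge on one side and the last edge on the other,
  -- gives a cycle through both ends. It has at most c vertices, so at most c pieces of the path lie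
  -- between its visits.
  path-bound : Walk x y xs → Unique (x ∷ xs) → length xs ≤ c * c
  path-bound [] _ = z≤n
  path-bound (_ ∷ []) _ = *-mono-≤ (≤-trans (n≤1+n 1) 2≤c) (≤-trans (n≤1+n 1) 2≤c)
  path-bound {x} {y} {x₁ ∷ xs} W@(e ∷ W′@(_ ∷ _)) u! with ms , q , eq , Wm , q∼y ← last-view W′ = go eq u!
    where
    go : xs ≡ ms ∷ʳ y → Unique (x ∷ x₁ ∷ xs) → suc (length xs) ≤ c * c
    go eq u! = finish (link-path Wm (here refl) (here refl)
        (λ { (here refl) → ∉-∷⁻ u! (here refl) }) ms! dis)
      where
      u!′ = Unique-++⁻ (x ∷ x₁ ∷ []) (subst (λ k → Unique (x ∷ x₁ ∷ k)) eq u!)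
      ms! = proj₁ (proj₂ u!′)
      dis : ∀ {z} → z ∈ x₁ ∷ x ∷ [] → z ∉ ms ∷ʳ y
      dis (here refl)         = proj₂ (proj₂ u!′) (there (here refl))
      dis (there (here refl)) = proj₂ (proj₂ u!′) (here refl)
      on-common-cycle : (∃₂ λ v zs → Walk v v zs × Unique zs × x ∈ zs × y ∈ zs) → suc (length xs) ≤ c * c
      on-common-cycle (v , zs , Z , z! , x∈ , y∈) = begin
        suc (length xs)                     ≤⟨ chords-bound Z z! _ ≤-refl W u! x∈ y∈ ⟩
        c * count (on-cycle Z z!) (x₁ ∷ xs) ≤⟨ *-monoʳ-≤ c (count-⊆ (on-cycle Z z!)
                                                (proj₁ (proj₂ (Unique-++⁻ (x ∷ []) u!))) (λ _ → toWitness)) ⟩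
        c * count (on-cycle Z z!) zs        ≤⟨ *-monoʳ-≤ c (count≤length _ zs) ⟩
        c * length zs                       ≤⟨ *-monoʳ-≤ c (≮⇒≥ λ long → no-long-cycle (v , zs , Z , z! , long)) ⟩
        c * c                               ∎
        where open ≤-Reasoning
      finish : Link (x ∷ []) x₁ q (y ∷ []) → suc (length xs) ≤ c * c
      finish L = on-common-cycle (cases (Link.ends L) (Link.j∈rs L))
        where
        open Link L using (u; v; j)
        x≢x₁ = ∼⇒≢ e
        inner : (u ≡ x₁ × v ∈ x ∷ []) ⊎ (v ≡ x₁ × u ∈ x ∷ []) →
                ∃[ is ] (Walk v u is) × (Unique (v ∷ is)) × (∀ {z} → z ∈ v ∷ is → z ∈ x₁ ∷ x ∷ []) × (x ∈ (v ∷ is))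
        inner (inj₁ (refl , here refl)) = x₁ ∷ [] , (e ∷ []) , ∉-∷⁺ (λ { (here eq) → x≢x₁ eq }) ([] ∷ []) ,
          (λ { (here refl) → there (here refl) ; (there (here refl)) → here refl }) , here refl
        inner (inj₂ (refl , here refl)) = x ∷ [] , (∼-sym e ∷ []) , ∉-∷⁺ (λ { (here eq) → x≢x₁ (sym eq) }) ([] ∷ []) ,
          (λ z∈ → z∈) , there (here refl)
        cases : (u ≡ x₁ × v ∈ x ∷ []) ⊎ (v ≡ x₁ × u ∈ x ∷ []) → j ∈ y ∷ [] →
                ∃₂ λ v zs → Walk v v zs × Unique zs × x ∈ zs × y ∈ zs
        cases ends (here refl) with is , Wi , i! , i⊆ , x∈ ← inner ends
          with zs , Z , z! , _ , i⊆zs , j⊆zs ← close L (λ z∈ z∈y → dis z∈ (∈-++⁺ʳ ms z∈y)) Wi i! i⊆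
                 (q∼y ∷ []) (∉-∷⁺ (λ { (here refl) → ∼-irrefl q∼y }) ([] ∷ [])) (λ z∈ → z∈) =
          v , zs , Z , z! , i⊆zs x∈ , j⊆zs (here refl)

-- Sparse orders, rounds and a complete bipartite subgraph

members : ∀ {n} → (Fin n → Bool) → List (Fin n)
members {n} p = filterᵇ p (allFin n)

members! : ∀ {n} (p : Fin n → Bool) → Unique (members p)
members! {n} p = filterᵇ-unique (Uniq.allFin⁺ n)

length-members : ∀ {n} (p : Fin n → Bool) → length (members p) ≡ count p (allFin n)
length-members {n} p = length-filterᵇ p (allFin n)

∈-members⁺ : ∀ {n} {p : Fin n → Bool} {z} → T (p z) → z ∈ members p
∈-members⁺ {p = p} {z} = ∈-filterᵇ⁺ {p = p} (∈-allFin z)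

∈-members⁻ : ∀ {n} {p : Fin n → Bool} {z} → z ∈ members p → T (p z)
∈-members⁻ {n} {p} z∈ = proj₂ (∈-filterᵇ⁻ {p = p} (allFin n) z∈)

count-∨ : ∀ {A : Set} (p q : A → Bool) xs → count (λ z → p z ∨ q z) xs ≤ count p xs + count q xs
count-∨ p q []       = z≤n
count-∨ p q (x ∷ xs) = ≤-trans (+-mono-≤ (𝟙-∨ (p x) (q x)) (count-∨ p q xs))
                               (≤-reflexive (interchange +-commutativeSemigroup (𝟙 (p x)) _ _ _))
  where
  𝟙-∨ : ∀ a b → 𝟙 (a ∨ b) ≤ 𝟙 a + 𝟙 b
  𝟙-∨ true  b = s≤s z≤n
  𝟙-∨ false b = ≤-refl

count-not : ∀ {A : Set} (p : A → Bool) xs → count p xs + count (not ∘ p) xs ≡ length xs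
count-not p []       = refl
count-not p (x ∷ xs) = trans (interchange +-commutativeSemigroup (𝟙 (p x)) _ _ _) (cong₂ _+_ (𝟙-not (p x)) (count-not p xs))
  where
  𝟙-not : ∀ a → 𝟙 a + 𝟙 (not a) ≡ 1
  𝟙-not true  = refl
  𝟙-not false = refl

cut : ∀ {A : Set} k (xs : List A) → k ≤ length xs → ∃₂ λ ys zs → xs ≡ ys ++ zs × length ys ≡ k
cut zero    xs       _        = [] , xs , refl , refl
cut (suc k) (x ∷ xs) (s≤s le) with ys , zs , eq , len ← cut k xs le = x ∷ ys , zs , cong (x ∷_) eq , cong suc len

-- Bounds the size after i rounds from `g₀` vertices: a set of size g leaves at most 2 ^ g traces,
-- so among M * 2 ^ g vertices some M have the same one.
growth : ℕ → ℕ → ℕ → ℕ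
growth M g₀ zero    = g₀
growth M g₀ (suc i) = growth M g₀ i + M * 2 ^ growth M g₀ i

T-not : ∀ {b} → T b → ¬ T (not b)
T-not {true} _ ()

half-not : ∀ {A : Set} (p : A → Bool) ws M k → M * 2 ^ suc k ≤ length ws →
           ¬ M * 2 ^ k ≤ length (filterᵇ p ws) → M * 2 ^ k ≤ length (filterᵇ (not ∘ p) ws)
half-not p ws M k le ¬le = ≮⇒≥ λ lt → <-irrefl refl (begin-strict
  length ws                       ≡⟨ count-not p ws ⟨
  count p ws + count (not ∘ p) ws ≡⟨ cong₂ _+_ (length-filterᵇ p ws) (length-filterᵇ (not ∘ p) ws) ⟨
  length (filterᵇ p ws) + length (filterᵇ (not ∘ p) ws) <⟨ +-mono-< (≰⇒> ¬le) lt ⟩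
  M * 2 ^ k + M * 2 ^ k           ≡⟨ *-distribˡ-+ M (2 ^ k) (2 ^ k) ⟨
  M * (2 ^ k + 2 ^ k)             ≡⟨ cong (λ j → M * (2 ^ k + j)) (+-identityʳ (2 ^ k)) ⟨
  M * 2 ^ suc k                   ≤⟨ le ⟩
  length ws                       ∎)
  where open ≤-Reasoning

module Density {n} (G : Graph n) where
  open Graph G using (adj; _∼_)
  open Walks G

  private variable
    w x y z : V
    xs ys : List V

  -- Each edge is counted at its earlier end; `size-↭` then allows any order of the vertices.
  size : List V → ℕ
  size []       = 0
  size (x ∷ xs) = count (adj x) xs + size xs

  size-↭ : xs ↭ ys → size xs ≡ size ys
  size-↭ Perm.refl   = refl
  size-↭ (prep x r)  = cong₂ _+_ (count-↭ (adj x) r) (size-↭ r)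
  size-↭ (swap {xs} {ys} x y r) = begin
    (𝟙 (adj x y) + count (adj x) xs) + (count (adj y) xs + size xs)
      ≡⟨ +-assoc (𝟙 (adj x y)) _ _ ⟩
    𝟙 (adj x y) + (count (adj x) xs + (count (adj y) xs + size xs))
      ≡⟨ cong (𝟙 (adj x y) +_) (x∙yz≈y∙xz +-commutativeSemigroup (count (adj x) xs) (count (adj y) xs) (size xs)) ⟩
    𝟙 (adj x y) + (count (adj y) xs + (count (adj x) xs + size xs))
      ≡⟨ +-assoc (𝟙 (adj x y)) _ _ ⟨
    (𝟙 (adj x y) + count (adj y) xs) + (count (adj x) xs + size xs)
      ≡⟨ cong₂ _+_ (cong₂ _+_ (cong 𝟙 (Graph.sym G x y)) (count-↭ (adj y) r))
                   (cong₂ _+_ (count-↭ (adj x) r) (size-↭ r)) ⟩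
    (𝟙 (adj y x) + count (adj y) ys) + (count (adj x) ys + size ys) ∎
    where open ≡-Reasoning
  size-↭ (Perm.trans r s) = trans (size-↭ r) (size-↭ s)

  size≤ : ∀ xs → size xs ≤ length xs * length xs
  size≤ []       = z≤n
  size≤ (x ∷ xs) = begin
    count (adj x) xs + size xs             ≤⟨ +-mono-≤ (count≤length (adj x) xs) (size≤ xs) ⟩
    length xs + length xs * length xs      ≡⟨⟩
    suc (length xs) * length xs            ≤⟨ *-monoʳ-≤ (suc (length xs)) (n≤1+n (length xs)) ⟩
    suc (length xs) * suc (length xs)      ∎
    where open ≤-Reasoning

  record Biclique (t M : ℕ) : Set where
    field
      as bs : List V
      as!   : Unique as
      bs!   : Unique bs
      |as|  : length as ≡ t
      |bs|  : M ≤ length bs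
      a∼b   : ∀ {a b} → a ∈ as → b ∈ bs → a ∼ b

  module _ (t M : ℕ) (0<M : 0 < M) where

    -- Each vertex of `ts` splits `ws` into neighbours and non-neighbours, and a part that is still
    -- large enough is kept; `as` collects the vertices whose neighbours were kept. By the last
    -- component `as` is the whole trace in `ts`.
    same-trace : ∀ ts ws → Unique ts → Unique ws → M * 2 ^ length ts ≤ length ws →
                 ∃₂ λ as bs → Unique as × Unique bs × M ≤ length bs ×
                   (∀ {a} → a ∈ as → a ∈ ts) × (∀ {b} → b ∈ bs → b ∈ ws) ×
                   (∀ {a b} → a ∈ as → b ∈ bs → a ∼ b) ×
                   (∀ {b} → b ∈ bs → count (adj b) ts ≡ length as)
    same-trace [] ws _ ws! le =
      [] , ws , [] , ws! , ≤-trans (≤-reflexive (sym (*-identityʳ M))) le , (λ ()) , (λ b∈ → b∈) , (λ ()) , λ _ → refl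
    same-trace (z ∷ ts) ws z! ws! le with _ ∷ ts! ← z!
      with M * 2 ^ length ts ≤? length (filterᵇ (adj z) ws)
    ... | yes le₁
      with as , bs , as! , bs! , big , as⊆ , bs⊆ , ab , tr ←
        same-trace ts _ ts! (filterᵇ-unique {p = adj z} ws!) le₁ =
      z ∷ as , bs , ∉-∷⁺ (λ z∈ → ∉-∷⁻ z! (as⊆ z∈)) as! , bs! , big ,
      (λ { (here refl) → here refl ; (there a∈) → there (as⊆ a∈) }) ,
      (λ b∈ → proj₁ (∈-filterᵇ⁻ ws (bs⊆ b∈))) ,
      (λ { (here refl) b∈ → proj₂ (∈-filterᵇ⁻ ws (bs⊆ b∈)) ; (there a∈) b∈ → ab a∈ b∈ }) ,
      (λ b∈ → cong₂ _+_ (𝟙-T (∼-sym (proj₂ (∈-filterᵇ⁻ {p = adj z} ws (bs⊆ b∈))))) (tr b∈))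
    ... | no ¬le₁
      with as , bs , as! , bs! , big , as⊆ , bs⊆ , ab , tr ←
        same-trace ts _ ts! (filterᵇ-unique {p = not ∘ adj z} ws!)
          (half-not (adj z) ws M (length ts) le ¬le₁) =
      as , bs , as! , bs! , big , (λ a∈ → there (as⊆ a∈)) ,
      (λ b∈ → proj₁ (∈-filterᵇ⁻ ws (bs⊆ b∈))) , ab ,
      (λ b∈ → cong₂ _+_ (𝟙-¬T (λ b∼z → T-not (∼-sym b∼z) (proj₂ (∈-filterᵇ⁻ {p = not ∘ adj z} ws (bs⊆ b∈))))) (tr b∈))

    module _ {ss : List V} where

      level : ℕ → V → Bool
      level zero    z = ⌊ z ∈? ss ⌋
      level (suc i) z = level i z ∨ (t ≤ᵇ count (adj z) (members (level i)))

      new : ℕ → V → Bool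
      new i z = t ≤ᵇ count (adj z) (members (level i))

      level-suc : ∀ i → T (level i z) → T (level (suc i) z)
      level-suc i Lz = Equivalence.from T-∨ (inj₁ Lz)

      level-new : ∀ i → t ≤ count (adj z) (members (level i)) → T (level (suc i) z)
      level-new i le = Equivalence.from T-∨ (inj₂ (≤⇒≤ᵇ le))

      level-zero : ∀ i → z ∈ ss → T (level i z)
      level-zero zero    z∈ = fromWitness z∈
      level-zero (suc i) z∈ = level-suc i (level-zero i z∈)

      grow-level : ∀ i → Biclique t M ⊎ length (members (level (suc i))) ≤
                         length (members (level i)) + M * 2 ^ length (members (level i))
      grow-level i with M * 2 ^ length (members (level i)) ≤? length (members (new i))
      ... | no ¬le = inj₂ (begin
          length (members (level (suc i))) ≡⟨ length-members (level (suc i)) ⟩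
          count (level (suc i)) (allFin n) ≤⟨ count-∨ (level i) (new i) (allFin n) ⟩
          count (level i) (allFin n) + count (new i) (allFin n)
            ≡⟨ cong₂ _+_ (length-members (level i)) (length-members (new i)) ⟨
          length (members (level i)) + length (members (new i)) ≤⟨ +-monoʳ-≤ (length (members (level i))) (≰⇒≥ ¬le) ⟩
          length (members (level i)) + M * 2 ^ length (members (level i)) ∎)
        where open ≤-Reasoning
      ... | yes le
        with as , bs , as! , bs! , big , as⊆ , bs⊆ , ab , tr ←
          same-trace (members (level i)) (members (new i)) (members! (level i)) (members! (new i)) le
        = inj₁ (biclique as! bs! big ab bs⊆ tr)
        where
        biclique : ∀ {as bs} → Unique as → Unique bs → M ≤ length bs →
                   (∀ {a b} → a ∈ as → b ∈ bs → a ∼ b) →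
                   (∀ {b} → b ∈ bs → b ∈ members (new i)) →
                   (∀ {b} → b ∈ bs → count (adj b) (members (level i)) ≡ length as) → Biclique t M
        -- Since M is positive, `bs` has a vertex. Its neighbours in the level, at least t of them,
        -- are exactly as many as `as` has entries, so t entries can be picked.
        biclique {bs = []} _ _ big _ _ _ = contradiction (≤-trans 0<M big) λ ()
        biclique {as} {b ∷ bs} as! bs! big ab bs⊆ tr
          with as₁ , as₂ , refl , len ← cut t as
                 (≤-trans (≤ᵇ⇒≤ t _ (∈-members⁻ {p = new i} (bs⊆ (here refl)))) (≤-reflexive (tr (here refl)))) =
          record { as = as₁ ; bs = b ∷ bs ; as! = proj₁ (Unique-++⁻ as₁ as!) ; bs! = bs! ; |as| = len
                 ; |bs| = big ; a∼b = λ a∈ → ab (∈-++⁺ˡ a∈) }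

      levels-bounded : ∀ i → Biclique t M ⊎ length (members (level i)) ≤ growth M (length (members (level 0))) i
      levels-bounded zero = inj₂ ≤-refl
      levels-bounded (suc i) with levels-bounded i | grow-level i
      ... | inj₁ K | _       = inj₁ K
      ... | inj₂ _ | inj₁ K  = inj₁ K
      ... | inj₂ le | inj₂ le′ =
        inj₂ (≤-trans le′ (+-mono-≤ le (*-monoʳ-≤ M (^-monoʳ-≤ 2 le))))

      data Full : List V → Set where
        []  : Full []
        _∷_ : w ∈ ss ⊎ t ≤ count (adj w) xs → Full xs → Full (w ∷ xs)

      full-suffix : Full xs → Unique xs → w ∈ xs →
                    ∃[ r ] Full (w ∷ r) × Unique (w ∷ r) × (∀ {z} → z ∈ w ∷ r → z ∈ xs)
      full-suffix F@(_ ∷ _) u! (here refl) = _ , F , u! , λ z∈ → z∈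
      full-suffix (_ ∷ F) (_ ∷ u!) (there w∈) with r , F′ , r! , r⊆ ← full-suffix F u! w∈ =
        r , F′ , r! , λ z∈ → there (r⊆ z∈)

      -- A vertex missing after i + 1 rounds has t later neighbours but fewer than t neighbours
      -- reached after i rounds. The path goes on to a later neighbour not yet reached; following
      -- the order, it never returns.
      long-path : ∀ i → Full (w ∷ xs) → Unique (w ∷ xs) → ¬ T (level i w) →
                  ∃₂ λ y ps → Walk w y ps × Unique (w ∷ ps) × (∀ {z} → z ∈ ps → z ∈ xs) × length ps ≡ i
      long-path zero F u! _ = _ , [] , [] , ([] ∷ []) , (λ ()) , refl
      long-path (suc i) (inj₁ w∈ ∷ F) u! ¬L = contradiction (level-zero (suc i) w∈) ¬L
      long-path {w} {xs} (suc i) (inj₂ le ∷ F) w!@(_ ∷ u!) ¬L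
        with u , u∈ , w∼u , u∉ ← ∃-new (adj w) {ls = members (level i)} u! (<-≤-trans (≰⇒> (λ le′ → ¬L (level-new i le′))) le)
        with r , F′ , r! , r⊆ ← full-suffix F u! u∈
        with y , ps , W , ps! , ps⊆ , len ← long-path i F′ r! (λ Lu → u∉ (∈-members⁺ {p = level i} Lu))
        = y , u ∷ ps , w∼u ∷ W ,
          ∉-∷⁺ (λ { (here refl) → ∉-∷⁻ w! u∈ ; (there w∈) → ∉-∷⁻ w! (r⊆ (there (ps⊆ w∈))) }) ps! ,
          (λ { (here refl) → u∈ ; (there z∈) → r⊆ (there (ps⊆ z∈)) }) , cong suc len

  module _ {t c : ℕ} where

    data Order : List V → Set where
      stop : length xs ≤ c → Order xs
      _∷_  : count (adj w) xs ≤ t → Order xs → Order (w ∷ xs)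

    order : (∀ us → Unique us → c < length us → ∃[ w ] w ∈ us × count (adj w) us ≤ t) →
            ∀ us → Unique us → ∃[ xs ] us ↭ xs × Order xs
    order light us = go (length us) us ≤-refl
      where
      go : ∀ k us → length us ≤ k → Unique us → ∃[ xs ] us ↭ xs × Order xs
      go zero    us le us! = us , ↭-refl , stop (≤-trans le z≤n)
      go (suc k) us le us! with length us ≤? c
      ... | yes small = us , ↭-refl , stop small
      ... | no ¬small with w , w∈ , lw ← light us us! (≰⇒> ¬small) with us′ , r ← ∈⇒↭ w∈
        with xs , r′ , o ← go k us′ (s≤s⁻¹ (subst (_≤ suc k) (↭-length r) le))
                             (proj₁ (proj₂ (Unique-++⁻ (w ∷ []) (Unique-↭ r us!)))) =
        w ∷ xs , ↭-trans r (prep w r′) ,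
        ≤-trans (≤-reflexive (sym (count-↭ (adj w) r′)))
          (≤-trans (m≤n+m _ (𝟙 (adj w w))) (≤-trans (≤-reflexive (sym (count-↭ (adj w) r))) lw)) ∷ o

    sparse : Order xs → List V
    sparse {xs} (stop _) = xs
    sparse {w ∷ xs} (_ ∷ o) with t ≤? count (adj w) xs
    ... | yes _ = sparse o
    ... | no  _ = w ∷ sparse o

    -- An exceptional vertex before the final part contributes at least one edge less than t. The
    -- final part has at most c vertices: c * c pays for its edges and c for its vertices, all
    -- exceptional.
    sparse-bound : (o : Order xs) → size xs + length (sparse o) ≤ t * length xs + (c * c + c)
    sparse-bound {xs} (stop le) = ≤-trans (+-mono-≤ (≤-trans (size≤ xs) (*-mono-≤ le le)) le) (m≤n+m _ (t * length xs))
    sparse-bound {w ∷ xs} (lw ∷ o) with t ≤? count (adj w) xs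
    ... | yes _ = begin
      (count (adj w) xs + size xs) + length (sparse o) ≡⟨ +-assoc (count (adj w) xs) _ _ ⟩
      count (adj w) xs + (size xs + length (sparse o)) ≤⟨ +-mono-≤ lw (sparse-bound o) ⟩
      t + (t * length xs + (c * c + c))                ≡⟨ +-assoc t _ _ ⟨
      (t + t * length xs) + (c * c + c)                ≡⟨ cong (_+ (c * c + c)) (*-suc t (length xs)) ⟨
      t * suc (length xs) + (c * c + c)                ∎
      where open ≤-Reasoning
    ... | no ¬full = begin
      (count (adj w) xs + size xs) + suc (length (sparse o)) ≡⟨ +-suc _ _ ⟩
      suc ((count (adj w) xs + size xs) + length (sparse o)) ≡⟨ cong suc (+-assoc (count (adj w) xs) _ _) ⟩
      suc (count (adj w) xs) + (size xs + length (sparse o)) ≤⟨ +-mono-≤ (≰⇒> ¬full) (sparse-bound o) ⟩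
      t + (t * length xs + (c * c + c))                ≡⟨ +-assoc t _ _ ⟨
      (t + t * length xs) + (c * c + c)                ≡⟨ cong (_+ (c * c + c)) (*-suc t (length xs)) ⟨
      t * suc (length xs) + (c * c + c)                ∎
      where open ≤-Reasoning

    full-mono : ∀ {M 0<M ss ss′ xs} → (∀ {z} → z ∈ ss → z ∈ ss′) → Full t M 0<M {ss} xs → Full t M 0<M {ss′} xs
    full-mono sub []            = []
    full-mono sub (inj₁ w∈ ∷ F) = inj₁ (sub w∈) ∷ full-mono sub F
    full-mono sub (inj₂ le ∷ F) = inj₂ le ∷ full-mono sub F

    sparse-full : ∀ {M 0<M} (o : Order xs) → Full t M 0<M {sparse o} xs
    sparse-full {xs} (stop _) = all xs (λ z∈ → z∈)
      where
      all : ∀ ys → (∀ {z} → z ∈ ys → z ∈ xs) → Full t _ _ {xs} ys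
      all []       _   = []
      all (y ∷ ys) sub = inj₁ (sub (here refl)) ∷ all ys (λ z∈ → sub (there z∈))
    sparse-full {w ∷ xs} (_ ∷ o) with t ≤? count (adj w) xs
    ... | yes le = inj₂ le ∷ sparse-full o
    ... | no  _  = inj₁ (here refl) ∷ full-mono there (sparse-full o)

  -- The density and `sparse-bound` leave at most t * t + (c * c + c) exceptional vertices to start
  -- from. If `suc (c * c)` rounds all stay small, a vertex is missing at the end, and `long-path`
  -- yields a path with more than c * c edges.
  find-biclique : ∀ {t c M} → 0 < M →
    (∀ us → Unique us → c < length us → ∃[ w ] w ∈ us × count (adj w) us ≤ t) →
    (∀ {x y xs} → Walk x y xs → Unique (x ∷ xs) → length xs ≤ c * c) →
    t * n ≤ size (allFin n) + t * t → growth M (t * t + (c * c + c)) (suc (c * c)) < n → Biclique t M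
  find-biclique {t} {c} {M} 0<M light short dense large
    with xs , r , o ← order light (allFin n) (Uniq.allFin⁺ n)
    with levels-bounded t M 0<M {sparse o} (suc (c * c))
  ... | inj₁ K = K
  ... | inj₂ le = contradiction (short W W!) (<⇒≱ (≤-reflexive (sym len)))
    where
    open ≤-Reasoning
    L = level t M 0<M {sparse o}
    |xs| : length xs ≡ n
    |xs| = trans (sym (↭-length r)) (length-tabulate {n = n} (λ i → i))
    xs! : Unique xs
    xs! = Unique-↭ r (Uniq.allFin⁺ n)
    L₀≤ : length (members (L 0)) ≤ t * t + (c * c + c)
    L₀≤ = begin
      length (members (L 0)) ≤⟨ length-⊆ (members! (L 0)) (λ z∈ → toWitness (∈-members⁻ {p = L 0} z∈)) ⟩
      length (sparse o)      ≤⟨ +-cancelˡ-≤ (size xs) _ _ (begin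
          size xs + length (sparse o)        ≤⟨ sparse-bound o ⟩
          t * length xs + (c * c + c)        ≡⟨ cong (λ k → t * k + (c * c + c)) |xs| ⟩
          t * n + (c * c + c)                ≤⟨ +-monoˡ-≤ (c * c + c) dense ⟩
          size (allFin n) + t * t + (c * c + c) ≡⟨ cong (λ k → k + t * t + (c * c + c)) (size-↭ r) ⟩
          size xs + t * t + (c * c + c)      ≡⟨ +-assoc (size xs) _ _ ⟩
          size xs + (t * t + (c * c + c))    ∎) ⟩
      t * t + (c * c + c)    ∎
    growth-mono : ∀ {a b} → a ≤ b → ∀ i → growth M a i ≤ growth M b i
    growth-mono a≤b zero    = a≤b
    growth-mono a≤b (suc i) = +-mono-≤ (growth-mono a≤b i) (*-monoʳ-≤ M (^-monoʳ-≤ 2 (growth-mono a≤b i)))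
    fresh = ∃-new′ {us = xs} {ls = members (L (suc (c * c)))} xs! (begin-strict
      length (members (L (suc (c * c)))) ≤⟨ le ⟩
      growth M (length (members (L 0))) (suc (c * c)) ≤⟨ growth-mono L₀≤ (suc (c * c)) ⟩
      growth M (t * t + (c * c + c)) (suc (c * c)) <⟨ large ⟩
      n                                  ≡⟨ |xs| ⟨
      length xs                          ∎)
    suffix = full-suffix t M 0<M (sparse-full o) xs! (proj₁ (proj₂ fresh))
    found = long-path t M 0<M (suc (c * c)) (proj₁ (proj₂ suffix)) (proj₁ (proj₂ (proj₂ suffix)))
              (λ Lw → proj₂ (proj₂ fresh) (∈-members⁺ {p = L (suc (c * c))} Lw))
    W = proj₁ (proj₂ (proj₂ found))
    W! = proj₁ (proj₂ (proj₂ (proj₂ found)))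
    len = proj₂ (proj₂ (proj₂ (proj₂ (proj₂ found))))

-- An edge outside A lies on a long cycle

module Extension {n} (G : Graph n) (robust : Walks.Robust G) {t M} (2≤t : 2 ≤ t) (t<M : t < M)
  (no-long-cycle : ¬ Posa.Cycle> G robust (t + t)) (K : Density.Biclique G t M) where

  open Graph G using (adj; _∼_)
  open Walks G
  open Linkage G robust
  open Density.Biclique K

  private
    ws : List V
    ws = as ++ bs

    as≢bs : ∀ {a b} → a ∈ as → b ∈ bs → a ≢ b
    as≢bs a∈ b∈ = ∼⇒≢ (a∼b a∈ b∈)

    1<as : 1 < length as
    1<as = ≤-trans 2≤t (≤-reflexive (sym |as|))

    1<bs : 1 < length bs
    1<bs = ≤-trans 2≤t (≤-trans (<⇒≤ t<M) |bs|)

    first-a : ∃ (_∈ as)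
    first-a with a , a∈ , _ ← ∃-new′ {ls = []} as! (<⇒≤ 1<as) = a , a∈

  module _ {v w : V} (v∉as : v ∉ as) (w∉as : w ∉ as) (v∼w : v ∼ w) where

    Anchor : Set
    Anchor = ∃₂ λ y e → y ∈ ws × e ∈ ws × Link (v ∷ []) w y (e ∷ [])

    w∉ws : w ∉ bs → w ∉ ws
    w∉ws w∉bs w∈ with ∈-++⁻ as w∈
    ... | inj₁ w∈as = w∉as w∈as
    ... | inj₂ w∈bs = w∉bs w∈bs
    partner : ∀ {y} → y ∈ ws → ∃[ e ] e ∈ ws × y ∼ e × e ≢ v
    partner y∈ with ∈-++⁻ as y∈
    ... | inj₂ y∈bs with a , a∈ ← first-a = a , ∈-++⁺ˡ a∈ , ∼-sym (a∼b a∈ y∈bs) , λ { refl → v∉as a∈ }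
    ... | inj₁ y∈as with e , e∈ , e∉ ← ∃-new′ {ls = v ∷ []} bs! 1<bs =
      e , ∈-++⁺ʳ as e∈ , a∼b y∈as e∈ , λ { refl → e∉ (here refl) }
    e∉ : ∀ {y e ss} → All (λ s → s ∉ w ∷ [] × s ∉ ws × s ≢ v) ss → e ∈ ws → y ∼ e → e ∉ ss ∷ʳ y
    e∉ {ss = ss} inn e∈ y∼e e∈′ with ∈-∷ʳ⁻ ss e∈′
    ... | inj₁ e∈ss = proj₁ (proj₂ (All.lookup inn e∈ss)) e∈
    ... | inj₂ refl = ∼-irrefl y∼e
    dis : ∀ {y e ss} → w ∉ bs → All (λ s → s ∉ w ∷ [] × s ∉ ws × s ≢ v) ss → y ∈ ws → y ≢ v → e ∈ ws → e ≢ v →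
          ∀ {z} → z ∈ w ∷ v ∷ [] → z ∉ (ss ∷ʳ y) ++ e ∷ []
    dis {ss = ss} w∉bs inn y∈ y≢v e∈ e≢v z∈ z∈′ with ∈-∷ʳ⁻ (ss ∷ʳ _) z∈′
    dis w∉bs inn y∈ y≢v e∈ e≢v (here refl) z∈′ | inj₂ refl = w∉ws w∉bs e∈
    dis w∉bs inn y∈ y≢v e∈ e≢v (there (here refl)) z∈′ | inj₂ refl = e≢v refl
    dis {ss = ss} w∉bs inn y∈ y≢v e∈ e≢v z∈ z∈′ | inj₁ z∈″ with ∈-∷ʳ⁻ ss z∈″
    dis w∉bs inn y∈ y≢v e∈ e≢v (here refl) z∈′ | inj₁ _ | inj₂ refl = w∉ws w∉bs y∈
    dis w∉bs inn y∈ y≢v e∈ e≢v (there (here refl)) z∈′ | inj₁ _ | inj₂ refl = y≢v refl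
    dis w∉bs inn y∈ y≢v e∈ e≢v (here refl) z∈′ | inj₁ _ | inj₁ z∈ss = proj₁ (All.lookup inn z∈ss) (here refl)
    dis w∉bs inn y∈ y≢v e∈ e≢v (there (here refl)) z∈′ | inj₁ _ | inj₁ z∈ss = proj₂ (proj₂ (All.lookup inn z∈ss)) refl

    -- The linkage is built along a path from `w` that avoids `v` and meets `ws` only in its end
    -- `y`. The second target `e` is a neighbour of `y` other than `v`, which keeps it off that
    -- path.
    anchor : Anchor
    anchor with w ∈? bs
    ... | yes w∈ with a , a∈ ← first-a =
      w , a , ∈-++⁺ʳ as w∈ , ∈-++⁺ˡ a∈ ,
      link-path [] (here refl) (here refl) (λ { (here refl) → ∼-irrefl v∼w }) ([] ∷ [])
        (λ { (here refl) (here refl) → w∉as a∈ ; (there (here refl)) (here refl) → v∉as a∈ })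
    ... | no w∉bs with a , a∈ ← first-a
      with xs , W , W≢ ← robust v {w} {a} (λ { refl → ∼-irrefl v∼w }) (λ { refl → v∉as a∈ })
      with bridge {_} {y} {ss} B (here refl) y∈ inn ss! _ y≢v ←
             find-bridge (w ∷ []) ws (_≢ v) (λ { (here refl) → w∉ws w∉bs }) W (here refl) (∈-++⁺ˡ a∈)
               (λ { refl → ∼-irrefl v∼w }) W≢
      with e , e∈ , y∼e , e≢v ← partner y∈
      = y , e , y∈ , e∈ , link-path B (here refl) (here refl) (λ { (here refl) → ∼-irrefl v∼w })
          (Unique-∷ʳ⁺ (Unique-∷ʳ⁺ ss! (λ y∈ss → proj₁ (proj₂ (All.lookup inn y∈ss)) y∈)) (e∉ inn e∈ y∼e))
          (dis w∉bs inn y∈ y≢v e∈ e≢v)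

    -- The end conditions are parameters so that one end at a time can be moved into `as`. `only`
    -- concerns `as` alone, because an end in `bs` becomes an inner vertex when the ear is
    -- prolonged; `fs` is reserved for the rest of the cycle.
    record Ear (fs : List V) (P Q : V → Set) : Set where
      constructor ear
      field
        {a b}  : V
        {qs}   : List V
        walk   : Walk a b qs
        qs!    : Unique (a ∷ qs)
        Pa     : P a
        Qb     : Q b
        a≢b    : a ≢ b
        only   : ∀ {z} → z ∈ a ∷ qs → z ∈ as → z ≡ a ⊎ z ≡ b
        fresh  : ∀ {z} → z ∈ fs → z ∉ a ∷ qs
        v∈     : v ∈ a ∷ qs
        w∈     : w ∈ a ∷ qs

    flip-ear : ∀ {fs P Q} → Ear fs P Q → Ear fs Q P
    flip-ear (ear W q! Pa Qb a≢b only fresh v∈ w∈) with qs′ , W′ , r ← reverseʷ W =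
      ear W′ (Unique-↭ (↭-sym r) q!) Qb Pa (a≢b ∘ sym)
        (λ z∈ z∈as → Sum.swap (only (∈-resp-↭ r z∈) z∈as))
        (λ z∈ z∈q → fresh z∈ (∈-resp-↭ r z∈q)) (∈-resp-↭ (↭-sym r) v∈) (∈-resp-↭ (↭-sym r) w∈)

    -- An end in `bs` is adjacent to all of `as`; since t ≥ 2, one of these vertices differs from
    -- the opposite end.
    end-in-as : ∀ {fs P} → (∀ {z} → z ∈ fs → z ∈ bs) → Ear fs P (_∈ ws) → Ear fs P (_∈ as)
    end-in-as {fs} {P} fs⊆ (ear {a} {b} {qs} W q! Pa b∈ a≢b only fresh v∈ w∈) with ∈-++⁻ as b∈
    ... | inj₁ b∈as = ear W q! Pa b∈as a≢b only fresh v∈ w∈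
    ... | inj₂ b∈bs with c , c∈ , c∉ ← ∃-new′ {ls = a ∷ []} as! 1<as =
      ear (W ++ʷ ∼-sym (a∼b c∈ b∈bs) ∷ []) (Unique-∷ʳ⁺ q! c∉q) Pa c∈ (λ { refl → c∉ (here refl) })
        only′ fresh′ (∈-++⁺ˡ v∈) (∈-++⁺ˡ w∈)
      where
      c∉q : c ∉ a ∷ qs
      c∉q c∈q with only c∈q c∈
      ... | inj₁ refl = c∉ (here refl)
      ... | inj₂ refl = as≢bs c∈ b∈bs refl
      only′ : ∀ {z} → z ∈ a ∷ qs ∷ʳ c → z ∈ as → z ≡ a ⊎ z ≡ c
      only′ z∈ z∈as with ∈-∷ʳ⁻ (a ∷ qs) z∈
      ... | inj₂ z≡c = inj₂ z≡c
      ... | inj₁ z∈q with only z∈q z∈as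
      ...   | inj₁ z≡a  = inj₁ z≡a
      ...   | inj₂ refl = contradiction refl (as≢bs z∈as b∈bs)
      fresh′ : ∀ {z} → z ∈ fs → z ∉ a ∷ qs ∷ʳ c
      fresh′ z∈ z∈q with ∈-∷ʳ⁻ (a ∷ qs) z∈q
      ... | inj₁ z∈′  = fresh z∈ z∈′
      ... | inj₂ refl = as≢bs c∈ (fs⊆ z∈) refl

    zigzag : ∀ {a b} os fs → a ∈ as → b ∈ as → (∀ {z} → z ∈ os → z ∈ as) → (∀ {z} → z ∈ fs → z ∈ bs) →
             length fs ≡ suc (length os) → ∃[ zs ] Walk b a zs × zs ↭ a ∷ os ++ fs
    zigzag [] (f ∷ []) a∈ b∈ os⊆ fs⊆ _ =
      f ∷ _ ∷ [] , a∼b b∈ (fs⊆ (here refl)) ∷ ∼-sym (a∼b a∈ (fs⊆ (here refl))) ∷ [] , swap f _ ↭-refl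
    zigzag {a} (o ∷ os) (f ∷ fs) a∈ b∈ os⊆ fs⊆ len
      with zs , Z , r ← zigzag os fs a∈ (os⊆ (here refl)) (os⊆ ∘ there) (fs⊆ ∘ there) (suc-injective len) =
      f ∷ o ∷ zs , a∼b b∈ (fs⊆ (here refl)) ∷ ∼-sym (a∼b (os⊆ (here refl)) (fs⊆ (here refl))) ∷ Z ,
      ↭-trans (prep f (prep o r)) (↭-trans (↭-sym (shift f (o ∷ a ∷ os) fs)) (swap o a ↭-refl))

    -- The zigzag runs through the other t - 2 vertices of `as` and t - 1 of `fs`. With the ends
    -- `a`, `b` and the vertices `v`, `w` of the ear this makes at least 2t + 1 vertices.
    close-ear : ∀ {fs} → Unique fs → (∀ {z} → z ∈ fs → z ∈ bs) → t ≤ suc (length fs) → ¬ Ear fs (_∈ as) (_∈ as)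
    close-ear {fs} fs! fs⊆ t≤ (ear {a} {b} {qs} W q! a∈ b∈ a≢b only fresh v∈ w∈)
      with as₁ , r₁ ← ∈⇒↭ a∈ with ∈-resp-↭ r₁ b∈
    ... | here b≡a = a≢b (sym b≡a)
    ... | there b∈₁ with os , r₂ ← ∈⇒↭ b∈₁ = finish (cut (suc (length os)) fs (s≤s⁻¹ (≤-trans (≤-reflexive len-os) t≤)))
      where
      r : as ↭ a ∷ b ∷ os
      r = ↭-trans r₁ (prep a r₂)
      len-os : 2 + length os ≡ t
      len-os = trans (sym (↭-length r)) |as|
      os⊆ : ∀ {z} → z ∈ os → z ∈ as
      os⊆ z∈ = ∈-resp-↭ (↭-sym r) (there (there z∈))
      abo! : Unique (a ∷ b ∷ os)
      abo! = Unique-↭ r as!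
      4≤ : 3 ≤ length qs
      4≤ = s≤s⁻¹ (length-⊆ {xs = a ∷ b ∷ v ∷ w ∷ []} {a ∷ qs}
             (∉-∷⁺ (λ { (here eq) → a≢b eq ; (there (here refl)) → v∉as a∈ ; (there (there (here refl))) → w∉as a∈ })
               (∉-∷⁺ (λ { (here refl) → v∉as b∈ ; (there (here refl)) → w∉as b∈ })
                 (∉-∷⁺ (λ { (here refl) → ∼-irrefl v∼w }) ([] ∷ []))))
             (λ { (here refl) → here refl ; (there (here refl)) → last-∈ W
                ; (there (there (here refl))) → v∈ ; (there (there (there (here refl)))) → w∈ }))
      finish : (∃₂ λ gs hs → fs ≡ gs ++ hs × length gs ≡ suc (length os)) → ⊥
      finish (gs , hs , refl , len-gs)
        with zs , Z , p ← zigzag os gs a∈ b∈ os⊆ (λ z∈ → fs⊆ (∈-++⁺ˡ z∈)) len-gs =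
        no-long-cycle (a , qs ++ zs , W ++ʷ Z ,
          Unique-++⁺ (proj₁ (proj₂ (Unique-++⁻ (a ∷ []) q!))) (Unique-↭ (↭-sym p) aog!)
            (λ z∈q z∈z → disj z∈q (∈-resp-↭ p z∈z)) ,
          (begin
            suc (t + t)                              ≡⟨ cong (λ k → suc (k + k)) len-os ⟨
            suc ((2 + length os) + (2 + length os))  ≡⟨ cong (3 +_) (trans (+-suc _ _) (cong suc (+-suc _ _))) ⟩
            3 + (2 + (length os + length os))        ≤⟨ +-mono-≤ 4≤ (≤-reflexive (sym (len-zs p))) ⟩
            length qs + length zs                    ≡⟨ length-++ qs ⟨
            length (qs ++ zs)                        ∎))
        where
        open ≤-Reasoning
        aog! : Unique (a ∷ os ++ gs)
        aog! = ∉-∷⁺ (λ z∈ → [ (λ z∈os → ∉-∷⁻ abo! (there z∈os)) , (λ z∈gs → as≢bs a∈ (fs⊆ (∈-++⁺ˡ z∈gs)) refl) ]′ (∈-++⁻ os z∈))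
                 (Unique-++⁺ (proj₁ (proj₂ (Unique-++⁻ (a ∷ b ∷ []) abo!))) (proj₁ (Unique-++⁻ gs fs!))
                   (λ z∈os z∈gs → as≢bs (os⊆ z∈os) (fs⊆ (∈-++⁺ˡ z∈gs)) refl))
        disj : ∀ {z} → z ∈ qs → z ∉ a ∷ os ++ gs
        disj z∈q (here refl) = ∉-∷⁻ q! z∈q
        disj z∈q (there z∈) with ∈-++⁻ os z∈
        ... | inj₂ z∈gs = fresh (∈-++⁺ˡ z∈gs) (there z∈q)
        ... | inj₁ z∈os with only (there z∈q) (os⊆ z∈os)
        ...   | inj₁ refl = ∉-∷⁻ q! z∈q
        ...   | inj₂ refl with _ ∷ b! ← abo! = ∉-∷⁻ b! z∈os
        len-zs : ∀ {zs} → zs ↭ a ∷ os ++ gs → length zs ≡ 2 + (length os + length os)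
        len-zs p = trans (↭-length p) (cong suc (trans (length-++ os) (trans (cong (length os +_) len-gs) (+-suc _ _))))

    -- Both paths of the linkage are cut where they first meet `ws` and joined by the edge between
    -- `v` and `w`. Only the two ends can lie in `bs`, which has at least t + 1 vertices, so at
    -- least t - 1 stay free.
    ws-ear : ∀ {y e} → y ∈ ws → e ∈ ws → Link (v ∷ []) w y (e ∷ []) →
             ∃[ fs ] Unique fs × (∀ {z} → z ∈ fs → z ∈ bs) × t ≤ suc (length fs) × Ear fs (_∈ ws) (_∈ ws)
    ws-ear {y} {e} y∈ e∈ (link {u₁} {u₂} {j} {ps₁} {ps₂} A B ends (here refl) uniq _ _ _ _)
      with u₁! , u₂! , u# ← Unique-++⁻ (u₁ ∷ ps₁) uniq
      with h₁ , hs₁ , (W₁ , h₁∈ , only₁) , h₁! , sub₁ ← first-hit ws A u₁! y∈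
      with h₂ , hs₂ , (W₂ , h₂∈ , only₂) , h₂! , sub₂ ← first-hit ws B u₂! e∈
      with rs , R , r ← reverseʷ W₁
      = fs , filterᵇ-unique bs! , (λ z∈ → proj₁ (∈-filterᵇ⁻ bs z∈)) , t≤ ,
        ear (R ++ʷ proj₁ (starts ends) ∷ W₂) (Unique-↭ (↭-sym r′) hh!) h₁∈ h₂∈ h₁≢h₂
          (λ z∈ z∈as → only (∈-resp-↭ r′ z∈) (∈-++⁺ˡ z∈as))
          fresh
          (∈-resp-↭ (↭-sym r′) (proj₁ (proj₂ (starts ends)))) (∈-resp-↭ (↭-sym r′) (proj₂ (proj₂ (starts ends))))
      where
      r′ : h₁ ∷ rs ++ u₂ ∷ hs₂ ↭ (u₁ ∷ hs₁) ++ u₂ ∷ hs₂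
      r′ = ++⁺ʳ (u₂ ∷ hs₂) r
      sub₁′ : ∀ {z} → z ∈ u₁ ∷ hs₁ → z ∈ u₁ ∷ ps₁
      sub₁′ (here eq)  = here eq
      sub₁′ (there z∈) = there (sub₁ z∈)
      sub₂′ : ∀ {z} → z ∈ u₂ ∷ hs₂ → z ∈ u₂ ∷ ps₂
      sub₂′ (here eq)  = here eq
      sub₂′ (there z∈) = there (sub₂ z∈)
      h# : ∀ {z} → z ∈ u₁ ∷ hs₁ → z ∉ u₂ ∷ hs₂
      h# z∈ z∈′ = u# (sub₁′ z∈) (sub₂′ z∈′)
      hh! : Unique ((u₁ ∷ hs₁) ++ u₂ ∷ hs₂)
      hh! = Unique-++⁺ h₁! h₂! h#
      h₁≢h₂ : h₁ ≢ h₂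
      h₁≢h₂ refl = h# (last-∈ W₁) (last-∈ W₂)
      only : ∀ {z} → z ∈ (u₁ ∷ hs₁) ++ u₂ ∷ hs₂ → z ∈ ws → z ≡ h₁ ⊎ z ≡ h₂
      only z∈ z∈ws with ∈-++⁻ (u₁ ∷ hs₁) z∈
      ... | inj₁ z∈₁ = inj₁ (only₁ z∈₁ z∈ws)
      ... | inj₂ z∈₂ = inj₂ (only₂ z∈₂ z∈ws)
      starts : (u₁ ≡ w × u₂ ∈ v ∷ []) ⊎ (u₂ ≡ w × u₁ ∈ v ∷ []) →
               u₁ ∼ u₂ × v ∈ (u₁ ∷ hs₁) ++ u₂ ∷ hs₂ × w ∈ (u₁ ∷ hs₁) ++ u₂ ∷ hs₂
      starts (inj₁ (refl , here refl)) = ∼-sym v∼w , ∈-++⁺ʳ (u₁ ∷ hs₁) (here refl) , here refl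
      starts (inj₂ (refl , here refl)) = v∼w , here refl , ∈-++⁺ʳ (u₁ ∷ hs₁) (here refl)
      used : V → Bool
      used z = ⌊ z ∈? h₁ ∷ h₂ ∷ [] ⌋
      fs : List V
      fs = filterᵇ (not ∘ used) bs
      fresh : ∀ {z} → z ∈ fs → z ∉ h₁ ∷ rs ++ u₂ ∷ hs₂
      fresh {z} z∈ z∈q = T-not (fromWitness {a? = z ∈? h₁ ∷ h₂ ∷ []}
          ([ (λ { refl → here refl }) , (λ { refl → there (here refl) }) ]′
             (only (∈-resp-↭ r′ z∈q) (∈-++⁺ʳ as (proj₁ (∈-filterᵇ⁻ {p = not ∘ used} bs z∈))))))
          (proj₂ (∈-filterᵇ⁻ {p = not ∘ used} bs z∈))
      open ≤-Reasoning
      t≤ : t ≤ suc (length fs)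
      t≤ = s≤s⁻¹ (begin
        suc t                             ≤⟨ ≤-trans t<M |bs| ⟩
        length bs                         ≡⟨ count-not used bs ⟨
        count used bs + count (not ∘ used) bs
          ≤⟨ +-monoˡ-≤ _ (≤-trans (count-⊆ used {ls = h₁ ∷ h₂ ∷ []} bs! (λ _ → toWitness)) (count≤length used (h₁ ∷ h₂ ∷ []))) ⟩
        2 + count (not ∘ used) bs         ≡⟨ cong (2 +_) (length-filterᵇ (not ∘ used) bs) ⟨
        2 + length fs                     ∎)

    no-edge : ⊥
    no-edge with y , e , y∈ , e∈ , L ← anchor with fs , fs! , fs⊆ , t≤ , E ← ws-ear y∈ e∈ L =
      close-ear fs! fs⊆ t≤ (end-in-as fs⊆ (flip-ear (end-in-as fs⊆ E)))

  outside-independent : ∀ {v w} → v ∉ as → w ∉ as → ¬ v ∼ w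
  outside-independent v∉ w∉ v∼w = no-edge v∉ w∉ v∼w

-- From the definitions to walks and lists

enum-∈ : ∀ {n} (S : Subset n) k → enum S k Subset.∈ S
enum-∈ (true  ∷ S) zero    = here
enum-∈ (true  ∷ S) (suc k) = there (enum-∈ S k)
enum-∈ (false ∷ S) k       = there (enum-∈ S k)

enum-surjective : ∀ {n} (S : Subset n) {i} → i Subset.∈ S → ∃[ k ] enum S k ≡ i
enum-surjective (true  ∷ S) here        = zero , refl
enum-surjective (true  ∷ S) (there i∈S) with k , eq ← enum-surjective S i∈S = suc k , cong suc eq
enum-surjective (false ∷ S) (there i∈S) with k , eq ← enum-surjective S i∈S = k , cong suc eq

enum-injective : ∀ {n} (S : Subset n) {i j} → enum S i ≡ enum S j → i ≡ j
enum-injective (true  ∷ S) {zero}  {zero}  _  = refl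
enum-injective (true  ∷ S) {suc i} {suc j} eq = cong suc (enum-injective S (Fin.suc-injective eq))
enum-injective (false ∷ S) eq = enum-injective S (Fin.suc-injective eq)

lookup-injective : ∀ {A : Set} {xs : List A} → Unique xs → ∀ {i j} → lookup xs i ≡ lookup xs j → i ≡ j
lookup-injective (_ ∷ _) {zero}  {zero}  _  = refl
lookup-injective u@(_ ∷ _) {zero}  {suc j} eq = contradiction (subst (_∈ _) (sym eq) (∈-lookup j)) (∉-∷⁻ u)
lookup-injective u@(_ ∷ _) {suc i} {zero}  eq = contradiction (subst (_∈ _) eq (∈-lookup i)) (∉-∷⁻ u)
lookup-injective (_ ∷ u) {suc i} {suc j} eq = cong suc (lookup-injective u eq)

module FromDefs {n} (G : Graph n) where
  open Graph G using (adj; _∼_)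
  open Walks G
  open Density G

  Star⇒Walk : ∀ {u w} → Star _∼_ u w → ∃ (Walk u w)
  Star⇒Walk ε        = [] , []
  Star⇒Walk (e ◅ es) with xs , W ← Star⇒Walk es = _ , e ∷ W

  connected⇒walk : Connected G → ∀ u w → ∃ (Walk u w)
  connected⇒walk conn u w = Star⇒Walk (conn u w)

  robust : (∀ v → Connected (G [[ ∁ ⁅ v ⁆ ]])) → Robust
  robust conn v {u} {w} u≢v w≢v
    with i , refl ← enum-surjective (∁ ⁅ v ⁆) (Subset.x∉p⇒x∈∁p (Subset.x≢y⇒x∉⁅y⁆ u≢v))
    with j , refl ← enum-surjective (∁ ⁅ v ⁆) (Subset.x∉p⇒x∈∁p (Subset.x≢y⇒x∉⁅y⁆ w≢v))
    = lift (conn v i j)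
    where
    e = enum (∁ ⁅ v ⁆)
    lift : ∀ {i j} → Star (Graph._∼_ (G [[ ∁ ⁅ v ⁆ ]])) i j → ∃[ xs ] Walk (e i) (e j) xs × All (_≢ v) xs
    lift ε = [] , [] , []
    lift (_◅_ {j = k} a as) with xs , W , a≢ ← lift as =
      e k ∷ xs , a ∷ W , Subset.x∉⁅y⁆⇒x≢y (Subset.x∈∁p⇒x∉p (enum-∈ (∁ ⁅ v ⁆) k)) ∷ a≢

  walk-first : ∀ {u w xs} → Walk u w xs → ∀ i → toℕ i ≡ 0 → u ∼ lookup xs i
  walk-first (e ∷ W) zero _ = e

  walk-last : ∀ {u w xs} → Walk u w xs → ∀ i → suc (toℕ i) ≡ length xs → lookup xs i ≡ w
  walk-last (_ ∷ [])        zero    _  = refl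
  walk-last (_ ∷ W@(_ ∷ _)) (suc i) eq = walk-last W i (suc-injective eq)

  walk-step : ∀ {u w xs} → Walk u w xs → ∀ i j → suc (toℕ i) ≡ toℕ j → lookup xs i ∼ lookup xs j
  walk-step (_ ∷ W) zero    (suc j) eq = walk-first W j (sym (suc-injective eq))
  walk-step (_ ∷ W) (suc i) (suc j) eq = walk-step W i j (suc-injective eq)

  -- The list of a closed walk ends with its starting vertex, so the arc from the last index to 0 is
  -- the first edge of the walk.
  closed-walk⇒⊑ : ∀ {v zs} m → length zs ≡ 3 + m → Walk v v zs → Unique zs → cycle m ⊑ G
  closed-walk⇒⊑ {v} {zs} m len Z z! = f , inj , edge
    where
    f : Fin (3 + m) → V
    f i = lookup zs (cast (sym len) i)
    toℕ-f : ∀ i → toℕ (cast (sym len) i) ≡ toℕ i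
    toℕ-f = Fin.toℕ-cast (sym len)
    inj : Injective _≡_ _≡_ f
    inj {i} {j} eq = Fin.toℕ-injective (trans (sym (toℕ-f i))
      (trans (cong toℕ (lookup-injective z! eq)) (toℕ-f j)))
    arc⇒∼ : ∀ i j → T (arc m i j) → f i ∼ f j
    arc⇒∼ i j a with Equivalence.to T-∨ a
    ... | inj₁ next = walk-step Z _ _ (trans (cong suc (toℕ-f i)) (trans (≡ᵇ⇒≡ _ _ next) (sym (toℕ-f j))))
    ... | inj₂ wrap with l , z ← Equivalence.to T-∧ wrap =
      subst (_∼ f j) (sym (walk-last Z _ (trans (cong suc (trans (toℕ-f i) (≡ᵇ⇒≡ _ _ l))) (sym len))))
        (walk-first Z _ (trans (toℕ-f j) (≡ᵇ⇒≡ _ _ z)))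
    edge : ∀ i j → T (arc m i j ∨ arc m j i) → f i ∼ f j
    edge i j a with Equivalence.to T-∨ a
    ... | inj₁ ij = arc⇒∼ i j ij
    ... | inj₂ ji = ∼-sym (arc⇒∼ j i ji)

  long-cycle-free : ∀ {c} → 2 ≤ c → (∀ m → suc c ≤ 3 + m → ¬ cycle m ⊑ G) →
                    ¬ (∃₂ λ v zs → Walk v v zs × Unique zs × c < length zs)
  long-cycle-free 2≤c free (v , zs , Z , z! , c<) with m , eq ← m≤n⇒∃[o]m+o≡n (≤-trans (s≤s 2≤c) c<) =
    free m (subst (_ <_) (sym eq) c<) (closed-walk⇒⊑ m (sym eq) Z z!)

  count-cong : ∀ {A : Set} {p q : A → Bool} {xs} → All (λ z → p z ≡ q z) xs → count p xs ≡ count q xs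
  count-cong []         = refl
  count-cong (eq ∷ eqs) = cong₂ _+_ (cong 𝟙 eq) (count-cong eqs)

  length-filter : ∀ {A : Set} {P : A → Set} (P? : Decidable P) xs → length (filter P? xs) ≡ count (does ∘ P?) xs
  length-filter P? []       = refl
  length-filter P? (x ∷ xs) with does (P? x)
  ... | true  = cong suc (length-filter P? xs)
  ... | false = length-filter P? xs

  count-map : ∀ {A B : Set} (p : B → Bool) (f : A → B) xs → count p (map f xs) ≡ count (p ∘ f) xs
  count-map p f []       = refl
  count-map p f (x ∷ xs) = cong (𝟙 (p (f x)) +_) (count-map p f xs)

  -- `allFin n` is increasing. The row of its first vertex holds the edges to later vertices, while
  -- its column contributes nothing, as only pairs with i < j are counted.
  edges≡size : Graph.edges G ≡ size (allFin n)
  edges≡size = trans (length-filter (λ (i , j) → (i Fin.<? j) ×-dec T? (adj i j)) (cartesianProduct (allFin n) (allFin n)))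
                     (sorted (allFin n) (AllPairs.tabulate⁺-< (λ lt → lt)))
    where
    open import Data.Fin.Base using () renaming (_<_ to _<ᶠ_)
    D : V × V → Bool
    D (i , j) = does (i Fin.<? j) ∧ adj i j
    D-greater : ∀ i j → j <ᶠ i → D (i , j) ≡ false
    D-greater i j lt = cong (_∧ adj i j) (dec-false (i Fin.<? j) (<-asym lt))
    D-less : ∀ i j → i <ᶠ j → D (i , j) ≡ adj i j
    D-less i j lt = cong (_∧ adj i j) (dec-true (i Fin.<? j) lt)
    D-self : ∀ i → D (i , i) ≡ false
    D-self i = trans (cong (does (i Fin.<? i) ∧_) (Graph.irrefl G i)) (∧-zeroʳ _)
    row : ∀ x xs ys → count D (cartesianProduct (x ∷ xs) ys) ≡
                      count (λ y → D (x , y)) ys + count D (cartesianProduct xs ys)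
    row x xs ys = trans (count-++ D (map (x ,_) ys) (cartesianProduct xs ys))
                        (cong (_+ count D (cartesianProduct xs ys)) (count-map D (x ,_) ys))
    drop-column : ∀ {x} xs ys → All (x <ᶠ_) xs →
                  count D (cartesianProduct xs (x ∷ ys)) ≡ count D (cartesianProduct xs ys)
    drop-column []        ys []         = refl
    drop-column {x} (x′ ∷ xs) ys (lt ∷ lts) = begin
      count D (cartesianProduct (x′ ∷ xs) (x ∷ ys))                        ≡⟨ row x′ xs (x ∷ ys) ⟩
      𝟙 (D (x′ , x)) + count (λ y → D (x′ , y)) ys + count D (cartesianProduct xs (x ∷ ys))
        ≡⟨ cong₂ (λ b k → 𝟙 b + count (λ y → D (x′ , y)) ys + k) (D-greater x′ x lt) (drop-column xs ys lts) ⟩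
      count (λ y → D (x′ , y)) ys + count D (cartesianProduct xs ys)       ≡⟨ row x′ xs ys ⟨
      count D (cartesianProduct (x′ ∷ xs) ys)                              ∎
      where open ≡-Reasoning
    sorted : ∀ xs → AllPairs _<ᶠ_ xs → count D (cartesianProduct xs xs) ≡ size xs
    sorted []       []         = refl
    sorted (x ∷ xs) (lts ∷ ps) = begin
      count D (cartesianProduct (x ∷ xs) (x ∷ xs)) ≡⟨ row x xs (x ∷ xs) ⟩
      𝟙 (D (x , x)) + count (λ y → D (x , y)) xs + count D (cartesianProduct xs (x ∷ xs))
        ≡⟨ cong₂ _+_ (cong₂ (λ b k → 𝟙 b + k) (D-self x) (count-cong (All.map (D-less x _) lts)))
                     (trans (drop-column xs xs lts) (sorted xs ps)) ⟩
      count (adj x) xs + size xs ∎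
      where open ≡-Reasoning

  cross : List V → List V → ℕ
  cross []       ys = 0
  cross (x ∷ xs) ys = count (adj x) ys + cross xs ys

  size-++ : ∀ xs ys → size (xs ++ ys) ≡ size xs + cross xs ys + size ys
  size-++ []       ys = refl
  size-++ (x ∷ xs) ys = begin
    count (adj x) (xs ++ ys) + size (xs ++ ys) ≡⟨ cong₂ _+_ (count-++ (adj x) xs ys) (size-++ xs ys) ⟩
    (a + b) + ((c + d) + e)                    ≡⟨ +-assoc (a + b) (c + d) e ⟨
    ((a + b) + (c + d)) + e                    ≡⟨ cong (_+ e) (interchange +-commutativeSemigroup a b c d) ⟩
    ((a + c) + (b + d)) + e                    ∎
    where
    open ≡-Reasoning
    a = count (adj x) xs
    b = count (adj x) ys
    c = size xs
    d = cross xs ys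
    e = size ys

  cross≤ : ∀ xs ys → cross xs ys ≤ length xs * length ys
  cross≤ []       ys = z≤n
  cross≤ (x ∷ xs) ys = +-mono-≤ (count≤length (adj x) ys) (cross≤ xs ys)

  cross-complete : ∀ xs ys → (∀ {x y} → x ∈ xs → y ∈ ys → x ∼ y) → cross xs ys ≡ length xs * length ys
  cross-complete []       ys _   = refl
  cross-complete (x ∷ xs) ys all =
    cong₂ _+_ (count-all (All.tabulate (λ y∈ → all (here refl) y∈)))
              (cross-complete xs ys (λ x∈ → all (there x∈)))

  size-independent : ∀ xs → (∀ {x y} → x ∈ xs → y ∈ xs → ¬ x ∼ y) → size xs ≡ 0
  size-independent []       _   = refl
  size-independent (x ∷ xs) ind =
    cong₂ _+_ (count-none (All.tabulate (λ y∈ → ind (here refl) (there y∈))))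
              (size-independent xs (λ x∈ y∈ → ind (there x∈) (there y∈)))

  pullback : ∀ {m} → (Fin m → V) → Graph m
  pullback f = record
    { adj    = λ i j → adj (f i) (f j)
    ; sym    = λ i j → Graph.sym G (f i) (f j)
    ; irrefl = λ i → Graph.irrefl G (f i)
    }

module _ {m n} (H : Graph m) (G : Graph n) (f : Fin m → Fin n)
         (f-adj : ∀ i j → Graph.adj H i j ≡ Graph.adj G (f i) (f j)) where

  size-map : ∀ xs → Density.size H xs ≡ Density.size G (map f xs)
  size-map []       = refl
  size-map (x ∷ xs) = cong₂ _+_
    (trans (FromDefs.count-cong H (All.universal (f-adj x) xs)) (sym (FromDefs.count-map H (Graph.adj G (f x)) f xs)))
    (size-map xs)

  edges≡size-map : Graph.edges H ≡ Density.size G (map f (allFin m))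
  edges≡size-map = trans (FromDefs.edges≡size H) (size-map (allFin m))

-- The upper bound from the complete bipartite subgraph

module Upper {n} (G : Graph n) {k} (F : Graph k) where
  open Graph G using (adj; _∼_)
  open Walks G
  open Density G
  open FromDefs G

  module _ {t M} (K : Biclique t M) (k≤M : k ≤ M) where
    open Biclique K

    core : Graph (length as)
    core = pullback (lookup as)

    -- A vertex outside the covering goes to the entry of `bs` with its own index, which keeps the
    -- images distinct and explains `k≤M`. Two such vertices are not adjacent in `F`.
    extend-⊑ : ∀ S → VertexCovering F S → F [[ S ]] ⊑ core → F ⊑ G
    extend-⊑ S covers (g , g-inj , g-edge) = h , h-inj , h-edge
      where
      open import Data.Fin.Subset.Properties using () renaming (_∈?_ to _∈ˢ?_)
      g′ : Fin ∣ S ∣ → V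
      g′ i = lookup as (g i)
      b : Fin k → V
      b i = lookup bs (inject≤ i (≤-trans k≤M |bs|))
      g′∈ : ∀ i → g′ i ∈ as
      g′∈ i = ∈-lookup (g i)
      b∈ : ∀ i → b i ∈ bs
      b∈ i = ∈-lookup (inject≤ i _)
      data View (i : Fin k) : V → Set where
        inside  : ∀ j → enum S j ≡ i → View i (g′ j)
        outside : i Subset.∉ S → View i (b i)
      view : ∀ i → ∃ (View i)
      view i with i ∈ˢ? S
      ... | yes i∈ with j , eq ← enum-surjective S i∈ = g′ j , inside j eq
      ... | no  i∉ = b i , outside i∉
      h : Fin k → V
      h i = proj₁ (view i)
      view-injective : ∀ {i j x y} → View i x → View j y → x ≡ y → i ≡ j
      view-injective (inside p refl) (inside q refl) eq = cong (enum S) (g-inj (lookup-injective as! eq))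
      view-injective (inside p _) (outside _) eq = contradiction eq (∼⇒≢ (a∼b (g′∈ p) (b∈ _)))
      view-injective (outside _) (inside q _) eq = contradiction (sym eq) (∼⇒≢ (a∼b (g′∈ q) (b∈ _)))
      view-injective (outside _) (outside _) eq = Fin.inject≤-injective _ _ _ _ (lookup-injective bs! eq)
      h-inj : Injective _≡_ _≡_ h
      h-inj {i} {j} = view-injective (proj₂ (view i)) (proj₂ (view j))
      view-edge : ∀ {i j x y} → View i x → View j y → Graph._∼_ F i j → x ∼ y
      view-edge (inside p refl) (inside q refl) e = g-edge p q e
      view-edge (inside p _)  (outside _)    _ = a∼b (g′∈ p) (b∈ _)
      view-edge (outside _)   (inside q _)   _ = ∼-sym (a∼b (g′∈ q) (b∈ _))
      view-edge (outside i∉)  (outside j∉)   e = contradiction e (covers _ _ i∉ j∉)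
      h-edge : ∀ i j → Graph._∼_ F i j → h i ∼ h j
      h-edge i j = view-edge (proj₂ (view i)) (proj₂ (view j))

    core-free : ¬ F ⊑ G → Free (CoveringSubgraphs F) core
    core-free F⋢G _ (cov S covers) sub = F⋢G (extend-⊑ S covers sub)

    core-edges : Graph.edges core ≡ size as
    core-edges = trans (edges≡size-map core G (lookup as) (λ _ _ → refl))
      (cong size (trans (map-tabulate id (lookup as)) (tabulate-lookup as)))

    rest : List V
    rest = members (λ z → does (z ∉? as))

    ∈-rest⁻ : ∀ {z} → z ∈ rest → z ∉ as
    ∈-rest⁻ {z} z∈ = toWitness (subst T (sym (isYes≗does (z ∉? as))) (∈-members⁻ {p = λ z → does (z ∉? as)} z∈))

    all↭ : allFin n ↭ as ++ rest
    all↭ = ⊆-↭ (Uniq.allFin⁺ n) (λ {z} _ → cover z) (≤-trans (length≤n ar!) (≤-reflexive (sym (length-tabulate {n = n} id))))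
      where
      ar! : Unique (as ++ rest)
      ar! = Unique-++⁺ as! (members! _) (λ z∈ z∈r → ∈-rest⁻ z∈r z∈)
      cover : ∀ z → z ∈ as ++ rest
      cover z with z ∈? as
      ... | yes z∈ = ∈-++⁺ˡ z∈
      ... | no  z∉ = ∈-++⁺ʳ as (∈-members⁺ {p = λ z → does (z ∉? as)} (subst T (sym (dec-true (z ∉? as) z∉)) _))

    edges-bound : (∀ {v w} → v ∉ as → w ∉ as → ¬ v ∼ w) →
                  Graph.edges G ≤ Graph.edges core + t * (n ∸ t)
    edges-bound ind = begin
      Graph.edges G                              ≡⟨ edges≡size ⟩
      size (allFin n)                            ≡⟨ size-↭ all↭ ⟩
      size (as ++ rest)                          ≡⟨ size-++ as rest ⟩
      size as + cross as rest + size rest        ≡⟨ cong₂ (λ i j → i + cross as rest + j) (sym core-edges)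
                                                      (size-independent rest (λ x∈ y∈ → ind (∈-rest⁻ x∈) (∈-rest⁻ y∈))) ⟩
      Graph.edges core + cross as rest + 0       ≡⟨ +-identityʳ _ ⟩
      Graph.edges core + cross as rest           ≤⟨ +-monoʳ-≤ (Graph.edges core) (cross≤ as rest) ⟩
      Graph.edges core + length as * length rest ≡⟨ cong₂ (λ i j → Graph.edges core + i * j) |as| |rest| ⟩
      Graph.edges core + t * (n ∸ t)             ∎
      where
      open ≤-Reasoning
      |rest| : length rest ≡ n ∸ t
      |rest| = sym (trans (cong₂ _∸_ (trans (sym (length-tabulate {n = n} id)) (trans (↭-length all↭) (length-++ as))) (sym |as|))
                          (m+n∸m≡n (length as) (length rest)))

-- The join and the lower bound

module Join {t} (H : Graph t) (r : ℕ) where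

  isRight : Fin t ⊎ Fin r → Bool
  isRight (inj₁ _) = false
  isRight (inj₂ _) = true

  joinAdj : Fin t ⊎ Fin r → Fin t ⊎ Fin r → Bool
  joinAdj (inj₁ i) (inj₁ j) = Graph.adj H i j
  joinAdj (inj₁ _) (inj₂ _) = true
  joinAdj (inj₂ _) (inj₁ _) = true
  joinAdj (inj₂ _) (inj₂ _) = false

  joinAdj-sym : ∀ x y → joinAdj x y ≡ joinAdj y x
  joinAdj-sym (inj₁ i) (inj₁ j) = Graph.sym H i j
  joinAdj-sym (inj₁ _) (inj₂ _) = refl
  joinAdj-sym (inj₂ _) (inj₁ _) = refl
  joinAdj-sym (inj₂ _) (inj₂ _) = refl

  joinAdj-irrefl : ∀ x → joinAdj x x ≡ false
  joinAdj-irrefl (inj₁ i) = Graph.irrefl H i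
  joinAdj-irrefl (inj₂ _) = refl

  join : Graph (t + r)
  join = record
    { adj    = λ i j → joinAdj (splitAt t i) (splitAt t j)
    ; sym    = λ i j → joinAdj-sym (splitAt t i) (splitAt t j)
    ; irrefl = λ i → joinAdj-irrefl (splitAt t i)
    }

  open Graph join using (adj; _∼_)
  open Walks join
  open Density join
  open FromDefs join

  right : V → Bool
  right v = isRight (splitAt t v)

  right-independent : ∀ {v w} → T (right v) → T (right w) → ¬ v ∼ w
  right-independent {v} {w} rv rw with splitAt t v | splitAt t w
  ... | inj₂ _ | inj₂ _ = λ ()

  left-right : ∀ {v w} → ¬ T (right v) → T (right w) → v ∼ w
  left-right {v} {w} lv rw with splitAt t v | splitAt t w
  ... | inj₁ _ | inj₂ _ = _
  ... | inj₂ _ | _      = contradiction _ lv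

  left : ∀ {v} → ¬ T (right v) → ∃[ a ] a ↑ˡ r ≡ v
  left {v} lv with splitAt t v in eq
  ... | inj₁ a = a , Fin.splitAt⁻¹-↑ˡ eq
  ... | inj₂ _ = contradiction _ lv

  ↑ˡ-left : ∀ a → ¬ T (right (a ↑ˡ r))
  ↑ˡ-left a = subst (λ s → ¬ T (isRight s)) (sym (Fin.splitAt-↑ˡ t a r)) (λ ())

  ↑ʳ-right : ∀ b → T (right (t ↑ʳ b))
  ↑ʳ-right b = subst (T ∘ isRight) (sym (Fin.splitAt-↑ʳ t r b)) _

  -- Sums over the edges of the walk, each with at most one end on the right. The last vertex
  -- belongs to one edge only but is counted twice, hence the term for `w`.
  right-count : ∀ {u w xs} → Walk u w xs → count right xs + count right (u ∷ xs) ≤ length xs + 𝟙 (right w)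
  right-count {u} []  = ≤-reflexive (+-identityʳ _)
  right-count {u} {w} (_∷_ {v = v} {xs = xs} e W) = begin
    count right (v ∷ xs) + (𝟙 (right u) + count right (v ∷ xs))
      ≡⟨ interchange +-commutativeSemigroup (𝟙 (right v)) _ _ _ ⟩
    (𝟙 (right v) + 𝟙 (right u)) + (count right xs + count right (v ∷ xs)) ≤⟨ +-mono-≤ one (right-count W) ⟩
    1 + (length xs + 𝟙 (right w))                                         ∎
    where
    open ≤-Reasoning
    one : 𝟙 (right v) + 𝟙 (right u) ≤ 1
    one with T? (right u) | T? (right v)
    ... | yes ru | yes rv = contradiction e (right-independent ru rv)
    ... | yes ru | no ¬rv rewrite 𝟙-¬T ¬rv = 𝟙≤1 (right u)
    ... | no ¬ru | _ rewrite 𝟙-¬T ¬ru = ≤-trans (≤-reflexive (+-identityʳ _)) (𝟙≤1 (right v))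

  -- At most half of the vertices are on the right, and at most t are on the left.
  closed-walk-short : ∀ {v zs} → Walk v v zs → Unique zs → length zs ≤ t + t
  closed-walk-short {v} {zs} Z z! = +-cancelʳ-≤ (length zs) _ _ (begin
    length zs + length zs ≡⟨ cong₂ _+_ (count-not right zs) (count-not right zs) ⟨
    (R + L) + (R + L)     ≡⟨ interchange +-commutativeSemigroup R L R L ⟩
    (R + R) + (L + L)     ≤⟨ +-mono-≤ R+R≤ (+-mono-≤ L≤t L≤t) ⟩
    length zs + (t + t)   ≡⟨ +-comm (length zs) _ ⟩
    (t + t) + length zs   ∎)
    where
    open ≤-Reasoning
    R = count right zs
    L = count (not ∘ right) zs
    R+R≤ : R + R ≤ length zs
    R+R≤ = +-cancelˡ-≤ (𝟙 (right v)) _ _ (begin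
      𝟙 (right v) + (R + R) ≡⟨ x∙yz≈y∙xz +-commutativeSemigroup (𝟙 (right v)) R R ⟩
      R + (𝟙 (right v) + R) ≤⟨ right-count Z ⟩
      length zs + 𝟙 (right v) ≡⟨ +-comm (length zs) _ ⟩
      𝟙 (right v) + length zs ∎)
    L≤t : L ≤ t
    L≤t = begin
      L                       ≤⟨ count-⊆ (not ∘ right) {ls = map (_↑ˡ r) (allFin t)} z! in-left ⟩
      count (not ∘ right) (map (_↑ˡ r) (allFin t)) ≤⟨ count≤length (not ∘ right) (map (_↑ˡ r) (allFin t)) ⟩
      length (map (_↑ˡ r) (allFin t)) ≡⟨ trans (length-map _ (allFin t)) (length-tabulate {n = t} id) ⟩
      t                       ∎
      where
      in-left : ∀ {u} → u ∈ zs → T (not (right u)) → u ∈ map (_↑ˡ r) (allFin t)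
      in-left {u} _ nr with a , refl ← left {u} (λ ru → T-not ru nr) = ∈-map⁺ (_↑ˡ r) (∈-allFin a)

  tabulate-walk : ∀ N (f : Fin (suc N) → V) → (∀ i → f (inject₁ i) ∼ f (suc i)) →
                  Walk (f zero) (f (fromℕ N)) (tabulate (f ∘ suc))
  tabulate-walk zero    f e = []
  tabulate-walk (suc N) f e = e zero ∷ tabulate-walk N (f ∘ suc) (e ∘ suc)

  no-long-cycle : ∀ m → t + t < 3 + m → ¬ cycle m ⊑ join
  no-long-cycle m long (f , inj , edge) = <⇒≱ long (begin
    3 + m                                     ≡⟨ length-tabulate f ⟨
    length (tabulate f)                       ≡⟨ ↭-length perm ⟩
    length (tabulate (f ∘ suc) ∷ʳ f zero)     ≤⟨ closed-walk-short
        (tabulate-walk (2 + m) f (λ i → edge _ _ (Equivalence.from T-∨ (inj₁ (step i)))) ++ʷ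
          edge (fromℕ (2 + m)) zero (Equivalence.from T-∨ (inj₁ wrap)) ∷ [])
        (Unique-↭ perm (Uniq.tabulate⁺ inj)) ⟩
    t + t                                     ∎)
    where
    open ≤-Reasoning
    perm : tabulate f ↭ tabulate (f ∘ suc) ∷ʳ f zero
    perm = ∷↭∷ʳ (f zero) (tabulate (f ∘ suc))
    step : ∀ i → T (arc m (inject₁ i) (suc i))
    step i = Equivalence.from T-∨ (inj₁ (≡⇒≡ᵇ (suc (toℕ (inject₁ i))) (suc (toℕ i)) (cong suc (Fin.toℕ-inject₁ i))))
    wrap : T (arc m (fromℕ (2 + m)) zero)
    wrap = Equivalence.from (T-∨ {suc (toℕ (fromℕ (2 + m))) ≡ᵇ 0}) (inj₂ (Equivalence.from T-∧
             (≡⇒≡ᵇ (toℕ (fromℕ (2 + m))) (2 + m) (Fin.toℕ-fromℕ (2 + m)) , _)))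

  Joined : (V → Set) → V → V → Set
  Joined P u w = u ≡ w ⊎ u ∼ w ⊎ ∃[ x ] P x × u ∼ x × x ∼ w

  -- Two vertices on the same side are joined through `a` or `b` on the other side; `P` says that
  -- the middle vertex survives a deletion.
  via : ∀ {P a b} → P a → P b → ¬ T (right a) → T (right b) → ∀ u w → Joined P u w
  via {a = a} {b} pa pb la rb u w with T? (right u) | T? (right w)
  ... | yes ru | yes rw = inj₂ (inj₂ (a , pa , ∼-sym (left-right la ru) , left-right la rw))
  ... | yes ru | no  lw = inj₂ (inj₁ (∼-sym (left-right lw ru)))
  ... | no  lu | yes rw = inj₂ (inj₁ (left-right lu rw))
  ... | no  lu | no  lw = inj₂ (inj₂ (b , pb , left-right lu rb , ∼-sym (left-right lw rb)))

  avoiding : ∀ {k} (f : Fin k → V) → (∀ {i j} → f i ≡ f j → i ≡ j) → 2 ≤ k → ∀ v → ∃[ i ] f i ≢ v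
  avoiding {suc (suc k)} f inj (s≤s (s≤s _)) v with f zero Fin.≟ v
  ... | no  ≢v   = zero , ≢v
  ... | yes refl = suc zero , λ eq → case (inj eq)
    where
    case : suc {suc k} zero ≡ zero → ⊥
    case ()

  connected : 2 ≤ t → 2 ≤ r → Connected join
  connected (s≤s _) (s≤s _) u w with via {P = λ _ → V} {zero ↑ˡ r} {t ↑ʳ zero} u u (↑ˡ-left zero) (↑ʳ-right zero) u w
  ... | inj₁ refl                         = ε
  ... | inj₂ (inj₁ e)                     = e ◅ ε
  ... | inj₂ (inj₂ (x , _ , e₁ , e₂))     = _◅_ {j = x} e₁ (e₂ ◅ ε)

  two-connected : 2 ≤ t → 2 ≤ r → TwoConnected join
  two-connected 2≤t 2≤r = ≤-trans (n≤1+n 3) (+-mono-≤ 2≤t 2≤r) , connected 2≤t 2≤r , minus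
    where
    minus : ∀ v → Connected (join [[ ∁ ⁅ v ⁆ ]])
    minus v i j
      with a , a≢ ← avoiding (_↑ˡ r) (λ {i} {j} → Fin.↑ˡ-injective r i j) 2≤t v
      with b , b≢ ← avoiding (t ↑ʳ_) (λ {i} {j} → Fin.↑ʳ-injective t i j) 2≤r v
      with via {P = _≢ v} a≢ b≢ (↑ˡ-left a) (↑ʳ-right b) (enum (∁ ⁅ v ⁆) i) (enum (∁ ⁅ v ⁆) j)
    ... | inj₁ eq with refl ← enum-injective (∁ ⁅ v ⁆) eq = ε
    ... | inj₂ (inj₁ e) = e ◅ ε
    ... | inj₂ (inj₂ (x , x≢ , e₁ , e₂))
      with k , refl ← enum-surjective (∁ ⁅ v ⁆) (Subset.x∉p⇒x∈∁p (Subset.x≢y⇒x∉⁅y⁆ x≢)) = e₁ ◅ e₂ ◅ ε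

  edges-join : Graph.edges join ≡ Graph.edges H + t * r
  edges-join = begin
    Graph.edges join                  ≡⟨ edges≡size ⟩
    size (allFin (t + r))             ≡⟨ size-↭ all↭ ⟩
    size (ls ++ rs)                   ≡⟨ size-++ ls rs ⟩
    size ls + cross ls rs + size rs   ≡⟨ cong₂ (λ i j → i + cross ls rs + j) (sym edges-H) (size-independent rs independent) ⟩
    Graph.edges H + cross ls rs + 0   ≡⟨ +-identityʳ _ ⟩
    Graph.edges H + cross ls rs       ≡⟨ cong (Graph.edges H +_) (cross-complete ls rs complete) ⟩
    Graph.edges H + length ls * length rs ≡⟨ cong₂ (λ i j → Graph.edges H + i * j) |ls| |rs| ⟩
    Graph.edges H + t * r             ∎
    where
    open ≡-Reasoning
    ls = map (_↑ˡ r) (allFin t)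
    rs = map (t ↑ʳ_) (allFin r)
    |ls| : length ls ≡ t
    |ls| = trans (length-map _ (allFin t)) (length-tabulate {n = t} id)
    |rs| : length rs ≡ r
    |rs| = trans (length-map _ (allFin r)) (length-tabulate {n = r} id)
    ls-left : ∀ {x} → x ∈ ls → ¬ T (right x)
    ls-left x∈ with a , _ , refl ← ∈-map⁻ (_↑ˡ r) x∈ = ↑ˡ-left a
    rs-right : ∀ {x} → x ∈ rs → T (right x)
    rs-right x∈ with b , _ , refl ← ∈-map⁻ (t ↑ʳ_) x∈ = ↑ʳ-right b
    independent : ∀ {x y} → x ∈ rs → y ∈ rs → ¬ x ∼ y
    independent x∈ y∈ = right-independent (rs-right x∈) (rs-right y∈)
    complete : ∀ {x y} → x ∈ ls → y ∈ rs → x ∼ y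
    complete x∈ y∈ = left-right (ls-left x∈) (rs-right y∈)
    edges-H : Graph.edges H ≡ size ls
    edges-H = edges≡size-map H join (_↑ˡ r)
      (λ i j → sym (cong₂ joinAdj (Fin.splitAt-↑ˡ t i r) (Fin.splitAt-↑ˡ t j r)))
    all↭ : allFin (t + r) ↭ ls ++ rs
    all↭ = ⊆-↭ (Uniq.allFin⁺ (t + r)) (λ {z} _ → cover z)
      (≤-reflexive (trans (length-++ ls) (trans (cong₂ _+_ |ls| |rs|) (sym (length-tabulate {n = t + r} id)))))
      where
      cover : ∀ z → z ∈ ls ++ rs
      cover z with splitAt t z in eq
      ... | inj₁ a = ∈-++⁺ˡ (subst (_∈ ls) (Fin.splitAt⁻¹-↑ˡ eq) (∈-map⁺ (_↑ˡ r) (∈-allFin a)))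
      ... | inj₂ b = ∈-++⁺ʳ ls (subst (_∈ rs) (Fin.splitAt⁻¹-↑ʳ eq) (∈-map⁺ (t ↑ʳ_) (∈-allFin b)))

  -- The right side is independent, so the vertices of `F` placed on the left form a vertex
  -- covering, and `H` contains the subgraph that it induces.
  F-free : ∀ {k} (F : Graph k) → Free (CoveringSubgraphs F) H → ¬ F ⊑ join
  F-free {k} F free (f , inj , edge) = free _ (cov S covers) (g , g-inj , g-edge)
    where
    S : Subset k
    S = Vec.tabulate (λ i → not (right (f i)))
    ∈S⇒left : ∀ {i} → i Subset.∈ S → ¬ T (right (f i))
    ∈S⇒left {i} i∈ rfi = T-not rfi (subst T (sym (trans (sym (Vec.lookup∘tabulate _ i)) (Vec.[]=⇒lookup i∈))) _)
    ∉S⇒right : ∀ {i} → i Subset.∉ S → T (right (f i))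
    ∉S⇒right {i} i∉ with T? (right (f i))
    ... | yes rfi = rfi
    ... | no  lfi = contradiction (Vec.lookup⇒[]= i S (trans (Vec.lookup∘tabulate _ i) (not-false lfi))) i∉
      where
      not-false : ∀ {b} → ¬ T b → not b ≡ true
      not-false {true}  ¬t = contradiction _ ¬t
      not-false {false} _  = refl
    covers : VertexCovering F S
    covers i j i∉ j∉ i∼j = right-independent (∉S⇒right i∉) (∉S⇒right j∉) (edge i j i∼j)
    image : ∀ i → ∃[ a ] a ↑ˡ r ≡ f (enum S i)
    image i = left (∈S⇒left (enum-∈ S i))
    g : Fin ∣ S ∣ → Fin t
    g i = proj₁ (image i)
    g-inj : Injective _≡_ _≡_ g
    g-inj {i} {j} eq = enum-injective S (inj (trans (sym (proj₂ (image i))) (trans (cong (_↑ˡ r) eq) (proj₂ (image j)))))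
    g-edge : ∀ i j → Graph._∼_ F (enum S i) (enum S j) → Graph._∼_ H (g i) (g j)
    g-edge i j e = subst T (cong₂ joinAdj (Fin.splitAt-↑ˡ t (g i) r) (Fin.splitAt-↑ˡ t (g j) r))
      (subst₂ _∼_ (sym (proj₂ (image i))) (sym (proj₂ (image j))) (edge _ _ e))

-- Decidability and the existence of ex(t,H)

-- Predicates on functions need not respect pointwise equality, so embeddings and graphs are
-- searched as vectors and matrices.
Searchable : Set → Set₁
Searchable A = ∀ {P : A → Set} → Decidable P → Dec (∃ P)

search-Bool : Searchable Bool
search-Bool P? = map′ (λ { (inj₁ p) → true , p ; (inj₂ p) → false , p })
                      (λ { (true , p) → inj₁ p ; (false , p) → inj₂ p })
                      (P? true ⊎-dec P? false)

search-Vec : ∀ {A n} → Searchable A → Searchable (Vec A n)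
search-Vec {n = zero}  s P? = map′ (λ p → [] , p) (λ { ([] , p) → p }) (P? [])
search-Vec {n = suc n} s P? = map′ (λ { (x , xs , p) → x ∷ xs , p }) (λ { (x ∷ xs , p) → x , xs , p })
                                   (s (λ x → search-Vec s (λ xs → P? (x ∷ xs))))

infix 4 _⊑?_
_⊑?_ : ∀ {m n} (H : Graph m) (G : Graph n) → Dec (H ⊑ G)
_⊑?_ {m} {n} H G = map′
  (λ (f , inj , edge) → Vec.lookup f , (λ {i} {j} → inj i j) , edge)
  (λ (f , inj , edge) → Vec.tabulate f ,
    (λ i j eq → inj (trans (sym (Vec.lookup∘tabulate f i)) (trans eq (Vec.lookup∘tabulate f j)))) ,
    λ i j e → subst₂ (Graph._∼_ G) (sym (Vec.lookup∘tabulate f i)) (sym (Vec.lookup∘tabulate f j)) (edge i j e))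
  (search-Vec Fin.any? λ f →
    Fin.all? (λ i → Fin.all? (λ j → (Vec.lookup f i Fin.≟ Vec.lookup f j) →-dec (i Fin.≟ j))) ×-dec
    Fin.all? (λ i → Fin.all? (λ j → T? _ →-dec T? (Graph.adj G (Vec.lookup f i) (Vec.lookup f j)))))

vertexCovering? : ∀ {m} (F : Graph m) S → Dec (VertexCovering F S)
vertexCovering? F S = Fin.all? λ i → Fin.all? λ j →
  ¬? (i Subset.∈? S) →-dec (¬? (j Subset.∈? S) →-dec ¬? (T? (Graph.adj F i j)))

free? : ∀ {m n} (F : Graph m) (G : Graph n) → Dec (Free (CoveringSubgraphs F) G)
free? F G = map′
  (λ none → λ { _ (cov S covers) sub → none (S , covers , sub) })
  (λ { free (S , covers , sub) → free _ (cov S covers) sub })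
  (¬? (Subset.anySubset? (λ S → vertexCovering? F S ×-dec (F [[ S ]] ⊑? G))))

-- Symmetrised and cleared on the diagonal, every Boolean matrix yields a graph, so the search needs
-- no side condition.
fromMatrix : ∀ {n} → Vec (Vec Bool n) n → Graph n
fromMatrix M = record
  { adj    = λ i j → (entry i j ∧ entry j i) ∧ not (does (i Fin.≟ j))
  ; sym    = λ i j → cong₂ _∧_ (∧-comm (entry i j) (entry j i)) (cong not (≟-sym i j))
  ; irrefl = λ i → trans (cong (λ b → (entry i i ∧ entry i i) ∧ not b) (dec-true (i Fin.≟ i) refl)) (∧-zeroʳ _)
  }
  where
  entry : _ → _ → Bool
  entry i j = Vec.lookup (Vec.lookup M i) j
  ≟-sym : ∀ i j → does (i Fin.≟ j) ≡ does (j Fin.≟ i)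
  ≟-sym i j with i Fin.≟ j
  ... | yes refl = sym (dec-true (i Fin.≟ i) refl)
  ... | no  i≢j  = sym (dec-false (j Fin.≟ i) (i≢j ∘ sym))

toMatrix : ∀ {n} → Graph n → Vec (Vec Bool n) n
toMatrix G = Vec.tabulate (λ i → Vec.tabulate (Graph.adj G i))

fromMatrix-toMatrix : ∀ {n} (G : Graph n) i j → Graph.adj (fromMatrix (toMatrix G)) i j ≡ Graph.adj G i j
fromMatrix-toMatrix G i j = trans
  (cong₂ (λ a b → (a ∧ b) ∧ not (does (i Fin.≟ j))) (entry i j) (trans (entry j i) (Graph.sym G j i)))
  (trans (cong (_∧ not (does (i Fin.≟ j))) (∧-idem (Graph.adj G i j))) off-diagonal)
  where
  entry : ∀ i j → Vec.lookup (Vec.lookup (toMatrix G) i) j ≡ Graph.adj G i j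
  entry i j = trans (cong (λ v → Vec.lookup v j) (Vec.lookup∘tabulate _ i)) (Vec.lookup∘tabulate _ j)
  off-diagonal : Graph.adj G i j ∧ not (does (i Fin.≟ j)) ≡ Graph.adj G i j
  off-diagonal with i Fin.≟ j
  ... | no  _    = ∧-identityʳ _
  ... | yes refl rewrite Graph.irrefl G i = refl

-- Searches downwards from the bound; the given instance of `P` stops the search at 0 at the latest.
maximum : ∀ {P : ℕ → Set} → Decidable P → ∀ B → (∀ e → P e → e ≤ B) → ∃ P → ∃ (IsMaximum P)
maximum P? B bound p with P? B
... | yes pB = B , pB , bound
maximum {P} P? zero bound (e , pe) | no ¬pB = contradiction (subst P (n≤0⇒n≡0 (bound e pe)) pe) ¬pB
maximum {P} P? (suc B) bound p | no ¬pB =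
  maximum P? B (λ e pe → s≤s⁻¹ (≤∧≢⇒< (bound e pe) (λ { refl → ¬pB pe }))) p

free-resp : ∀ 𝒢 {n} (G G′ : Graph n) → (∀ i j → Graph.adj G′ i j ≡ Graph.adj G i j) → Free 𝒢 G → Free 𝒢 G′
free-resp 𝒢 G G′ eq free H H∈ (f , inj , edge) = free H H∈ (f , inj , λ i j e → subst T (eq (f i) (f j)) (edge i j e))

edges-resp : ∀ {n} (G G′ : Graph n) → (∀ i j → Graph.adj G i j ≡ Graph.adj G′ i j) → Graph.edges G ≡ Graph.edges G′
edges-resp {n} G G′ eq = trans (edges≡size-map G G′ id eq)
  (trans (cong (Density.size G′) (map-id (allFin n))) (sym (FromDefs.edges≡size G′)))

ex-exists : ∀ {m} (F : Graph m) t → (∃ λ (G : Graph t) → Free (CoveringSubgraphs F) G) →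
            ∃ (Ex t (CoveringSubgraphs F))
ex-exists F t (G₀ , free₀) = maximum attained? (t * t) (λ { _ (G , _ , refl) → edges≤ G }) (_ , G₀ , (λ {j} → free₀ {j}) , refl)
  where
  edges≤ : ∀ (G : Graph t) → Graph.edges G ≤ t * t
  edges≤ G = ≤-trans (≤-reflexive (FromDefs.edges≡size G))
    (≤-trans (Density.size≤ G (allFin t)) (≤-reflexive (cong (λ k → k * k) (length-tabulate {n = t} id))))
  attained? : Decidable (λ e → ∃ λ (G : Graph t) → Free (CoveringSubgraphs F) G × Graph.edges G ≡ e)
  attained? e = map′ (λ (M , free , eq) → fromMatrix M , (λ {j} → free {j}) , eq)
    (λ (G , free , eq) → toMatrix G ,
      (λ {j} → free-resp (CoveringSubgraphs F) G (fromMatrix (toMatrix G)) (fromMatrix-toMatrix G) (λ {l} → free {l}) {j}) ,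
      trans (edges-resp (fromMatrix (toMatrix G)) G (fromMatrix-toMatrix G)) eq)
    (search-Vec (search-Vec search-Bool) (λ M → free? F (fromMatrix M) ×-dec (Graph.edges (fromMatrix M) ≟ e)))

empty : ∀ t → Graph t
empty t = record { adj = λ _ _ → false ; sym = λ _ _ → refl ; irrefl = λ _ → refl }

-- An independent vertex covering is a colour class of a proper 2-colouring.
empty-free : ∀ {m} (F : Graph m) (q : ℕ ⁺) → HasP F q → ∀ t → [ t + 1 ] ≤⁺ q → Free (CoveringSubgraphs F) (empty t)
empty-free F q p t t<q _ (cov S covers) (f , inj , edge) = absurd p t<q
  where
  colour = Vec.lookup S

  in-S : ∀ i → colour i ≡ true → ∃[ k ] enum S k ≡ i
  in-S i eq = enum-surjective S (Vec.lookup⇒[]= i S eq)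

  not-in-S : ∀ i → colour i ≡ false → i Subset.∉ S
  not-in-S i eq i∈ with () ← trans (sym eq) (Vec.[]=⇒lookup i∈)

  proper : ProperTwoColouring F colour
  proper i j i∼j eq with colour i in ci | colour j in cj
  ... | true  | true with k , refl ← in-S i ci | l , refl ← in-S j cj = edge k l i∼j
  ... | false | false = covers i j (not-in-S i ci) (not-in-S j cj) i∼j

  class≡S : colourClass colour true ≡ S
  class≡S = trans (Vec.tabulate-cong (λ i → does-true (colour i))) (Vec.tabulate∘lookup S)
    where
    does-true : ∀ b → does (b ≟ᵇ true) ≡ b
    does-true true  = refl
    does-true false = refl

  absurd : ∀ {q} → HasP F q → [ t + 1 ] ≤⁺ q → ⊥
  absurd (finite (_ , min)) t<q = <⇒≱ (≤-trans (≤-reflexive (+-comm 1 t)) ([≤]-injective t<q))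
    (≤-trans (min _ (colour , true , proper , cong ∣_∣ class≡S)) (Fin.injective⇒≤ inj))
  absurd (infinite ¬bipartite) _ = ¬bipartite (colour , proper)

-- Parity, constants and conclusion

halves : ∀ k → k ≡ ⌊ k /2⌋ + ⌊ k /2⌋ ⊎ k ≡ suc (⌊ k /2⌋ + ⌊ k /2⌋)
halves zero          = inj₁ refl
halves (suc zero)    = inj₂ refl
halves (suc (suc k)) with halves k
... | inj₁ eq = inj₁ (cong suc (trans (cong suc eq) (sym (+-suc ⌊ k /2⌋ ⌊ k /2⌋))))
... | inj₂ eq = inj₂ (cong (2 +_) (trans eq (sym (+-suc ⌊ k /2⌋ ⌊ k /2⌋))))

odd-half : ∀ k → 5 ≤ k → 2 ∤ k → k ≡ suc (⌊ k ∸ 1 /2⌋ + ⌊ k ∸ 1 /2⌋)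
odd-half (suc k) _ 2∤ with halves k
... | inj₁ eq = cong suc eq
... | inj₂ eq = contradiction (divides (suc ⌊ k /2⌋) (cong suc (trans eq
        (cong suc (trans (cong (⌊ k /2⌋ +_) (sym (+-identityʳ _))) (*-comm 2 ⌊ k /2⌋)))))) 2∤

module _ {t m} (2≤t : 2 ≤ t) (F : Graph m) where

  -- `find-biclique` with c = t + t. A side of t + 1 + m vertices suffices both for the long cycle,
  -- which wants more than t, and for the m vertices of `F`.
  threshold : ℕ
  threshold = growth (suc t + m) (t * t + ((t + t) * (t + t) + (t + t))) (suc ((t + t) * (t + t)))

  upper : ∀ {n b} → threshold < n → t ≤ n → Ex t (CoveringSubgraphs F) b →
          (G : Graph n) → TwoConnected G → Free (Cycles≥ (suc (t + t)) ∪ ｛ m , F ｝) G →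
          Graph.edges G ≤ b + t * (n ∸ t)
  upper {n} {b} large t≤n (_ , max) G (_ , conn , conn-minus) free with Graph.edges G ≤? t * (n ∸ t)
  ... | yes few = ≤-trans few (m≤n+m _ b)
  ... | no many = ≤-trans
      (edges-bound K m≤M (Extension.outside-independent G rob 2≤t (m≤m+n (suc t) m) no-long-cycle K))
      (+-monoˡ-≤ _ (core-bound (core K m≤M) (Density.Biclique.|as| K)
        (core-free K m≤M (free F (inj₂ refl)))))
    where
    open FromDefs G
    open Walks G
    open Upper G F
    m≤M : m ≤ suc t + m
    m≤M = m≤n+m m (suc t)
    rob : Robust
    rob = robust conn-minus
    2≤c : 2 ≤ t + t
    2≤c = ≤-trans 2≤t (m≤m+n t t)
    no-long-cycle : ¬ Posa.Cycle> G rob (t + t)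
    no-long-cycle = long-cycle-free 2≤c (λ l le → free (cycle l) (inj₁ (cyc l le)))
    light : ∀ us → Unique us → t + t < length us → ∃[ w ] w ∈ us × count (Graph.adj G w) us ≤ t
    light us us! long with any? (λ w → count (Graph.adj G w) us ≤? t) us
    ... | yes hit = find hit
    ... | no ¬hit = ⊥-elim
      -- Here d = t + 1, the least degree that is not light.
      (Core.no-core G rob (connected⇒walk conn) {t + t} {suc t} (s≤s z≤n)
        (≤-reflexive (cong suc (sym (+-suc t t)))) no-long-cycle us us! long
        (λ u∈ → ≰⇒> (λ le → ¬hit (Any.map (λ { refl → le }) u∈))))
    open ≤-Reasoning
    dense : t * n ≤ Density.size G (allFin n) + t * t
    dense = begin
      t * n                 ≡⟨ cong (t *_) (m∸n+n≡m t≤n) ⟨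
      t * (n ∸ t + t)       ≡⟨ *-distribˡ-+ t (n ∸ t) t ⟩
      t * (n ∸ t) + t * t   ≤⟨ +-monoˡ-≤ (t * t) (<⇒≤ (≰⇒> many)) ⟩
      Graph.edges G + t * t ≡⟨ cong (_+ t * t) edges≡size ⟩
      Density.size G (allFin n) + t * t ∎
    K : Density.Biclique G t (suc t + m)
    K = Density.find-biclique G (s≤s z≤n) light (PathBound.path-bound G rob 2≤c no-long-cycle) dense large
    core-bound : ∀ {s} (C : Graph s) → s ≡ t → Free (CoveringSubgraphs F) C → Graph.edges C ≤ b
    core-bound C refl C-free = max _ (C , (λ {j} → C-free {j}) , refl)

  ex₂-conn : ∀ {n b} → threshold < n → t + 2 ≤ n → Ex t (CoveringSubgraphs F) b →
             Ex₂₋conn n (Cycles≥ (suc (t + t)) ∪ ｛ m , F ｝) (b + t * (n ∸ t))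
  ex₂-conn {b = b} large big ex@((H , H-free , refl) , _) with r , refl ← m≤n⇒∃[o]m+o≡n (≤-trans (m≤m+n t 2) big) =
    (join , two-connected 2≤t (+-cancelˡ-≤ t _ _ big) ,
      (λ { _ (inj₁ (cyc l le)) → no-long-cycle l le ; _ (inj₂ refl) → F-free F H-free }) ,
      trans edges-join (cong (λ k → Graph.edges H + t * k) (sym (m+n∸m≡n t r)))) ,
    λ { _ (G , G₂ , G-free , refl) → upper large (m≤m+n t r) ex G G₂ G-free }
    where open Join H r

theorem4 : ∀ (k : ℕ) → 5 ≤ k → 2 ∤ k →
    let t = ⌊ k ∸ 1 /2⌋ in
    ∀ {m} (F : Graph m) (q : ℕ ⁺) → HasP F q → [ t + 1 ] ≤⁺ q →
    let 𝓕 = Cycles≥ k ∪ ｛ m , F ｝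
        𝓗 = CoveringSubgraphs F
    in
    ∃[ n₀ ] ∀ (n : ℕ) → n₀ ≤ n →
      ∃[ a ] ∃[ b ] Ex₂₋conn n 𝓕 a × Ex t 𝓗 b × a ≡ b + t * (n ∸ t)
theorem4 k 5≤k 2∤k {m} F q hasP t<q with b , ex ← ex-exists F ⌊ k ∸ 1 /2⌋ (empty _ , empty-free F q hasP _ t<q) =
  -- The summand t + 2 leaves two independent vertices in the join, which make it 2-connected.
  suc (threshold 2≤t F) + (t + 2) , λ n n₀≤n →
    b + t * (n ∸ t) , b ,
    subst (λ j → Ex₂₋conn n (Cycles≥ j ∪ ｛ m , F ｝) (b + t * (n ∸ t))) (sym k≡)
      (ex₂-conn 2≤t F (≤-trans (m≤m+n (suc (threshold 2≤t F)) (t + 2)) n₀≤n)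
        (≤-trans (m≤n+m (t + 2) (suc (threshold 2≤t F))) n₀≤n) ex) ,
    ex , refl
  where
  t = ⌊ k ∸ 1 /2⌋
  k≡ : k ≡ suc (t + t)
  k≡ = odd-half k 5≤k 2∤k
  2≤t : 2 ≤ t
  2≤t = ≮⇒≥ λ t<2 → <⇒≱ (s≤s (+-mono-≤ (s≤s⁻¹ t<2) (s≤s⁻¹ t<2)))
          (≤-trans (n≤1+n 3) (s≤s⁻¹ (subst (5 ≤_) k≡ 5≤k)))
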